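{- Let $r\ge1$ and let $\lambda,\mu$ be partitions with $\ell(\lambda)\le r$, $\ell(\mu)\le r$ (padded with zeros to $r$ parts). Then $$g_\mu^\perp G^r_\lambda(x)=\det\left(\sum_{n=0}^\infty\ \sum_{k=0}^{\mu_j-j+r}\binom{1-j}{k}\binom{i-1}{n-k}\beta^n\,h_{\lambda_i-\mu_j-i+j+n}(x)\right)_{1\le i,j\le r}.$$
   Context: The ground field is $\mathbb{C}(\beta)$; $\Lambda$ is the algebra of symmetric functions in $x=(x_1,x_2,\dots)$ over it, with Schur functions $s_\lambda$, complete symmetric functions $h_m$ ($h_0=1$, $h_m=0$ for $m<0$), and Hall inner product $\langle s_\lambda,s_\mu\rangle=\delta_{\lambda,\mu}$. $I_n=\mathrm{span}\{s_\lambda:\ell(\lambda)>n\}$ and $\widehat\Lambda=\varprojlim\Lambda/I_n$; elements of $\widehat\Lambda$ are formal sums $\sum c_\lambda s_\lambda$ such that for every $n$ only finitely many $\lambda$ with $\ell(\lambda)\le n$ have $c_\lambda\neq0$. The Hall product extends to $\widehat\Lambda\times\Lambda\to \mathbb{C}(\beta)$. For $f\in\Lambda$, $f^\perp$ is defined by $\langle f^\perp g,h\rangle=\langle g,fh\rangle$ for all $h\in\Lambda$. The stable Grothendieck polynomial $G_\lambda(x)\in\widehat\Lambda$ is the unique element such that for all $n\ge\ell(\lambda)$, $G_\lambda(x_1,\dots,x_n):=G_\lambda(x_1,\dots,x_n,0,0,\dots)=\det\bigl(x_i^{\lambda_j+n-j}(1+\beta x_i)^{j-1}\bigr)_{1\le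 i,j\le n}/\prod_{1\le i<j\le n}(x_i-x_j)$. The dual stable Grothendieck polynomials $g_\mu\in\Lambda$ are determined by $\langle G_\lambda,g_\mu\rangle=\delta_{\lambda,\mu}$. The $r$-th truncation is $G^r_\lambda(x)=\iota_r(G_\lambda(x_1,\dots,x_r))\in\Lambda$, where $\iota_r$ is the linear map from symmetric polynomials in $x_1,\dots,x_r$ to $\Lambda$ sending $s_\nu(x_1,\dots,x_r)$ to $s_\nu(x)$ for $\ell(\nu)\le r$. Binomials: $\binom{a}{n}=a(a-1)\cdots(a-n+1)/n!$ for $a\in\mathbb Z$, $n\ge0$, and $\binom an=0$ for $n<0$ (so the sum over $n$ is finite). -}

module Defs where

open import Level using (Level; _⊔_)
open import Algebra.Bundles using (CommutativeRing; RawRing)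
import Algebra.Definitions.RawSemiring as RawSemiringDefs
import Algebra.Properties.Ring as RingProperties
import Algebra.Properties.Semiring.Sum as SemiringSum
open import Data.Bool.Base using (if_then_else_)
open import Data.Fin.Base using (Fin; toℕ; punchIn)
import Data.Fin.Base as Fin
open import Data.Fin.Properties using (_<?_; toℕ≤pred[n])
open import Data.Integer.Base using (ℤ; +_; -[1+_])
import Data.Integer.Base as ℤ
open import Data.List.Base using (List; []; _∷_; _++_; length; map; foldr; filter; concatMap; mapMaybe; upTo)
open import Data.List.Properties using (≡-dec)
open import Data.List.Relation.Unary.All using (All)
import Data.List.Relation.Unary.All as All
open import Data.List.Relation.Unary.Linked using (Linked; linked?)
open import Data.List.Relation.Binary.Permutation.Propositional using (_↭_; refl; prep; swap; trans)
open import Data.Maybe.Base using (Maybe)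
import Data.Maybe.Base as Maybe
open import Data.Nat.Base using (ℕ; zero; suc; NonZero; _≤_; _<_; _≥_; _∸_; _!)
import Data.Nat.Base as ℕ
import Data.Nat.Properties as ℕₚ
open import Algebra.Properties.CommutativeSemigroup ℕₚ.+-commutativeSemigroup using (interchange)
open import Data.Nat.ListAction using (sum)
open import Data.Nat.ListAction.Properties using (sum-++; sum-↭)
open import Data.Product.Base using (_×_; _,_)
open import Relation.Binary.PropositionalEquality as ≡ using (_≡_)
open import Relation.Nullary.Decidable using (does; yes; no; dec⇒maybe; dec-false; _×-dec_)
open import Function.Base using (_∘_)

------------------------------------------------------------------------
-- Partitions

IsPartition : List ℕ → Set
IsPartition xs = Linked _≥_ xs × All NonZero xs

record Partition : Set where
  constructor mkPartition
  field
    parts       : List ℕ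
    isPartition : IsPartition parts

open Partition public

ℓ⟨_⟩ : Partition → ℕ
ℓ⟨ lam ⟩ = length (parts lam)

∣_∣ : Partition → ℕ
∣ lam ∣ = sum (parts lam)

-- Indices start at 0: part lam i is λ_{i+1}, and it is 0 beyond the
-- length of lam.
part : Partition → ℕ → ℕ
part lam = entry (parts lam)
  where
  entry : List ℕ → ℕ → ℕ
  entry []       _       = 0
  entry (x ∷ _)  zero    = x
  entry (_ ∷ xs) (suc i) = entry xs i

toPartition : List ℕ → Maybe Partition
toPartition xs =
  Maybe.map (mkPartition xs)
            (dec⇒maybe (linked? ℕₚ._≥?_ xs ×-dec All.all? ℕₚ.nonZero? xs))

tuples : (k N : ℕ) → List (List ℕ)
tuples zero    N = [] ∷ []
tuples (suc k) N = concatMap (λ a → map (a ∷_) (tuples k N)) (upTo (suc N))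

-- All partitions of size at most N, each listed once.
partitionsUpTo : ℕ → List Partition
partitionsUpTo N =
  mapMaybe toPartition
    (filter (λ xs → sum xs ℕₚ.≤? N)
            (concatMap (λ k → tuples k N) (upTo (suc N))))

------------------------------------------------------------------------
-- Binomial coefficients with an arbitrary integer on top

-- a (a - 1) ⋯ (a - n + 1)
falling : ℤ → ℕ → ℤ
falling a zero    = ℤ.1ℤ
falling a (suc n) = falling a n ℤ.* (a ℤ.- + n)

binom : ℤ → ℤ → ℤ
binom a (+ n)    = (falling a n ℤ./ℕ (n !)) {{n ℕₚ.!≢0}}
binom a -[1+ _ ] = ℤ.0ℤ

------------------------------------------------------------------------
-- Determinants

module Determinant {a b : Level} (A : RawRing a b) where
  open RawRing A
  open RawSemiringDefs rawSemiring using (_^_) renaming (sum to ∑)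

  -- Laplace expansion along the first row.
  det : ∀ {n} → (Fin n → Fin n → Carrier) → Carrier
  det {zero}  M = 1#
  det {suc n} M = ∑ λ j →
    (- 1#) ^ toℕ j * (M Fin.zero j * det (λ i k → M (Fin.suc i) (punchIn j k)))

------------------------------------------------------------------------
-- Symmetric functions over a commutative ring

module SymmetricFunctions {c ℓ : Level} (R : CommutativeRing c ℓ) where

  open CommutativeRing R
    renaming (refl to ≈-refl; sym to ≈-sym; trans to ≈-trans)
  open RawSemiringDefs (RawRing.rawSemiring rawRing) using ()
    renaming (_×_ to _×ℕ_; _^_ to _^ᴿ_)
  open SemiringSum semiring using (sum-cong-≋; ∑-comm; sum-replicate-zero)
    renaming (sum to ∑)
  open RingProperties ring using (-0#≈0#)

  fromℤ : ℤ → Carrier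
  fromℤ (+ n)    = n ×ℕ 1#
  fromℤ -[1+ n ] = - (suc n ×ℕ 1#)

  δ : Partition → Partition → Carrier
  δ lam mu = if does (≡-dec ℕₚ._≟_ (parts lam) (parts mu)) then 1# else 0#

  -- A Series is a family consisting of one formal power series over R in
  -- x_1, …, x_n for each n: its value at a list (a_1, …, a_n) is the
  -- coefficient of x_1^{a_1} ⋯ x_n^{a_n} in the member with n variables.
  -- All operations act separately for each n.
  Series : Set c
  Series = List ℕ → Carrier

  _≋_ : Series → Series → Set ℓ
  f ≋ g = ∀ α → f α ≈ g α

  -- Equality of the members with n variables.
  EqualIn : ℕ → Series → Series → Set ℓ
  EqualIn n f g = ∀ α → length α ≡ n → f α ≈ g α

  homogeneous : ℕ → Series
  homogeneous m α = if does (sum α ℕₚ.≟ m) then 1# else 0#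

  -- Σ f(β) g(γ) over all ways of writing α = β + γ.
  conv : Series → Series → Series
  conv f g []      = f [] * g []
  conv f g (a ∷ α) = ∑ {suc a} λ i →
    conv (λ β → f (toℕ i ∷ β)) (λ γ → g ((a ∸ toℕ i) ∷ γ)) α

  Series-rawRing : RawRing c ℓ
  Series-rawRing = record
    { Carrier = Series
    ; _≈_     = _≋_
    ; _+_     = λ f g α → f α + g α
    ; _*_     = conv
    ; -_      = λ f α → - f α
    ; 0#      = λ _ → 0#
    ; 1#      = homogeneous 0
    }

  infixr 7 _·_
  _·_ : Carrier → Series → Series
  (a · f) α = a * f α

  -- The variable x_{i+1}.
  var : ℕ → Series
  var i       []            = 0#
  var zero    (1 ∷ α)       = homogeneous 0 α
  var zero    (_ ∷ α)       = 0#
  var (suc i) (0 ∷ α)       = var i α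
  var (suc i) (suc _ ∷ _)   = 0#

  Symmetric : Series → Set ℓ
  Symmetric f = ∀ {α β} → α ↭ β → f α ≈ f β

  -- Setting the last variable to 0 in the member with n + 1 variables
  -- gives the member with n variables.
  Stable : Series → Set ℓ
  Stable f = ∀ α → f (α ++ 0 ∷ []) ≈ f α

  DegreeAtMost : ℕ → Series → Set ℓ
  DegreeAtMost d f = ∀ α → d < sum α → f α ≈ 0#

  -- The algebra Λ: symmetric functions as stable families of symmetric
  -- polynomials of bounded degree.
  record Λ : Set (c ⊔ ℓ) where
    field
      coeff     : Series
      degree    : ℕ
      symmetric : Symmetric coeff
      stable    : Stable coeff
      bounded   : DegreeAtMost degree coeff

  open Λ public

  infix 4 _≈Λ_
  _≈Λ_ : Λ → Λ → Set ℓ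
  f ≈Λ g = coeff f ≋ coeff g


  conv-cong : ∀ {f f′ g g′} → f ≋ f′ → g ≋ g′ → conv f g ≋ conv f′ g′
  conv-cong p q []      = *-cong (p []) (q [])
  conv-cong p q (a ∷ α) = sum-cong-≋ {suc a} λ i →
    conv-cong (λ β → p (toℕ i ∷ β)) (λ γ → q ((a ∸ toℕ i) ∷ γ)) α

  slice-symmetric : ∀ {f} → Symmetric f → ∀ x → Symmetric (λ α → f (x ∷ α))
  slice-symmetric s x p = s (prep x p)

  conv-symmetric : ∀ {f g} → Symmetric f → Symmetric g → Symmetric (conv f g)
  conv-symmetric s t refl        = ≈-refl
  conv-symmetric s t (prep x p)  = sum-cong-≋ {suc x} λ i →
    conv-symmetric (slice-symmetric s (toℕ i)) (slice-symmetric t (x ∸ toℕ i)) p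
  conv-symmetric {f} {g} s t (swap {xs = α} {ys = β} x y p) =
    ≈-trans
      (sum-cong-≋ {suc x} λ i → sum-cong-≋ {suc y} λ j →
        ≈-trans
          (conv-symmetric
            (slice-symmetric (slice-symmetric s (toℕ i)) (toℕ j))
            (slice-symmetric (slice-symmetric t (x ∸ toℕ i)) (y ∸ toℕ j)) p)
          (conv-cong (λ _ → s (swap (toℕ i) (toℕ j) refl))
                     (λ _ → t (swap (x ∸ toℕ i) (y ∸ toℕ j) refl)) β))
      (∑-comm {suc x} {suc y} λ i j →
        conv (λ γ → f (toℕ j ∷ toℕ i ∷ γ))
             (λ γ → g ((y ∸ toℕ j) ∷ (x ∸ toℕ i) ∷ γ)) β)
  conv-symmetric s t (trans p q) =
    ≈-trans (conv-symmetric s t p) (conv-symmetric s t q)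

  conv-stable : ∀ {f g} → Stable f → Stable g → Stable (conv f g)
  conv-stable s t []      =
    ≈-trans (+-identityʳ _) (*-cong (s []) (t []))
  conv-stable s t (a ∷ α) = sum-cong-≋ {suc a} λ i →
    conv-stable (λ β → s (toℕ i ∷ β)) (λ γ → t ((a ∸ toℕ i) ∷ γ)) α

  conv-vanish : ∀ f g α →
    (∀ β γ → sum β ℕ.+ sum γ ≡ sum α → f β * g γ ≈ 0#) → conv f g α ≈ 0#
  conv-vanish f g []      v = v [] [] ≡.refl
  conv-vanish f g (a ∷ α) v =
    ≈-trans
      (sum-cong-≋ {suc a} λ i → conv-vanish _ _ α λ β γ e →
        v (toℕ i ∷ β) ((a ∸ toℕ i) ∷ γ) (total i (sum β) (sum γ) e))
      (sum-replicate-zero (suc a))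
    where
    total : ∀ (i : Fin (suc a)) b c → b ℕ.+ c ≡ sum α →
            (toℕ i ℕ.+ b) ℕ.+ ((a ∸ toℕ i) ℕ.+ c) ≡ a ℕ.+ sum α
    total i b c e = ≡.trans
      (interchange (toℕ i) b (a ∸ toℕ i) c)
      (≡.cong₂ ℕ._+_ (ℕₚ.m+[n∸m]≡n (toℕ≤pred[n] i)) e)

  conv-bounded : ∀ {d e f g} → DegreeAtMost d f → DegreeAtMost e g →
                 DegreeAtMost (d ℕ.+ e) (conv f g)
  conv-bounded {d} {e} {f} {g} p q α d+e<α = conv-vanish f g α λ β γ eq →
    split β γ (≡.subst (d ℕ.+ e <_) (≡.sym eq) d+e<α)
    where
    split : ∀ β γ → d ℕ.+ e < sum β ℕ.+ sum γ → f β * g γ ≈ 0#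
    split β γ lt with d ℕₚ.<? sum β
    ... | yes d<β = ≈-trans (*-congʳ (p β d<β)) (zeroˡ _)
    ... | no  d≮β with e ℕₚ.<? sum γ
    ...   | yes e<γ = ≈-trans (*-congˡ (q γ e<γ)) (zeroʳ _)
    ...   | no  e≮γ with () ← ℕₚ.<⇒≱ lt (ℕₚ.+-mono-≤ (ℕₚ.≮⇒≥ d≮β) (ℕₚ.≮⇒≥ e≮γ))

  homogeneous-sum : ∀ m α β → sum α ≡ sum β → homogeneous m α ≈ homogeneous m β
  homogeneous-sum m α β e = reflexive
    (≡.cong (λ s → if does (s ℕₚ.≟ m) then 1# else 0#) e)

  sum-++0 : ∀ α → sum (α ++ 0 ∷ []) ≡ sum α
  sum-++0 α = ≡.trans (sum-++ α (0 ∷ [])) (ℕₚ.+-identityʳ (sum α))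

  -- Complete symmetric functions: the sum of all monomials of degree m.
  h : ℕ → Λ
  h m = record
    { coeff     = homogeneous m
    ; degree    = m
    ; symmetric = λ {α} {β} p → homogeneous-sum m α β (sum-↭ p)
    ; stable    = λ α → homogeneous-sum m (α ++ 0 ∷ []) α (sum-++0 α)
    ; bounded   = vanish
    }
    where
    vanish : DegreeAtMost m (homogeneous m)
    vanish α m<α = reflexive (≡.cong (λ b → if b then 1# else 0#)
      (dec-false (sum α ℕₚ.≟ m) (ℕₚ.<⇒≢ m<α ∘ ≡.sym)))

  infixl 6 _+Λ_
  infixl 7 _*Λ_
  infixr 7 _•_

  0Λ : Λ
  0Λ = record
    { coeff     = λ _ → 0#
    ; degree    = 0
    ; symmetric = λ _ → ≈-refl
    ; stable    = λ _ → ≈-refl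
    ; bounded   = λ _ _ → ≈-refl
    }

  _+Λ_ : Λ → Λ → Λ
  f +Λ g = record
    { coeff     = λ α → coeff f α + coeff g α
    ; degree    = degree f ℕ.⊔ degree g
    ; symmetric = λ p → +-cong (symmetric f p) (symmetric g p)
    ; stable    = λ α → +-cong (stable f α) (stable g α)
    ; bounded   = λ α lt → ≈-trans
        (+-cong (bounded f α (ℕₚ.≤-<-trans (ℕₚ.m≤m⊔n (degree f) (degree g)) lt))
                (bounded g α (ℕₚ.≤-<-trans (ℕₚ.m≤n⊔m (degree f) (degree g)) lt)))
        (+-identityˡ 0#)
    }

  -Λ_ : Λ → Λ
  -Λ f = record
    { coeff     = λ α → - coeff f α
    ; degree    = degree f
    ; symmetric = λ p → -‿cong (symmetric f p)
    ; stable    = λ α → -‿cong (stable f α)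
    ; bounded   = λ α lt → ≈-trans (-‿cong (bounded f α lt)) -0#≈0#
    }

  _*Λ_ : Λ → Λ → Λ
  f *Λ g = record
    { coeff     = conv (coeff f) (coeff g)
    ; degree    = degree f ℕ.+ degree g
    ; symmetric = conv-symmetric (symmetric f) (symmetric g)
    ; stable    = conv-stable (stable f) (stable g)
    ; bounded   = conv-bounded (bounded f) (bounded g)
    }

  _•_ : Carrier → Λ → Λ
  a • f = record
    { coeff     = a · coeff f
    ; degree    = degree f
    ; symmetric = λ p → *-congˡ (symmetric f p)
    ; stable    = λ α → *-congˡ (stable f α)
    ; bounded   = λ α lt → ≈-trans (*-congˡ (bounded f α lt)) (zeroʳ a)
    }

  Λ-rawRing : RawRing (c ⊔ ℓ) ℓ
  Λ-rawRing = record
    { Carrier = Λ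
    ; _≈_     = _≈Λ_
    ; _+_     = _+Λ_
    ; _*_     = _*Λ_
    ; -_      = -Λ_
    ; 0#      = 0Λ
    ; 1#      = h 0
    }

  module DetΛ = Determinant Λ-rawRing
  module DetS = Determinant Series-rawRing
  module S where
    open RawRing Series-rawRing public
    open RawSemiringDefs rawSemiring public using (_^_; product)
  module SumΛ = RawSemiringDefs (RawRing.rawSemiring Λ-rawRing)

  hℤ : ℤ → Λ
  hℤ (+ m)    = h m
  hℤ -[1+ _ ] = 0Λ

  -- Schur functions, by the Jacobi–Trudi formula det(h_{λ_i - i + j}).
  schur : Partition → Λ
  schur lam = DetΛ.det {ℓ⟨ lam ⟩} λ i j →
    hℤ (+ part lam (toℕ i) ℤ.- + toℕ i ℤ.+ + toℕ j)

  -- The completion of Λ: formal sums Σ c_ν s_ν such that, for every n,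
  -- c_ν vanishes for all but finitely many ν of length at most n.  As there
  -- are finitely many partitions of each size, the latter amounts to a
  -- bound on the size of the ν involved.
  record Λ̂ : Set (c ⊔ ℓ) where
    field
      coeffs : Partition → Carrier
      bound  : ℕ → ℕ
      finite : ∀ n ν → ℓ⟨ ν ⟩ ≤ n → bound n < ∣ ν ∣ → coeffs ν ≈ 0#

  open Λ̂ public

  support : ℕ → Λ̂ → List Partition
  support n f = filter (λ ν → ℓ⟨ ν ⟩ ℕₚ.≤? n) (partitionsUpTo (bound f n))

  -- f(x_1, …, x_n) = Σ_{ℓ(ν) ≤ n} c_ν s_ν(x_1, …, x_n), because
  -- s_ν(x_1, …, x_n) = 0 if ℓ(ν) > n.  Only the member with n variables of
  -- the resulting family is meaningful.
  evaluate : ℕ → Λ̂ → Series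
  evaluate n f =
    foldr (λ ν F → (coeffs f ν · coeff (schur ν)) S.+ F) S.0# (support n f)

  -- The image of f(x_1, …, x_r) under the linear map sending
  -- s_ν(x_1, …, x_r) to s_ν for ℓ(ν) ≤ r.
  truncation : ℕ → Λ̂ → Λ
  truncation r f =
    foldr (λ ν F → (coeffs f ν • schur ν) +Λ F) 0Λ (support r f)

  record HallProduct : Set (c ⊔ ℓ) where
    field
      ⟨_,_⟩       : Λ → Λ → Carrier
      ⟨⟩-cong     : ∀ {f f′ g g′} → f ≈Λ f′ → g ≈Λ g′ → ⟨ f , g ⟩ ≈ ⟨ f′ , g′ ⟩
      +-linearˡ   : ∀ f f′ g → ⟨ f +Λ f′ , g ⟩ ≈ ⟨ f , g ⟩ + ⟨ f′ , g ⟩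
      +-linearʳ   : ∀ f g g′ → ⟨ f , g +Λ g′ ⟩ ≈ ⟨ f , g ⟩ + ⟨ f , g′ ⟩
      •-linearˡ   : ∀ a f g → ⟨ a • f , g ⟩ ≈ a * ⟨ f , g ⟩
      •-linearʳ   : ∀ a f g → ⟨ f , a • g ⟩ ≈ a * ⟨ f , g ⟩
      orthonormal : ∀ lam mu → ⟨ schur lam , schur mu ⟩ ≈ δ lam mu

    -- The extension to the completion: ⟨ Σ c_ν s_ν , g ⟩ = Σ c_ν ⟨ s_ν , g ⟩,
    -- where ⟨ s_ν , g ⟩ = 0 if |ν| exceeds the degree of g.
    ⟨_,_⟩^ : Λ̂ → Λ → Carrier
    ⟨ f , g ⟩^ =
      foldr (λ ν a → coeffs f ν * ⟨ schur ν , g ⟩ + a) 0# (partitionsUpTo (degree g))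

    -- p = f^⊥ g
    IsPerp : Λ → Λ → Λ → Set (c ⊔ ℓ)
    IsPerp f g p = ∀ k → ⟨ p , k ⟩ ≈ ⟨ g , f *Λ k ⟩

  IsDualFamily : HallProduct → (Partition → Λ̂) → (Partition → Λ) → Set ℓ
  IsDualFamily H G g = ∀ lam mu → ⟨ G lam , g mu ⟩^ ≈ δ lam mu
    where open HallProduct H

  vandermonde : ℕ → Series
  vandermonde n = S.product {n} λ i → S.product {n} λ j →
    if does (i <? j) then var (toℕ i) S.+ (S.- var (toℕ j)) else S.1#

  module _ (β : Carrier) where

    -- det(x_i^{λ_j + n - j} (1 + β x_i)^{j - 1})_{1 ≤ i, j ≤ n}
    grothendieckNumerator : ℕ → Partition → Series
    grothendieckNumerator n lam = DetS.det {n} λ i j →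
      let x = var (toℕ i) in
      x S.^ (part lam (toℕ j) ℕ.+ (n ∸ suc (toℕ j))) S.* (S.1# S.+ β · x) S.^ toℕ j

    -- The quotient of the numerator by the Vandermonde product is expressed
    -- by multiplication; the latter is not a zero divisor.
    IsStableGrothendieck : (Partition → Λ̂) → Set ℓ
    IsStableGrothendieck G = ∀ lam n → ℓ⟨ lam ⟩ ≤ n →
      EqualIn n (vandermonde n S.* evaluate n (G lam)) (grothendieckNumerator n lam)

    -- With i and j counted from 0, the sum over k runs up to
    -- K = μ_{j+1} - (j+1) + r, and the summand is 0 unless k ≤ K and n - k ≤ i,
    -- so the sum over n may be stopped at i + K.
    perpMatrix : (r : ℕ) (lam mu : Partition) → Fin r → Fin r → Λ
    perpMatrix r lam mu i′ j′ =
      SumΛ.sum {suc (i ℕ.+ K)} λ n′ → SumΛ.sum {suc K} λ k′ →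
        let n = toℕ n′; k = toℕ k′ in
        (fromℤ (binom (ℤ.- (+ j)) (+ k)) * fromℤ (binom (+ i) (+ n ℤ.- + k)) * β ^ᴿ n)
          • hℤ (+ part lam i ℤ.- + part mu j ℤ.- + i ℤ.+ + j ℤ.+ + n)
      where
      i = toℕ i′
      j = toℕ j′
      K = part mu j ℕ.+ (r ∸ suc j)

    perpDeterminant : (r : ℕ) (lam mu : Partition) → Λ
    perpDeterminant r lam mu = DetΛ.det (perpMatrix r lam mu)

{-# OPTIONS --safe #-}

-- The Hall product reads off coefficients, ⟨ h_{b_1} ⋯ h_{b_r} , k ⟩ = [x^b] k, so the
-- determinant with entries Σ q_i(e) p_j(b) h_{e-b} pairs with k to
--   Σ_e q_1(e_1) ⋯ q_r(e_r) [x^e] (det(p_j(x_i)) k).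
-- The determinant of the theorem is the case where q_i are the coefficients of
-- t^{λ_i+r-i} (1 + β t)^{i-1} and p_j those of the polynomial part of
-- t^{μ_j+r-j} (1 + β/t)^{1-j}.  On the other hand ⟨ s_ν , f ⟩ = [x^{ν+δ}] (a_δ f), and
-- expanding G^r_λ in Schur functions turns ⟨ G^r_λ , g_μ k ⟩ into
--   Σ_e q_1(e_1) ⋯ q_r(e_r) [x^e] (a_δ g_μ k).
-- Hence it suffices that a_δ g_μ = det(p_j(x_i)) in r variables.  An alternating
-- polynomial in N variables is determined by its pairings with the q's of all λ,
-- because these are unitriangular; for large N these pairings are ⟨ G_λ , g_μ ⟩ = δ for
-- a_δ g_μ and a determinant of coefficients of (1 + β t)^{i-j}, again δ, for
-- det(p_j(x_i)).  Conversely p is determined by its pairings because the Schur functions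
-- span Λ, which follows from a_δ s_ν = a_{ν+δ}.

module Submission where

open import Defs
open import Algebra.Bundles using (CommutativeRing)
open import Data.Nat.Base using (ℕ; _≤_)
open import Function.Bundles using (_⇔_)

open import Algebra.Bundles using (RawRing)
import Algebra.Definitions.RawSemiring as RawSemiringDefs
import Algebra.Properties.CommutativeSemigroup as CommutativeSemigroupProperties
import Algebra.Properties.Monoid.Mult as MonoidMult
import Algebra.Properties.Ring as RingProperties
import Algebra.Properties.Semiring.Sum as SemiringSum
import Algebra.Solver.Ring.NaturalCoefficients.Default as NaturalCoefficients
open import Data.Bool.Base using (if_then_else_)
open import Data.Fin.Base using (Fin; toℕ; punchIn; inject₁; fromℕ; fromℕ<) renaming (zero to fzero; suc to fsuc)
open import Data.Fin.Properties
  using (_<?_; all?; ¬∀⟶∃¬; toℕ<n; toℕ≤pred[n]; toℕ-inject₁; toℕ-fromℕ; toℕ-fromℕ<)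
open import Data.Integer.Base using (ℤ; +_; -[1+_]; _⊖_)
import Data.Integer.Base as ℤ
import Data.Integer.Properties as ℤₚ
open import Data.Integer.Tactic.RingSolver using () renaming (solve-∀ to solveℤ-∀)
open import Data.List.Base
  using (List; []; _∷_; _++_; length; foldr; filter; map; concatMap; mapMaybe; upTo; replicate)
import Data.List.Base as List
open import Data.List.Membership.Propositional using (_∈_; _∉_)
open import Data.List.Membership.Propositional.Properties
  using (∈-filter⁺; ∈-filter⁻; ∈-concatMap⁺; ∈-concatMap⁻; ∈-map⁺; ∈-map⁻; ∈-upTo⁺)
open import Data.List.Properties
  using ( ∷-injectiveˡ; ∷-injectiveʳ; ++-assoc; ++-identityʳ; length-++; length-replicate; length-tabulate
        ; filter-all; tabulate-cong; tabulate-lookup; ≡-dec)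
open import Data.List.Relation.Binary.Permutation.Propositional as ↭ using (_↭_; ↭-sym; ↭-trans)
open import Data.List.Relation.Binary.Permutation.Propositional.Properties
  using (↭-length) renaming (shift to shift-↭)
open import Data.List.Relation.Unary.All using (All; []; _∷_)
import Data.List.Relation.Unary.All as All
open import Data.List.Relation.Unary.Any using (Any; here; there)
import Data.List.Relation.Unary.Any as Any
open import Data.List.Relation.Unary.Linked using (Linked; []; [-]; _∷_; linked?)
import Data.List.Relation.Unary.Linked as Linked
open import Data.List.Relation.Unary.Unique.Propositional using (Unique; []; _∷_)
import Data.List.Relation.Unary.Unique.Propositional.Properties as Unique
import Data.List.Sort as Sort
open import Data.Nat.Base using (zero; suc; NonZero; _<_; _≥_; _>_; _∸_; _!; z≤n; s≤s)
import Data.Nat.Base as ℕ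
import Data.Nat.DivMod as DivMod
open import Data.Nat.ListAction using (sum)
open import Data.Nat.ListAction.Properties using (sum-↭)
import Data.Nat.Properties as ℕₚ
open import Data.Product.Base using (_×_; _,_; proj₁; proj₂; ∃; ∃₂)
open import Data.Sum.Base using (_⊎_; inj₁; inj₂)
open import Data.Vec.Base using (Vec; []; _∷_; lookup)
import Data.Vec.Base as Vec
open import Data.Vec.Properties using (lookup∘tabulate)
open import Function.Base using (_∘_)
open import Function.Bundles using (mk⇔)
open import Level using (_⊔_)
import Relation.Binary.Construct.Flip.EqAndOrd as Flip
open import Relation.Binary.PropositionalEquality as ≡ using (_≡_; _≢_)
import Relation.Binary.Reasoning.Setoid as SetoidReasoning
open import Relation.Nullary.Decidable using (Dec; yes; no; does; _×-dec_; dec-true; dec-false)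
open import Relation.Nullary.Negation using (contradiction)

open CommutativeSemigroupProperties ℕₚ.+-commutativeSemigroup using (interchange; x∙yz≈y∙xz)

-- Coefficients lie in an arbitrary commutative ring, so nothing may be divided by the Vandermonde
-- product or by 2. Quotients by a_δ are read off as coefficients at exponents ν + δ, a_δ is
-- cancelled by looking at leading powers of the first variable, and vanishing on repeated exponents
-- is carried along beside antisymmetry.
--
-- The Hall product is given only by its values on Schur functions, and the g_μ only by duality.
-- That h-products pair with monomial coefficients has to be derived, from the symmetry of [x^c] h_b
-- in b and c.
--
-- Two numbers of variables occur because ⟨G_λ, g_μ⟩ may involve Schur functions of any length up to
-- the degree of g_μ, so duality can be exploited only in many variables, whereas the truncation
-- sees r of them. The bridge is that the relevant coefficients at ν + δ do not depend on the number
-- of variables.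
--
-- For j > 1 the expansion of (1 + β/t)^(1-j) does not end. Since a_δ g_μ is a polynomial, p_j must
-- stop at exponent 0 of t, and this is the upper limit of the sum over k.

-- Partitions, their enumeration, and strictly decreasing exponent lists

module Partitions where
  open ≡ using (refl; sym; trans; cong; cong₂; subst)
  open import Data.Nat.Base using (_+_)

  part-beyond : ∀ ν {i} → ℓ⟨ ν ⟩ ≤ i → part ν i ≡ 0
  part-beyond (mkPartition xs (linked , nonZero)) = beyond xs linked nonZero
    where
    beyond : ∀ xs l a {i} → length xs ≤ i → part (mkPartition xs (l , a)) i ≡ 0
    beyond []       l a le       = refl
    beyond (x ∷ xs) l a (s≤s le) = beyond xs (Linked.tail l) (All.tail a) le

  NonZero-irrelevant : ∀ {n} (p q : NonZero n) → p ≡ q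
  NonZero-irrelevant {suc n} p q = refl

  parts-injective : ∀ {ν κ} → parts ν ≡ parts κ → ν ≡ κ
  parts-injective {mkPartition xs (l , a)} {mkPartition .xs (l′ , a′)} refl =
    cong (mkPartition xs) (cong₂ _,_ (Linked.irrelevant ℕₚ.≤-irrelevant l l′) (All.irrelevant NonZero-irrelevant a a′))

  part-step : ∀ ν i → part ν (suc i) ≤ part ν i
  part-step (mkPartition xs (l , a)) = step xs l a
    where
    step : ∀ xs l a i → part (mkPartition xs (l , a)) (suc i) ≤ part (mkPartition xs (l , a)) i
    step []           l         a       i       = z≤n
    step (x ∷ [])     l         a       i       = z≤n
    step (x ∷ y ∷ xs) (x≥y ∷ l) (_ ∷ a) zero    = x≥y
    step (x ∷ y ∷ xs) (x≥y ∷ l) (_ ∷ a) (suc i) = step (y ∷ xs) l a i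

  part-antitone : ∀ ν {i j} → i ≤ j → part ν j ≤ part ν i
  part-antitone ν {i} i≤j = subst (λ j → part ν j ≤ part ν i) (ℕₚ.m∸n+n≡m i≤j) (down _)
    where
    down : ∀ d → part ν (d + i) ≤ part ν i
    down zero    = ℕₚ.≤-refl
    down (suc d) = ℕₚ.≤-trans (part-step ν (d + i)) (down d)

  part-injective : ∀ ν κ → (∀ i → part ν i ≡ part κ i) → parts ν ≡ parts κ
  part-injective (mkPartition xs (l , a)) (mkPartition ys (m , b)) = injective xs l a ys m b
    where
    injective : ∀ xs l a ys m b →
      (∀ i → part (mkPartition xs (l , a)) i ≡ part (mkPartition ys (m , b)) i) → xs ≡ ys
    injective []            l a       []            m b       eq = refl
    injective []            l a       (zero ∷ ys)   m (() ∷ b) eq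
    injective []            l a       (suc y ∷ ys)  m b       eq with () ← eq 0
    injective (zero ∷ xs)   l (() ∷ a) []           m b       eq
    injective (suc x ∷ xs)  l a       []            m b       eq with () ← eq 0
    injective (x ∷ xs)      l (_ ∷ a) (y ∷ ys)      m (_ ∷ b) eq =
      cong₂ _∷_ (eq 0) (injective xs (Linked.tail l) a ys (Linked.tail m) b (λ i → eq (suc i)))

  part-injective-< : ∀ ν κ n → ℓ⟨ ν ⟩ ≤ n → ℓ⟨ κ ⟩ ≤ n → (∀ i → i < n → part ν i ≡ part κ i) → parts ν ≡ parts κ
  part-injective-< ν κ n ℓν ℓκ eq = part-injective ν κ λ i → agree i
    where
    agree : ∀ i → part ν i ≡ part κ i
    agree i with i ℕₚ.<? n
    ... | yes i<n = eq i i<n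
    ... | no  i≮n = trans (part-beyond ν (ℕₚ.≤-trans ℓν (ℕₚ.≮⇒≥ i≮n)))
                          (sym (part-beyond κ (ℕₚ.≤-trans ℓκ (ℕₚ.≮⇒≥ i≮n))))

  length≤size : ∀ ν → ℓ⟨ ν ⟩ ≤ ∣ ν ∣
  length≤size (mkPartition xs (_ , a)) = bound xs a
    where
    bound : ∀ xs → All NonZero xs → length xs ≤ sum xs
    bound []           a       = z≤n
    bound (suc x ∷ xs) (_ ∷ a) = s≤s (ℕₚ.≤-trans (bound xs a) (ℕₚ.m≤n+m (sum xs) x))

  isPartition? : ∀ xs → Dec (IsPartition xs)
  isPartition? xs = linked? ℕₚ._≥?_ xs ×-dec All.all? ℕₚ.nonZero? xs

  -- `toPartition` packs proofs into its results, so membership and uniqueness are transported along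
  -- `parts` to a filtered list of plain lists.
  parts-mapMaybe : ∀ xss → map parts (mapMaybe toPartition xss) ≡ filter isPartition? xss
  parts-mapMaybe []         = refl
  parts-mapMaybe (xs ∷ xss) with linked? ℕₚ._≥?_ xs | All.all? ℕₚ.nonZero? xs
  ... | yes _ | yes _ = cong (xs ∷_) (parts-mapMaybe xss)
  ... | yes _ | no  _ = parts-mapMaybe xss
  ... | no  _ | yes _ = parts-mapMaybe xss
  ... | no  _ | no  _ = parts-mapMaybe xss

  -- `key` recovers from an element the block it lies in, so different blocks are disjoint; the keys
  -- used later are the length and the first entry of a list.
  unique-concatMap : ∀ {A B : Set} (f : A → List B) (key : B → A) →
    (∀ a → Unique (f a)) → (∀ a {y} → y ∈ f a → key y ≡ a) → ∀ {as} → Unique as → Unique (concatMap f as)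
  unique-concatMap f key f! key≡ []                   = []
  unique-concatMap f key f! key≡ {a ∷ as} (a∉as ∷ as!) =
    Unique.++⁺ (f! a) (unique-concatMap f key f! key≡ as!) λ (y∈fa , y∈rest) →
      All.lookup a∉as (found as (∈-concatMap⁻ f y∈rest) (key≡ a y∈fa)) refl
    where
    found : ∀ as {y} → Any (λ b → y ∈ f b) as → key y ≡ a → a ∈ as
    found (b ∷ as) (here y∈fb) eq = here (trans (sym eq) (key≡ b y∈fb))
    found (b ∷ as) (there any) eq = there (found as any eq)

  headOr0 : List ℕ → ℕ
  headOr0 []      = 0
  headOr0 (x ∷ _) = x

  tuples-length : ∀ k N {xs} → xs ∈ tuples k N → length xs ≡ k
  tuples-length zero    N (here refl) = refl
  tuples-length (suc k) N xs∈ with Any.satisfied (∈-concatMap⁻ (λ a → map (a ∷_) (tuples k N)) {xs = upTo (suc N)} xs∈)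
  ... | a , xs∈map with ∈-map⁻ (a ∷_) xs∈map
  ... | ys , ys∈ , refl = cong suc (tuples-length k N ys∈)

  tuples-unique : ∀ k N → Unique (tuples k N)
  tuples-unique zero    N = [] ∷ []
  tuples-unique (suc k) N = unique-concatMap (λ a → map (a ∷_) (tuples k N)) headOr0
    (λ a → Unique.map⁺ ∷-injectiveʳ (tuples-unique k N)) head≡ (Unique.upTo⁺ (suc N))
    where
    head≡ : ∀ a {xs} → xs ∈ map (a ∷_) (tuples k N) → headOr0 xs ≡ a
    head≡ a xs∈ with ∈-map⁻ (a ∷_) xs∈
    ... | ys , _ , refl = refl

  ∈-tuples : ∀ N xs → sum xs ≤ N → xs ∈ tuples (length xs) N
  ∈-tuples N []       _  = here refl
  ∈-tuples N (x ∷ xs) le = ∈-concatMap⁺ (λ a → map (a ∷_) (tuples (length xs) N))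
    (Any.map (λ { refl → ∈-map⁺ (x ∷_) (∈-tuples N xs (ℕₚ.≤-trans (ℕₚ.m≤n+m (sum xs) x) le)) })
      (∈-upTo⁺ (s≤s (ℕₚ.≤-trans (ℕₚ.m≤m+n x (sum xs)) le))))

  module _ (N : ℕ) where
    private
      lists : List (List ℕ)
      lists = concatMap (λ k → tuples k N) (upTo (suc N))

      parts-partitionsUpTo : map parts (partitionsUpTo N) ≡ filter isPartition? (filter (λ xs → sum xs ℕₚ.≤? N) lists)
      parts-partitionsUpTo = parts-mapMaybe (filter (λ xs → sum xs ℕₚ.≤? N) lists)

    partitionsUpTo-unique : Unique (partitionsUpTo N)
    partitionsUpTo-unique = Unique.map⁻ (subst Unique (sym parts-partitionsUpTo)
      (Unique.filter⁺ isPartition? (Unique.filter⁺ (λ xs → sum xs ℕₚ.≤? N)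
        (unique-concatMap (λ k → tuples k N) length (λ k → tuples-unique k N) (λ k → tuples-length k N)
          (Unique.upTo⁺ (suc N))))))

    ∈-partitionsUpTo : ∀ ν → ∣ ν ∣ ≤ N → ν ∈ partitionsUpTo N
    ∈-partitionsUpTo ν le with ∈-map⁻ parts (subst (parts ν ∈_) (sym parts-partitionsUpTo)
      (∈-filter⁺ isPartition? (∈-filter⁺ (λ xs → sum xs ℕₚ.≤? N)
        (∈-concatMap⁺ (λ k → tuples k N) (Any.map (λ { refl → ∈-tuples N (parts ν) le })
          (∈-upTo⁺ (s≤s (ℕₚ.≤-trans (length≤size ν) le))))) le) (isPartition ν)))
    ... | κ , κ∈ , eq = subst (_∈ partitionsUpTo N) (sym (parts-injective eq)) κ∈

    partitionsUpTo-size : ∀ {ν} → ν ∈ partitionsUpTo N → ∣ ν ∣ ≤ N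
    partitionsUpTo-size {ν} ν∈ = proj₂ (∈-filter⁻ (λ xs → sum xs ℕₚ.≤? N) {xs = lists}
      (proj₁ (∈-filter⁻ isPartition? {xs = filter (λ xs → sum xs ℕₚ.≤? N) lists}
        (subst (parts ν ∈_) parts-partitionsUpTo (∈-map⁺ parts ν∈)))))

  open Sort (Flip.decTotalOrder ℕₚ.≤-decTotalOrder) using (sort; sort-↭; sort-↗)

  decreasing-sort : ∀ xs → ∃ λ ys → ys ↭ xs × Linked _≥_ ys
  decreasing-sort xs = sort xs , sort-↭ xs , sort-↗ xs

  -- The dichotomy for exponents of an alternating series: a repetition, adjacent after sorting,
  -- kills the coefficient, and a strict list has the form ν + δ.
  strict-or-repeated : ∀ {xs} → Linked _≥_ xs →
    Linked _>_ xs ⊎ ∃ λ pre → ∃₂ λ x post → xs ≡ pre ++ x ∷ x ∷ post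
  strict-or-repeated []  = inj₁ []
  strict-or-repeated [-] = inj₁ [-]
  strict-or-repeated {x ∷ y ∷ xs} (x≥y ∷ l) with y ℕₚ.≟ x
  ... | yes refl = inj₂ ([] , x , xs , refl)
  ... | no  y≢x with strict-or-repeated l
  ...   | inj₁ strict               = inj₁ (ℕₚ.≤∧≢⇒< x≥y y≢x ∷ strict)
  ...   | inj₂ (pre , z , post , eq) = inj₂ (x ∷ pre , z , post , cong (x ∷_) eq)

  prependPart : ∀ p κ → part κ 0 ≤ p →
    ∃ λ ν → part ν 0 ≡ p × (∀ i → part ν (suc i) ≡ part κ i) × ℓ⟨ ν ⟩ ≤ suc ℓ⟨ κ ⟩
  -- A part equal to zero cannot be stored, but here all parts of `κ` are zero and `κ` itself
  -- serves.
  prependPart zero    κ le = κ , ℕₚ.n≤0⇒n≡0 le ,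
    (λ i → trans (zeros (suc i)) (sym (zeros i))) , ℕₚ.n≤1+n _
    where
    zeros : ∀ i → part κ i ≡ 0
    zeros i = ℕₚ.n≤0⇒n≡0 (ℕₚ.≤-trans (part-antitone κ {0} {i} z≤n) le)
  prependPart (suc p) (mkPartition [] (l , a)) le =
    mkPartition (suc p ∷ []) ([-] , _ ∷ a) , refl , (λ i → refl) , s≤s z≤n
  prependPart (suc p) (mkPartition (x ∷ xs) (l , a)) le =
    mkPartition (suc p ∷ x ∷ xs) (le ∷ l , _ ∷ a) , refl , (λ i → refl) , ℕₚ.≤-refl

  exponentList : Partition → ℕ → List ℕ
  exponentList ν n = List.tabulate {n = n} λ i → part ν (toℕ i) + (n ∸ suc (toℕ i))

  module _ {x : ℕ} (κ : Partition) where
    -- The first entry of `xs` is κ_0 + (length xs - 1) and `x` is larger, so x - length xs is still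
    -- at least κ_0 and can become the new first part.
    headroom : ∀ {xs} → Linked _>_ (x ∷ xs) → ℓ⟨ κ ⟩ ≤ length xs → exponentList κ (length xs) ≡ xs →
      part κ 0 + length xs ≤ x
    headroom {[]}     _         ℓκ eq = subst (_≤ x) (sym (trans (ℕₚ.+-identityʳ _) (part-beyond κ ℓκ))) z≤n
    headroom {y ∷ ys} (x>y ∷ _) ℓκ eq = subst (_≤ x)
      (sym (trans (ℕₚ.+-suc (part κ 0) (length ys)) (cong suc (∷-injectiveˡ eq)))) x>y

  strict-exponents : ∀ {xs} → Linked _>_ xs → ∃ λ ν → ℓ⟨ ν ⟩ ≤ length xs × exponentList ν (length xs) ≡ xs
  strict-exponents {[]}     _ = mkPartition [] ([] , []) , z≤n , refl
  strict-exponents {x ∷ xs} l =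
    let κ , ℓκ , eq = strict-exponents {xs} (Linked.tail l)
        room = headroom κ l ℓκ eq
        ν , head≡ , tail≡ , ℓν = prependPart (x ∸ length xs) κ (ℕₚ.m+n≤o⇒m≤o∸n (part κ 0) room)
    in ν , ℕₚ.≤-trans ℓν (s≤s ℓκ) ,
       cong₂ _∷_ (trans (cong (_+ length xs) head≡) (ℕₚ.m∸n+n≡m (ℕₚ.≤-trans (ℕₚ.m≤n+m (length xs) (part κ 0)) room)))
                 (trans (tabulate-cong (λ i → cong (_+ (length xs ∸ suc (toℕ i))) (tail≡ (toℕ i)))) eq)

open Partitions

∸-suc : ∀ {m n} → m < n → n ∸ m ≡ suc (n ∸ suc m)
∸-suc m<n = ℕₚ.+-∸-assoc 1 m<n

-- Determinants over a commutative ring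

module RingIdentities {c ℓ} (A : CommutativeRing c ℓ) where
  open CommutativeRing A
  open NaturalCoefficients commutativeSemiring using (solve; _:=_; _:+_; _:*_)
  open RingProperties ring using (-‿distribʳ-*)

  swap-factors : ∀ u s a t b d → (u * s) * (a * (t * (b * d))) ≈ (u * t) * (b * (s * (a * d)))
  swap-factors = solve 6 (λ u s a t b d →
    (u :* s) :* (a :* (t :* (b :* d))) := (u :* t) :* (b :* (s :* (a :* d)))) refl

  linear-step : ∀ s a b c d → s * ((a + c * b) * d) ≈ s * (a * d) + c * (s * (b * d))
  linear-step = solve 5 (λ s a b c d →
    s :* ((a :+ c :* b) :* d) := s :* (a :* d) :+ c :* (s :* (b :* d))) refl

  linear-step₂ : ∀ s a d c e → s * (a * (d + c * e)) ≈ s * (a * d) + c * (s * (a * e))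
  linear-step₂ = solve 5 (λ s a d c e →
    s :* (a :* (d :+ c :* e)) := s :* (a :* d) :+ c :* (s :* (a :* e))) refl

  exchange-variables : ∀ x y p q r t →
    x * (y * p + q) + (y * r + t) ≈ y * (x * p + r) + (x * q + t)
  exchange-variables = solve 6 (λ x y p q r t →
    x :* (y :* p :+ q) :+ (y :* r :+ t) := y :* (x :* p :+ r) :+ (x :* q :+ t)) refl

  into-minor : ∀ v s a d → v * (s * (a * d)) ≈ s * (a * (v * d))
  into-minor = solve 4 (λ v s a d → v :* (s :* (a :* d)) := s :* (a :* (v :* d))) refl

  neg-term : ∀ s a d → s * (a * (- d)) ≈ - (s * (a * d))
  neg-term s a d = trans (*-congˡ (sym (-‿distribʳ-* a d))) (sym (-‿distribʳ-* s (a * d)))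

module RingTheory {c ℓ} (A : CommutativeRing c ℓ) where
  open CommutativeRing A hiding (zero)
  open RawSemiringDefs (RawRing.rawSemiring rawRing) using (_^_; product)
  open SemiringSum semiring
    using (sum-cong-≋; ∑-comm; ∑-distrib-+; sum-replicate-zero; *-distribˡ-sum; sum-init-last)
    renaming (sum to ∑)
  open RingProperties ring using (-0#≈0#; -‿+-comm; -‿involutive; -1*x≈-x; -‿distribˡ-*)
  open SetoidReasoning setoid
  open RingIdentities A
  open Determinant rawRing public

  Matrix : ℕ → Set c
  Matrix n = Fin n → Fin n → Carrier

  sign : ∀ {n} → Fin n → Carrier
  sign j = (- 1#) ^ toℕ j

  ∑-zero : ∀ {n} (f : Fin n → Carrier) → (∀ i → f i ≈ 0#) → ∑ f ≈ 0#
  ∑-zero {n} f f≈0 = trans (sum-cong-≋ f≈0) (sum-replicate-zero n)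

  ∑-linear : ∀ {n} x (f g : Fin n → Carrier) → ∑ (λ i → f i + x * g i) ≈ ∑ f + x * ∑ g
  ∑-linear x f g = trans (∑-distrib-+ f (λ i → x * g i)) (+-congˡ (sym (*-distribˡ-sum x g)))

  ∑-neg : ∀ {n} (f : Fin n → Carrier) → ∑ (λ i → - f i) ≈ - ∑ f
  ∑-neg {zero}  f = sym -0#≈0#
  ∑-neg {suc n} f = trans (+-congˡ (∑-neg (f ∘ fsuc))) (-‿+-comm _ _)

  ∑-cong : ∀ {n} (f g : Fin n → Carrier) → (∀ i → f i ≈ g i) → ∑ f ≈ ∑ g
  ∑-cong f g = sum-cong-≋ {_} {f} {g}

  minor : ∀ {n} → Matrix (suc n) → Fin (suc n) → Matrix n
  minor M j i k = M (fsuc i) (punchIn j k)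

  laplace : ∀ {n} → Matrix (suc n) → Fin (suc n) → Carrier
  laplace M j = sign j * (M fzero j * det (minor M j))

  term-zero : ∀ {s a d} → a ≈ 0# → s * (a * d) ≈ 0#
  term-zero a≈0 = trans (*-congˡ (trans (*-congʳ a≈0) (zeroˡ _))) (zeroʳ _)

  minor-zero : ∀ {s a d} → d ≈ 0# → s * (a * d) ≈ 0#
  minor-zero d≈0 = trans (*-congˡ (trans (*-congˡ d≈0) (zeroʳ _))) (zeroʳ _)

  det-cong₀ : ∀ {n} (M N : Matrix (suc n)) → (∀ j → M fzero j ≈ N fzero j) →
    (∀ j → det (minor M j) ≈ det (minor N j)) → det M ≈ det N
  det-cong₀ M N top minors = ∑-cong (laplace M) (laplace N) λ j → *-congˡ (*-cong (top j) (minors j))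

  det-zero₀ : ∀ {n} (M : Matrix (suc n)) → (∀ j → det (minor M j) ≈ 0#) → det M ≈ 0#
  det-zero₀ M minors = ∑-zero (laplace M) λ j → minor-zero (minors j)

  det-cong : ∀ {n} (M N : Matrix n) → (∀ i j → M i j ≈ N i j) → det M ≈ det N
  det-cong {zero}  M N M≈N = refl
  det-cong {suc n} M N M≈N = det-cong₀ M N (M≈N fzero) λ j →
    det-cong (minor M j) (minor N j) λ i k → M≈N (fsuc i) (punchIn j k)

  columnTerm : ∀ {n} → Matrix (suc n) → Fin (suc n) → Carrier
  columnTerm M i = sign i * (M i fzero * det (λ k l → M (punchIn i k) (fsuc l)))

  -- Beyond the common corner term, both expansions are double sums over an entry of the first row
  -- and an entry of the first column, times the minor avoiding the rows and columns of both; they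
  -- differ in the order of summation.
  det-firstColumn : ∀ {n} (M : Matrix (suc n)) → det M ≈ ∑ (columnTerm M)
  det-firstColumn {zero}  M = refl
  det-firstColumn {suc n} M = +-congˡ (begin
    ∑ (laplace M ∘ fsuc)
      ≈⟨ ∑-cong (laplace M ∘ fsuc) (λ j → ∑ (T j)) (λ j → expand (sign (fsuc j)) (M fzero (fsuc j))
            (columnTerm (minor M (fsuc j))) (det-firstColumn (minor M (fsuc j)))) ⟩
    ∑ (λ j → ∑ (T j))
      ≈⟨ ∑-comm T ⟩
    ∑ (λ i → ∑ λ j → T j i)
      ≈⟨ ∑-cong (λ i → ∑ λ j → T j i) (λ i → ∑ (T′ i))
           (λ i → ∑-cong (λ j → T j i) (T′ i) (λ j → swap-factors (- 1#) _ _ _ _ _)) ⟩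
    ∑ (λ i → ∑ (T′ i))
      ≈⟨ ∑-cong (columnTerm M ∘ fsuc) (λ i → ∑ (T′ i)) (λ i → expand (sign (fsuc i)) (M (fsuc i) fzero)
           (laplace (λ k l → M (punchIn (fsuc i) k) (fsuc l))) refl) ⟨
    ∑ (columnTerm M ∘ fsuc) ∎)
    where
    D : Fin (suc n) → Fin (suc n) → Carrier
    D i j = det λ k l → M (fsuc (punchIn i k)) (fsuc (punchIn j l))
    T T′ : Fin (suc n) → Fin (suc n) → Carrier
    T j i = sign (fsuc j) * (M fzero (fsuc j) * (sign i * (M (fsuc i) fzero * D i j)))
    T′ i j = sign (fsuc i) * (M (fsuc i) fzero * (sign j * (M fzero (fsuc j) * D i j)))
    expand : ∀ {m} s a {d} (f : Fin m → Carrier) → d ≈ ∑ f → s * (a * d) ≈ ∑ λ i → s * (a * f i)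
    expand s a f d≈∑ = trans (*-congˡ (trans (*-congˡ d≈∑) (*-distribˡ-sum a f)))
                             (*-distribˡ-sum s (λ i → a * f i))

  det-transpose : ∀ {n} (M : Matrix n) → det (λ i j → M j i) ≈ det M
  det-transpose {zero}  M = refl
  det-transpose {suc n} M = trans
    (∑-cong (laplace λ i j → M j i) (columnTerm M) λ j → *-congˡ {sign j} (*-congˡ {M j fzero}
      (det-transpose λ k l → M (punchIn j k) (fsuc l))))
    (sym (det-firstColumn M))

  swap₀₁ : ∀ {n} → Fin (suc (suc n)) → Fin (suc (suc n))
  swap₀₁ fzero            = fsuc fzero
  swap₀₁ (fsuc fzero)     = fzero
  swap₀₁ (fsuc (fsuc k))  = fsuc (fsuc k)

  swap₀₁-punchIn : ∀ {m} (j : Fin (suc m)) k →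
    swap₀₁ (punchIn (fsuc (fsuc j)) k) ≡ punchIn (fsuc (fsuc j)) (swap₀₁ k)
  swap₀₁-punchIn j fzero           = ≡.refl
  swap₀₁-punchIn j (fsuc fzero)    = ≡.refl
  swap₀₁-punchIn j (fsuc (fsuc k)) = ≡.refl

  laplace₀ : ∀ {n} (M : Matrix (suc n)) → laplace M fzero ≈ M fzero fzero * det (minor M fzero)
  laplace₀ M = *-identityˡ _

  laplace₁ : ∀ {n} (M : Matrix (suc (suc n))) →
    laplace M (fsuc fzero) ≈ - (M fzero (fsuc fzero) * det (minor M (fsuc fzero)))
  laplace₁ M = trans (*-congʳ (*-identityʳ _)) (-1*x≈-x _)

  -- The first two terms of the Laplace expansion trade places with opposite signs; in every other
  -- minor the two columns are still the first two, so induction applies.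
  det-swapColumns : ∀ {n} (M : Matrix (suc (suc n))) → det (λ i j → M i (swap₀₁ j)) ≈ - det M
  det-swapColumns {n} M = begin
    laplace M′ fzero + (laplace M′ (fsuc fzero) + ∑ rest′)
      ≈⟨ +-cong (trans (laplace₀ M′) (*-congˡ (det-cong _ _ minor₀)))
                (+-cong (trans (laplace₁ M′) (-‿cong (*-congˡ (det-cong _ _ minor₁))))
                        (trans (∑-cong rest′ (λ j → - rest j) rest≈) (∑-neg rest))) ⟩
    y + (- x + - ∑ rest)
      ≈⟨ trans (+-congʳ (sym (-‿involutive y)))
               (trans (+-congˡ (-‿+-comm x (∑ rest))) (-‿+-comm (- y) (x + ∑ rest))) ⟩
    - (- y + (x + ∑ rest))
      ≈⟨ -‿cong (trans (sym (+-assoc _ _ _)) (trans (+-congʳ (+-comm _ _)) (+-assoc _ _ _))) ⟩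
    - (x + (- y + ∑ rest))
      ≈⟨ -‿cong (+-cong (laplace₀ M) (+-congʳ (laplace₁ M))) ⟨
    - (laplace M fzero + (laplace M (fsuc fzero) + ∑ rest)) ∎
    where
    M′ : Matrix (suc (suc n))
    M′ i j = M i (swap₀₁ j)
    x y : Carrier
    x = M fzero fzero * det (minor M fzero)
    y = M fzero (fsuc fzero) * det (minor M (fsuc fzero))
    rest rest′ : Fin n → Carrier
    rest j = laplace M (fsuc (fsuc j))
    rest′ j = laplace M′ (fsuc (fsuc j))
    minor₀ : ∀ i k → minor M′ fzero i k ≈ minor M (fsuc fzero) i k
    minor₀ i fzero    = refl
    minor₀ i (fsuc k) = refl
    minor₁ : ∀ i k → minor M′ (fsuc fzero) i k ≈ minor M fzero i k
    minor₁ i fzero    = refl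
    minor₁ i (fsuc k) = refl
    minor≈ : ∀ {m} (M : Matrix (suc (suc m))) (j : Fin m) →
      det (minor (λ i j → M i (swap₀₁ j)) (fsuc (fsuc j))) ≈ - det (minor M (fsuc (fsuc j)))
    minor≈ {suc m} M j = trans
      (det-cong _ _ λ i k → reflexive (≡.cong (M (fsuc i)) (swap₀₁-punchIn j k)))
      (det-swapColumns (minor M (fsuc (fsuc j))))
    rest≈ : ∀ j → rest′ j ≈ - rest j
    rest≈ j = trans (*-congˡ {sign (fsuc (fsuc j))} (*-congˡ {M fzero (fsuc (fsuc j))} (minor≈ M j)))
                    (neg-term _ _ _)

  -- Antisymmetry would give only `det M ≈ - det M`, which does not force zero when 2 is a zero
  -- divisor. Hence the separate induction, in which the first two Laplace terms cancel.
  det-equalColumns : ∀ {n} (M : Matrix (suc (suc n))) →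
    (∀ i → M i fzero ≈ M i (fsuc fzero)) → det M ≈ 0#
  det-equalColumns {n} M eq = begin
    laplace M fzero + (laplace M (fsuc fzero) + ∑ rest)
      ≈⟨ +-cong (laplace₀ M) (+-cong (laplace₁ M) (∑-zero rest rest≈)) ⟩
    x + (- y + 0#)
      ≈⟨ +-cong (*-cong (eq fzero) (det-cong _ _ minor₀)) (+-identityʳ (- y)) ⟩
    y + - y
      ≈⟨ -‿inverseʳ y ⟩
    0# ∎
    where
    x y : Carrier
    x = M fzero fzero * det (minor M fzero)
    y = M fzero (fsuc fzero) * det (minor M (fsuc fzero))
    rest : Fin n → Carrier
    rest j = laplace M (fsuc (fsuc j))
    minor₀ : ∀ i k → minor M fzero i k ≈ minor M (fsuc fzero) i k
    minor₀ i fzero    = sym (eq (fsuc i))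
    minor₀ i (fsuc k) = refl
    minor≈ : ∀ {m} (M : Matrix (suc (suc m))) → (∀ i → M i fzero ≈ M i (fsuc fzero)) → (j : Fin m) →
      det (minor M (fsuc (fsuc j))) ≈ 0#
    minor≈ {suc m} M eq j = det-equalColumns (minor M (fsuc (fsuc j))) (λ i → eq (fsuc i))
    rest≈ : ∀ j → rest j ≈ 0#
    rest≈ j = minor-zero {sign (fsuc (fsuc j))} (minor≈ M eq j)

  det-swapRows : ∀ {n} (M : Matrix (suc (suc n))) → det (λ i j → M (swap₀₁ i) j) ≈ - det M
  det-swapRows M = trans (sym (det-transpose λ i j → M (swap₀₁ i) j))
    (trans (det-swapColumns λ i j → M j i) (-‿cong (det-transpose M)))

  det-equalRows₀₁ : ∀ {n} (M : Matrix (suc (suc n))) →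
    (∀ j → M fzero j ≈ M (fsuc fzero) j) → det M ≈ 0#
  det-equalRows₀₁ M eq = trans (sym (det-transpose M)) (det-equalColumns (λ i j → M j i) eq)

  det-equalRows : ∀ {n} (M : Matrix n) i k → toℕ i < toℕ k → (∀ j → M i j ≈ M k j) → det M ≈ 0#
  det-equalRows M (fsuc i) (fsuc k) (s≤s i<k) eq = det-zero₀ M λ j →
    det-equalRows (minor M j) i k i<k (λ l → eq (punchIn j l))
  det-equalRows M fzero (fsuc fzero) _ eq = det-equalRows₀₁ M eq
  -- Exchanging rows 0 and 1 moves the first of the equal rows below the top, so that both survive
  -- in every minor.
  det-equalRows M fzero (fsuc (fsuc k)) _ eq = begin
    det M           ≈⟨ -‿involutive (det M) ⟨
    - - det M       ≈⟨ -‿cong (det-swapRows M) ⟨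
    - det M′        ≈⟨ -‿cong (det-zero₀ M′ λ j →
                         det-equalRows (minor M′ j) fzero (fsuc k) (s≤s z≤n) (λ l → eq (punchIn j l))) ⟩
    - 0#            ≈⟨ -0#≈0# ⟩
    0#              ∎
    where
    M′ : Matrix _
    M′ i j = M (swap₀₁ i) j

  infixr 5 _▹_
  _▹_ : ∀ {m n} → (Fin m → Carrier) → (Fin n → Fin m → Carrier) → Fin (suc n) → Fin m → Carrier
  (u ▹ M) fzero    = u
  (u ▹ M) (fsuc i) = M i

  ▹-cong : ∀ {m n} {u v : Fin m → Carrier} {M N : Fin n → Fin m → Carrier} →
    (∀ j → u j ≈ v j) → (∀ i j → M i j ≈ N i j) → ∀ i j → (u ▹ M) i j ≈ (v ▹ N) i j
  ▹-cong p q fzero    = p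
  ▹-cong p q (fsuc i) = q i

  det-linear₀ : ∀ {n} x (u v : Fin (suc n) → Carrier) (M : Fin n → Fin (suc n) → Carrier) →
    det ((λ j → u j + x * v j) ▹ M) ≈ det (u ▹ M) + x * det (v ▹ M)
  det-linear₀ x u v M = trans
    (∑-cong (laplace ((λ j → u j + x * v j) ▹ M)) (λ j → laplace (u ▹ M) j + x * laplace (v ▹ M) j)
      λ j → linear-step (sign j) (u j) (v j) x _)
    (∑-linear x (laplace (u ▹ M)) (laplace (v ▹ M)))

  det-linear₁ : ∀ {n} x (w u v : Fin (suc (suc n)) → Carrier) (M : Fin n → Fin (suc (suc n)) → Carrier) →
    det (w ▹ (λ j → u j + x * v j) ▹ M) ≈ det (w ▹ u ▹ M) + x * det (w ▹ v ▹ M)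
  det-linear₁ {n} x w u v M = trans
    (∑-cong (laplace (N λ j → u j + x * v j)) (λ j → laplace (N u) j + x * laplace (N v) j) λ j →
      trans (*-congˡ {sign j} (*-congˡ {w j} (trans (minor-▹ (λ j → u j + x * v j) j)
               (trans (det-linear₀ x (u ∘ punchIn j) (v ∘ punchIn j) (λ i → M i ∘ punchIn j))
                      (+-cong (sym (minor-▹ u j)) (*-congˡ (sym (minor-▹ v j))))))))
            (linear-step₂ (sign j) (w j) _ x _))
    (∑-linear x (laplace (N u)) (laplace (N v)))
    where
    N : (Fin (suc (suc n)) → Carrier) → Matrix (suc (suc n))
    N u = w ▹ u ▹ M
    minor-▹ : ∀ u j → det (minor (N u) j) ≈ det ((u ∘ punchIn j) ▹ λ i → M i ∘ punchIn j)
    minor-▹ u j = det-cong (minor (N u) j) ((u ∘ punchIn j) ▹ λ i → M i ∘ punchIn j) λ { fzero k → refl ; (fsuc i) k → refl }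

  -- Row operations carried out from the bottom up: each row is corrected by its predecessor in `r`,
  -- so induction on the minors replaces the rows from index 2 on while row 1 of `r` is kept, and
  -- then row 1 is replaced modulo row 0.
  det-chain : ∀ {n} x (r s : Matrix (suc n)) → (∀ j → r fzero j ≈ s fzero j) →
    (∀ i j → r (fsuc i) j ≈ s (fsuc i) j + x * r (inject₁ i) j) → det r ≈ det s
  det-chain {zero}  x r s top step = det-cong r s λ { fzero j → top j }
  det-chain {suc n} x r s top step = begin
    det r
      ≈⟨ det-cong₀ r (s fzero ▹ r (fsuc fzero) ▹ N) top (λ j →
           det-chain x (minor r j) (minor (s fzero ▹ r (fsuc fzero) ▹ N) j) (λ _ → refl)
             (λ i k → step (fsuc i) (punchIn j k))) ⟩
    det (s fzero ▹ r (fsuc fzero) ▹ N)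
      ≈⟨ det-cong (s fzero ▹ r (fsuc fzero) ▹ N) (s fzero ▹ u ▹ N) (▹-cong {N = u ▹ N} (λ _ → refl)
           (▹-cong {N = N} (λ j → trans (step fzero j) (+-congˡ (*-congˡ (top j)))) (λ _ _ → refl))) ⟩
    det (s fzero ▹ u ▹ N)
      ≈⟨ det-linear₁ x (s fzero) (s (fsuc fzero)) (s fzero) N ⟩
    det (s fzero ▹ s (fsuc fzero) ▹ N) + x * det (s fzero ▹ s fzero ▹ N)
      ≈⟨ +-cong (det-cong (s fzero ▹ s (fsuc fzero) ▹ N) s λ
                   { fzero j → refl ; (fsuc fzero) j → refl ; (fsuc (fsuc i)) j → refl })
                (trans (*-congˡ (det-equalRows₀₁ (s fzero ▹ s fzero ▹ N) (λ _ → refl))) (zeroʳ x)) ⟩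
    det s + 0#
      ≈⟨ +-identityʳ _ ⟩
    det s ∎
    where
    u : Fin (suc (suc n)) → Carrier
    u j = s (fsuc fzero) j + x * s fzero j
    N : Fin n → Fin (suc (suc n)) → Carrier
    N i = s (fsuc (fsuc i))

  det-zeroRow : ∀ {n} (M : Matrix n) i → (∀ j → M i j ≈ 0#) → det M ≈ 0#
  det-zeroRow M fzero    row≈0 = ∑-zero (laplace M) λ j → term-zero {sign j} (row≈0 j)
  det-zeroRow M (fsuc i) row≈0 = det-zero₀ M λ j → det-zeroRow (minor M j) i (row≈0 ∘ punchIn j)

  det-topRow : ∀ {n} (M : Matrix (suc n)) → (∀ j → M fzero (fsuc j) ≈ 0#) →
    det M ≈ M fzero fzero * det (minor M fzero)
  det-topRow M row≈0 = trans
    (+-cong (laplace₀ M) (∑-zero (laplace M ∘ fsuc) λ j → term-zero {sign (fsuc j)} (row≈0 j)))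
    (+-identityʳ _)

  -- In the expansion along the first row, the minor of the last column has a zero row, and the
  -- other minors again end in a row of this shape.
  det-lastRow : ∀ {n} (M : Matrix (suc n)) →
    (∀ j → M (fromℕ n) (inject₁ j) ≈ 0#) → M (fromℕ n) (fromℕ n) ≈ 1# →
    det M ≈ det (λ i j → M (inject₁ i) (inject₁ j))
  det-lastRow {zero}  M row≈0 corner≈1 =
    trans (+-identityʳ _) (trans (*-identityˡ _) (trans (*-identityʳ _) corner≈1))
  det-lastRow {suc n} M row≈0 corner≈1 = begin
    det M
      ≈⟨ sum-init-last (laplace M) ⟩
    ∑ (laplace M ∘ inject₁) + laplace M (fromℕ (suc n))
      ≈⟨ +-cong (∑-cong (laplace M ∘ inject₁) (laplace M′) init≈) (minor-zero (det-zeroRow (minor M (fromℕ (suc n)))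
           (fromℕ n) λ j → trans (reflexive (≡.cong (M (fsuc (fromℕ n))) (punchIn-fromℕ j))) (row≈0 j))) ⟩
    ∑ (laplace M′) + 0#
      ≈⟨ +-identityʳ _ ⟩
    det M′ ∎
    where
    M′ : Matrix (suc n)
    M′ i j = M (inject₁ i) (inject₁ j)
    punchIn-fromℕ : ∀ {m} (k : Fin m) → punchIn (fromℕ m) k ≡ inject₁ k
    punchIn-fromℕ fzero    = ≡.refl
    punchIn-fromℕ (fsuc k) = ≡.cong fsuc (punchIn-fromℕ k)
    punchIn-inject₁ : ∀ {m} (j : Fin (suc m)) k → punchIn (inject₁ j) (inject₁ k) ≡ inject₁ (punchIn j k)
    punchIn-inject₁ fzero    k        = ≡.refl
    punchIn-inject₁ (fsuc j) fzero    = ≡.refl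
    punchIn-inject₁ (fsuc j) (fsuc k) = ≡.cong fsuc (punchIn-inject₁ j k)
    punchIn-inject₁-fromℕ : ∀ {m} (j : Fin (suc m)) → punchIn (inject₁ j) (fromℕ m) ≡ fromℕ (suc m)
    punchIn-inject₁-fromℕ         fzero    = ≡.refl
    punchIn-inject₁-fromℕ {suc m} (fsuc j) = ≡.cong fsuc (punchIn-inject₁-fromℕ j)
    at : ∀ {j k} → j ≡ k → M (fsuc (fromℕ n)) j ≈ M (fsuc (fromℕ n)) k
    at j≡k = reflexive (≡.cong (M (fsuc (fromℕ n))) j≡k)
    init≈ : ∀ j → laplace M (inject₁ j) ≈ laplace M′ j
    init≈ j = *-cong (reflexive (≡.cong ((- 1#) ^_) (toℕ-inject₁ j))) (*-congˡ {M fzero (inject₁ j)}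
      (trans (det-lastRow (minor M (inject₁ j))
                (λ k → trans (at (punchIn-inject₁ j k)) (row≈0 (punchIn j k)))
                (trans (at (punchIn-inject₁-fromℕ j)) corner≈1))
             (det-cong _ _ λ i k → reflexive (≡.cong (M (fsuc (inject₁ i))) (punchIn-inject₁ j k)))))

  -- If lam 0 < mu 0 the first column vanishes, otherwise the first row vanishes
  -- off the diagonal.
  det-crossing : ∀ {n} (M : Matrix n) (lam mu : Fin n → ℕ) →
    (∀ {i j} → toℕ i ≤ toℕ j → lam j ≤ lam i) → (∀ {i j} → toℕ i ≤ toℕ j → mu j ≤ mu i) →
    (∀ i j → toℕ i < toℕ j → mu j ≤ lam i → M i j ≈ 0#) →
    (∀ i j → toℕ j < toℕ i → lam i < mu j → M i j ≈ 0#) →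
    (∀ i → lam i ≢ mu i → M i i ≈ 0#) →
    det M ≈ product (λ i → M i i)
  det-crossing {zero}  M lam mu lam↓ mu↓ upper lower diag = refl
  det-crossing {suc n} M lam mu lam↓ mu↓ upper lower diag = trans split
    (*-congˡ (det-crossing (minor M fzero) (lam ∘ fsuc) (mu ∘ fsuc)
      (λ i≤j → lam↓ (s≤s i≤j)) (λ i≤j → mu↓ (s≤s i≤j))
      (λ i j i<j → upper (fsuc i) (fsuc j) (s≤s i<j)) (λ i j j<i → lower (fsuc i) (fsuc j) (s≤s j<i))
      (λ i → diag (fsuc i))))
    where
    split : det M ≈ M fzero fzero * det (minor M fzero)
    split with mu fzero ℕₚ.≤? lam fzero
    ... | yes mu≤lam = det-topRow M λ j → upper fzero (fsuc j) (s≤s z≤n) (ℕₚ.≤-trans (mu↓ z≤n) mu≤lam)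
    ... | no  mu≰lam = trans
      (trans (sym (det-transpose M)) (det-zeroRow (λ i j → M j i) fzero
        λ { fzero → corner≈0 ; (fsuc i) → lower (fsuc i) fzero (s≤s z≤n)
              (ℕₚ.≤-<-trans (lam↓ z≤n) (ℕₚ.≰⇒> mu≰lam)) }))
      (sym (trans (*-congʳ corner≈0) (zeroˡ _)))
      where
      corner≈0 : M fzero fzero ≈ 0#
      corner≈0 = diag fzero λ lam≡mu → mu≰lam (ℕₚ.≤-reflexive (≡.sym lam≡mu))

  -- Complete symmetric polynomials and the bialternant formula

  complete : ∀ {n} → Vec Carrier n → ℕ → Carrier
  complete xs       zero    = 1#
  complete []       (suc m) = 0#
  complete (x ∷ xs) (suc m) = x * complete (x ∷ xs) m + complete xs (suc m)

  -- This is f (b - s), read as zero for b < s. It replaces integer indices, so that h_m = 0 for m <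
  -- 0 holds by computation.
  shifted : (ℕ → Carrier) → ℕ → ℕ → Carrier
  shifted f b       zero    = f b
  shifted f zero    (suc s) = 0#
  shifted f (suc b) (suc s) = shifted f b s

  shifted-recurrence : ∀ (f g : ℕ → Carrier) x → f 0 ≈ g 0 → (∀ m → f (suc m) ≈ x * f m + g (suc m)) →
    ∀ b s → shifted f b s ≈ shifted g b s + x * shifted f b (suc s)
  shifted-recurrence f g x base step zero    zero    = trans base (sym (trans (+-congˡ (zeroʳ x)) (+-identityʳ _)))
  shifted-recurrence f g x base step (suc b) zero    = trans (step b) (+-comm _ _)
  shifted-recurrence f g x base step zero    (suc s) = sym (trans (+-congˡ (zeroʳ x)) (+-identityʳ _))
  shifted-recurrence f g x base step (suc b) (suc s) = shifted-recurrence f g x base step b s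

  -- By the symmetry of h_m the recurrence may split off the second variable instead of the first;
  -- `newton` compares the two.
  complete-second : ∀ {n} x y (xs : Vec Carrier n) m →
    complete (x ∷ y ∷ xs) (suc m) ≈ y * complete (x ∷ y ∷ xs) m + complete (x ∷ xs) (suc m)
  complete-second x y xs zero    =
    trans (sym (+-assoc _ _ _)) (trans (+-congʳ (+-comm _ _)) (+-assoc _ _ _))
  complete-second x y xs (suc m) = trans (+-congʳ (*-congˡ (complete-second x y xs m)))
    (exchange-variables x y _ _ _ _)

  power-complete : ∀ x m → complete (x ∷ []) m ≈ x ^ m
  power-complete x zero    = refl
  power-complete x (suc m) = trans (+-identityʳ _) (*-congˡ (power-complete x m))

  differences : ∀ {n} → Carrier → Vec Carrier n → Carrier
  differences x []       = 1#
  differences x (y ∷ ys) = (x + - y) * differences x ys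

  vandermondeProduct : ∀ {n} → Vec Carrier n → Carrier
  vandermondeProduct []       = 1#
  vandermondeProduct (x ∷ xs) = differences x xs * vandermondeProduct xs

  module _ {n} (rows : Fin n → Fin (suc n) → Carrier) (b : Fin (suc n) → ℕ) where

    withTop : (ℕ → Carrier) → Carrier
    withTop f = det ((f ∘ b) ▹ rows)

    withTop-linear : ∀ {f g h : ℕ → Carrier} x → (∀ m → f m ≈ g m + x * h m) →
      withTop f ≈ withTop g + x * withTop h
    withTop-linear {f} {g} {h} x eq = trans
      (det-cong ((f ∘ b) ▹ rows) ((λ j → g (b j) + x * h (b j)) ▹ rows)
        (▹-cong {N = rows} (λ j → eq (b j)) (λ _ _ → refl)))
      (det-linear₀ x (g ∘ b) (h ∘ b) rows)

    -- complete xs is a divided difference of the powers.  Modulo the given rows, the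
    -- recursion for divided differences leaves only the powers of x.
    newton : ∀ x {m} (xs : Vec Carrier m) →
      (∀ s → s < m → withTop (λ k → shifted (complete xs) k s) ≈ 0#) →
      differences x xs * withTop (λ k → shifted (complete (x ∷ xs)) k m) ≈ withTop (x ^_)
    newton x [] _ = trans (*-identityˡ _)
      (det-cong (_ ▹ rows) (_ ▹ rows) (▹-cong {N = rows} (λ j → power-complete x (b j)) (λ _ _ → refl)))
    newton x {suc m} (y ∷ xs) vanish = begin
      ((x + - y) * differences x xs) * withTop (λ k → shifted (complete (x ∷ y ∷ xs)) k (suc m))
        ≈⟨ trans (*-congʳ (*-comm _ _)) (*-assoc _ _ _) ⟩
      differences x xs * ((x + - y) * withTop (λ k → shifted (complete (x ∷ y ∷ xs)) k (suc m)))
        ≈⟨ *-congˡ divided ⟩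
      differences x xs * withTop (λ k → shifted (complete (x ∷ xs)) k m)
        ≈⟨ newton x xs vanish′ ⟩
      withTop (x ^_) ∎
      where
      D X Y : Carrier
      D = withTop λ k → shifted (complete (x ∷ y ∷ xs)) k (suc m)
      X = withTop λ k → shifted (complete (x ∷ xs)) k m
      Y = withTop λ k → shifted (complete (y ∷ xs)) k m
      -- Both sides equal the determinant with top row h_(k-m)(x, y, xs), once with y and once with
      -- x split off. As `Y` vanishes by hypothesis, (x - y) D is `X`.
      both : X + y * D ≈ Y + x * D
      both = trans
        (sym (withTop-linear y λ k → shifted-recurrence (complete (x ∷ y ∷ xs)) (complete (x ∷ xs)) y
                                       refl (complete-second x y xs) k m))
        (withTop-linear x λ k → shifted-recurrence (complete (x ∷ y ∷ xs)) (complete (y ∷ xs)) x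
                                  refl (λ _ → refl) k m)
      divided : (x + - y) * D ≈ X
      divided = begin
        (x + - y) * D          ≈⟨ distribʳ D x (- y) ⟩
        x * D + - y * D        ≈⟨ +-congʳ (trans (sym (+-identityˡ _)) (+-congʳ (sym (vanish m ℕₚ.≤-refl)))) ⟩
        Y + x * D + - y * D    ≈⟨ +-cong (sym both) (sym (-‿distribˡ-* y D)) ⟩
        X + y * D + - (y * D)  ≈⟨ trans (+-assoc _ _ _) (trans (+-congˡ (-‿inverseʳ _)) (+-identityʳ X)) ⟩
        X ∎
      vanish′ : ∀ s → s < m → withTop (λ k → shifted (complete xs) k s) ≈ 0#
      vanish′ s s<m = begin
        withTop (λ k → shifted (complete xs) k s)
          ≈⟨ trans (+-congˡ (trans (*-congˡ (vanish (suc s) (s≤s s<m))) (zeroʳ y))) (+-identityʳ _) ⟨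
        withTop (λ k → shifted (complete xs) k s) + y * withTop (λ k → shifted (complete (y ∷ xs)) k (suc s))
          ≈⟨ withTop-linear y (λ k → shifted-recurrence (complete (y ∷ xs)) (complete xs) y
               refl (λ _ → refl) k s) ⟨
        withTop (λ k → shifted (complete (y ∷ xs)) k s)
          ≈⟨ vanish s (ℕₚ.m≤n⇒m≤1+n s<m) ⟩
        0# ∎

  jacobiTrudi : ∀ {n m} → Vec Carrier n → (Fin m → ℕ) → Fin n → Fin m → Carrier
  jacobiTrudi {n} xs b i j = shifted (complete xs) (b j) (n ∸ suc (toℕ i))

  -- Row operations remove x from all rows but the first, `newton` turns the first row into powers
  -- of x at the cost of the factors x - y, and expansion along that row leaves the same claim for
  -- `xs`.
  bialternant : ∀ {n} (xs : Vec Carrier n) (b : Fin n → ℕ) →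
    vandermondeProduct xs * det (jacobiTrudi xs b) ≈ det (λ i j → lookup xs i ^ b j)
  bialternant []               b = *-identityˡ 1#
  bialternant {suc n} (x ∷ xs) b = begin
    (differences x xs * vandermondeProduct xs) * det (jacobiTrudi (x ∷ xs) b)
      ≈⟨ *-congˡ (det-chain x (jacobiTrudi (x ∷ xs) b) (top ▹ rows) (λ _ → refl) step) ⟩
    (differences x xs * vandermondeProduct xs) * det (top ▹ rows)
      ≈⟨ trans (*-congʳ (*-comm _ _)) (*-assoc _ _ _) ⟩
    vandermondeProduct xs * (differences x xs * det (top ▹ rows))
      ≈⟨ *-congˡ (newton rows b x xs vanish) ⟩
    vandermondeProduct xs * det ((λ j → x ^ b j) ▹ rows)
      ≈⟨ *-distribˡ-sum _ (laplace ((λ j → x ^ b j) ▹ rows)) ⟩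
    ∑ (λ j → vandermondeProduct xs * laplace ((λ j → x ^ b j) ▹ rows) j)
      ≈⟨ ∑-cong (λ j → vandermondeProduct xs * laplace ((λ j → x ^ b j) ▹ rows) j) (laplace X)
           (λ j → trans (into-minor _ (sign j) _ _) (*-congˡ (*-congˡ (bialternant xs (b ∘ punchIn j))))) ⟩
    det X ∎
    where
    X : Matrix (suc n)
    X i j = lookup (x ∷ xs) i ^ b j
    top : Fin (suc n) → Carrier
    top j = shifted (complete (x ∷ xs)) (b j) n
    rows : Fin n → Fin (suc n) → Carrier
    rows = jacobiTrudi xs b
    step : ∀ i j → jacobiTrudi (x ∷ xs) b (fsuc i) j ≈ rows i j + x * jacobiTrudi (x ∷ xs) b (inject₁ i) j
    step i j = trans
      (shifted-recurrence (complete (x ∷ xs)) (complete xs) x refl (λ _ → refl) (b j) (n ∸ suc (toℕ i)))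
      (+-congˡ (*-congˡ (reflexive (≡.cong (shifted (complete (x ∷ xs)) (b j))
        (≡.trans (≡.sym (∸-suc (toℕ<n i))) (≡.cong (n ∸_) (≡.sym (toℕ-inject₁ i))))))))
    -- The rows below carry the shifts n - 1, ..., 0, so a top row with shift s repeats the one of
    -- index n - 1 - s.
    vanish : ∀ s → s < n → det ((λ j → shifted (complete xs) (b j) s) ▹ rows) ≈ 0#
    vanish s s<n = det-equalRows ((λ j → shifted (complete xs) (b j) s) ▹ rows) fzero (fsuc i) (s≤s z≤n) λ j →
      reflexive (≡.cong (shifted (complete xs) (b j)) (≡.sym shift≡))
      where
      i : Fin n
      i = fromℕ< {n ∸ suc s} (ℕₚ.∸-monoʳ-< {n} {suc s} {0} (s≤s z≤n) s<n)
      shift≡ : n ∸ suc (toℕ i) ≡ s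
      shift≡ = ≡.trans (≡.cong (λ t → n ∸ suc t) (toℕ-fromℕ< _))
        (≡.trans (≡.cong (n ∸_) (≡.sym (∸-suc s<n))) (ℕₚ.m∸[m∸n]≡n (ℕₚ.<⇒≤ s<n)))

-- The source need only be a raw ring, so that determinants over `Λ`, for which no ring laws are
-- proved, can be moved along `coeff` into the ring of series.
module DetHom {a b c ℓ} (A : RawRing a b) (B : CommutativeRing c ℓ) where
  private module A = RawRing A
  open CommutativeRing B
  open RawSemiringDefs A.rawSemiring using () renaming (_^_ to _^ᴬ_; sum to ∑ᴬ)
  open RawSemiringDefs (RawRing.rawSemiring rawRing) using (_^_) renaming (sum to ∑)
  open RingTheory B using (∑-cong; laplace)
  private
    module DA = Determinant A
    module DB = Determinant rawRing

  module _ (φ : A.Carrier → Carrier)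
           (φ-+ : ∀ x y → φ (x A.+ y) ≈ φ x + φ y) (φ-* : ∀ x y → φ (x A.* y) ≈ φ x * φ y)
           (φ-neg : ∀ x → φ (A.- x) ≈ - φ x) (φ-0 : φ A.0# ≈ 0#) (φ-1 : φ A.1# ≈ 1#) where

    hom-sum : ∀ {n} (f : Fin n → A.Carrier) → φ (∑ᴬ f) ≈ ∑ (φ ∘ f)
    hom-sum {zero}  f = φ-0
    hom-sum {suc n} f = trans (φ-+ _ _) (+-congˡ (hom-sum (f ∘ fsuc)))

    hom-power : ∀ x n → φ (x ^ᴬ n) ≈ φ x ^ n
    hom-power x zero    = φ-1
    hom-power x (suc n) = trans (φ-* _ _) (*-congˡ (hom-power x n))

    hom-sign : ∀ n → φ ((A.- A.1#) ^ᴬ n) ≈ (- 1#) ^ n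
    hom-sign zero    = φ-1
    hom-sign (suc n) = trans (φ-* _ _) (*-cong (trans (φ-neg _) (-‿cong φ-1)) (hom-sign n))

    hom-det : ∀ {n} (M : Fin n → Fin n → A.Carrier) → φ (DA.det M) ≈ DB.det (λ i j → φ (M i j))
    hom-det {zero}  M = φ-1
    hom-det {suc n} M = trans (hom-sum λ j → (A.- A.1#) ^ᴬ toℕ j A.* (M fzero j A.* DA.det (λ i k → M (fsuc i) (punchIn j k))))
      (∑-cong (λ j → φ ((A.- A.1#) ^ᴬ toℕ j A.* (M fzero j A.* DA.det (λ i k → M (fsuc i) (punchIn j k)))))
              (laplace λ i j → φ (M i j)) λ j →
        trans (φ-* _ _) (*-cong (hom-sign (toℕ j)) (trans (φ-* _ _) (*-congˡ (hom-det λ i k → M (fsuc i) (punchIn j k))))))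

-- Sums over pairs of natural numbers with a given total

module CauchySums {c ℓ} (R : CommutativeRing c ℓ) where
  open CommutativeRing R hiding (zero)
  open SemiringSum semiring using () renaming (sum to ∑)
  open RingTheory R using (∑-cong; ∑-zero; ∑-linear)
  open SetoidReasoning setoid

  cauchy : ℕ → (ℕ → ℕ → Carrier) → Carrier
  cauchy a F = ∑ {suc a} λ i → F (toℕ i) (a ∸ toℕ i)

  cauchy-cong : ∀ a {F G : ℕ → ℕ → Carrier} → (∀ i j → F i j ≈ G i j) → cauchy a F ≈ cauchy a G
  cauchy-cong a {F} {G} eq =
    ∑-cong {suc a} (λ i → F (toℕ i) (a ∸ toℕ i)) (λ i → G (toℕ i) (a ∸ toℕ i)) λ i → eq _ _

  cauchy-zero : ∀ a {F : ℕ → ℕ → Carrier} → (∀ i j → F i j ≈ 0#) → cauchy a F ≈ 0#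
  cauchy-zero a {F} eq = ∑-zero {suc a} (λ i → F (toℕ i) (a ∸ toℕ i)) λ i → eq _ _

  cauchy-linear : ∀ a x (F G : ℕ → ℕ → Carrier) →
    cauchy a (λ i j → F i j + x * G i j) ≈ cauchy a F + x * cauchy a G
  cauchy-linear a x F G =
    ∑-linear {suc a} x (λ i → F (toℕ i) (a ∸ toℕ i)) (λ i → G (toℕ i) (a ∸ toℕ i))

  cauchy-last : ∀ a (F : ℕ → ℕ → Carrier) →
    cauchy (suc a) F ≈ cauchy a (λ i j → F i (suc j)) + F (suc a) 0
  cauchy-last zero    F = trans (+-congˡ (+-identityʳ _)) (+-congʳ (sym (+-identityʳ _)))
  cauchy-last (suc a) F = trans (+-congˡ (cauchy-last a (λ i j → F (suc i) j))) (sym (+-assoc _ _ _))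

  cauchy-comm : ∀ a (F : ℕ → ℕ → Carrier) → cauchy a F ≈ cauchy a (λ i j → F j i)
  cauchy-comm zero    F = refl
  cauchy-comm (suc a) F = trans (+-congˡ (cauchy-comm a (λ i j → F (suc i) j)))
    (trans (+-comm _ _) (sym (cauchy-last a (λ i j → F j i))))

  cauchy-final : ∀ a (F : ℕ → ℕ → Carrier) → (∀ i j → F i (suc j) ≈ 0#) → cauchy a F ≈ F a 0
  cauchy-final zero    F eq = +-identityʳ _
  cauchy-final (suc a) F eq = trans (cauchy-last a F)
    (trans (+-congʳ (cauchy-zero a eq)) (+-identityˡ _))

  cauchy-+ : ∀ a (F G : ℕ → ℕ → Carrier) → cauchy a (λ i j → F i j + G i j) ≈ cauchy a F + cauchy a G
  cauchy-+ a F G = trans (cauchy-cong a {λ i j → F i j + G i j} {λ i j → F i j + 1# * G i j} λ i j → +-congˡ (sym (*-identityˡ _)))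
    (trans (cauchy-linear a 1# F G) (+-congˡ (*-identityˡ _)))

  -- Both sides sum T j l k over j + l + k = a; the terms with j = 0 are split off and the rest is
  -- the same claim for a - 1.
  cauchy-assoc : ∀ a (T : ℕ → ℕ → ℕ → Carrier) →
    cauchy a (λ i k → cauchy i (λ j l → T j l k)) ≈ cauchy a (λ j m → cauchy m (λ l k → T j l k))
  cauchy-assoc zero    T = refl
  cauchy-assoc (suc a) T = begin
    (T 0 0 (suc a) + 0#) + cauchy a (λ i k → T 0 (suc i) k + cauchy i (λ j l → T (suc j) l k))
      ≈⟨ +-cong (+-identityʳ _) (cauchy-+ a (λ i k → T 0 (suc i) k) (λ i k → cauchy i (λ j l → T (suc j) l k))) ⟩
    T 0 0 (suc a) + (cauchy a (λ i k → T 0 (suc i) k) + cauchy a (λ i k → cauchy i (λ j l → T (suc j) l k)))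
      ≈⟨ trans (sym (+-assoc _ _ _)) (+-congˡ (cauchy-assoc a (λ j → T (suc j)))) ⟩
    cauchy (suc a) (λ l k → T 0 l k) + cauchy a (λ j m → cauchy m (λ l k → T (suc j) l k)) ∎

-- The commutative ring of series

module SeriesRing {c ℓ} (R : CommutativeRing c ℓ) where
  open SymmetricFunctions R
  open CommutativeRing R hiding (zero)
  open SemiringSum semiring using (∑-comm; *-distribʳ-sum; *-distribˡ-sum) renaming (sum to ∑)
  open RawSemiringDefs (RawRing.rawSemiring rawRing) using (_^_)
  open RingProperties ring using (-0#≈0#; -‿distribˡ-*)
  open SetoidReasoning setoid
  open RingTheory R using (∑-cong)
  open CauchySums R

  conv-comm : ∀ f g → conv f g ≋ conv g f
  conv-comm f g []      = *-comm _ _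
  conv-comm f g (a ∷ α) = trans
    (cauchy-cong a λ i j → conv-comm (λ β → f (i ∷ β)) (λ γ → g (j ∷ γ)) α)
    (cauchy-comm a λ i j → conv (λ γ → g (j ∷ γ)) (λ β → f (i ∷ β)) α)

  conv-∑ˡ : ∀ {n} (f : Fin n → Series) g α → conv (λ β → ∑ λ i → f i β) g α ≈ ∑ λ i → conv (f i) g α
  conv-∑ˡ f g []      = *-distribʳ-sum (g []) (λ i → f i [])
  conv-∑ˡ f g (a ∷ α) = trans
    (∑-cong {suc a} _ (λ p → ∑ λ i → conv (λ β → f i (toℕ p ∷ β)) (λ γ → g ((a ∸ toℕ p) ∷ γ)) α)
      λ p → conv-∑ˡ (λ i β → f i (toℕ p ∷ β)) _ α)
    (∑-comm {suc a} λ p i → conv (λ β → f i (toℕ p ∷ β)) (λ γ → g ((a ∸ toℕ p) ∷ γ)) α)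

  conv-linearˡ : ∀ x f f′ g α → conv (λ β → f β + x * f′ β) g α ≈ conv f g α + x * conv f′ g α
  conv-linearˡ x f f′ g []      = trans (distribʳ _ _ _) (+-congˡ (*-assoc _ _ _))
  conv-linearˡ x f f′ g (a ∷ α) = trans
    (cauchy-cong a λ i j → conv-linearˡ x (λ β → f (i ∷ β)) (λ β → f′ (i ∷ β)) (λ γ → g (j ∷ γ)) α)
    (cauchy-linear a x (λ i j → conv (λ β → f (i ∷ β)) (λ γ → g (j ∷ γ)) α)
                       (λ i j → conv (λ β → f′ (i ∷ β)) (λ γ → g (j ∷ γ)) α))

  conv-zeroˡ : ∀ {f} g → (∀ β → f β ≈ 0#) → ∀ α → conv f g α ≈ 0#
  conv-zeroˡ g f≈0 []      = trans (*-congʳ (f≈0 [])) (zeroˡ _)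
  conv-zeroˡ g f≈0 (a ∷ α) = cauchy-zero a λ i j → conv-zeroˡ (λ γ → g (j ∷ γ)) (λ β → f≈0 (i ∷ β)) α

  conv-zeroʳ : ∀ f {g} → (∀ β → g β ≈ 0#) → ∀ α → conv f g α ≈ 0#
  conv-zeroʳ f g≈0 α = trans (conv-comm f _ α) (conv-zeroˡ f g≈0 α)

  conv-·ˡ : ∀ x f g α → conv (x · f) g α ≈ x * conv f g α
  conv-·ˡ x f g []      = *-assoc _ _ _
  conv-·ˡ x f g (a ∷ α) = trans
    (cauchy-cong a λ i j → conv-·ˡ x (λ β → f (i ∷ β)) (λ γ → g (j ∷ γ)) α)
    (sym (*-distribˡ-sum {suc a} x λ i → conv (λ β → f (toℕ i ∷ β)) (λ γ → g ((a ∸ toℕ i) ∷ γ)) α))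

  conv-·ʳ : ∀ x f g α → conv f (x · g) α ≈ x * conv f g α
  conv-·ʳ x f g α = trans (conv-comm f (x · g) α) (trans (conv-·ˡ x g f α) (*-congˡ (conv-comm g f α)))

  -- Slicing at the first exponent reduces this to `cauchy-assoc` and induction. As `conv-∑ˡ` pulls
  -- sums out of the left factor, commutativity turns the product round for the inner sum on the
  -- right.
  conv-assoc : ∀ f g k → conv (conv f g) k ≋ conv f (conv g k)
  conv-assoc f g k []      = *-assoc _ _ _
  conv-assoc f g k (a ∷ α) = begin
    cauchy a (λ i m → conv (λ β → cauchy i (λ j l → conv (f′ j) (g′ l) β)) (k′ m) α)
      ≈⟨ cauchy-cong a (λ i m → conv-∑ˡ {suc i} (λ p → conv (f′ (toℕ p)) (g′ (i ∸ toℕ p))) (k′ m) α) ⟩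
    cauchy a (λ i m → cauchy i (λ j l → conv (conv (f′ j) (g′ l)) (k′ m) α))
      ≈⟨ cauchy-assoc a (λ j l m → conv (conv (f′ j) (g′ l)) (k′ m) α) ⟩
    cauchy a (λ j i → cauchy i (λ l m → conv (conv (f′ j) (g′ l)) (k′ m) α))
      ≈⟨ cauchy-cong a (λ j i → cauchy-cong i λ l m →
           trans (conv-assoc (f′ j) (g′ l) (k′ m) α) (conv-comm (f′ j) _ α)) ⟩
    cauchy a (λ j i → cauchy i (λ l m → conv (conv (g′ l) (k′ m)) (f′ j) α))
      ≈⟨ cauchy-cong a (λ j i → trans
           (sym (conv-∑ˡ {suc i} (λ p → conv (g′ (toℕ p)) (k′ (i ∸ toℕ p))) (f′ j) α))
           (conv-comm (λ β → conv g k (i ∷ β)) (f′ j) α)) ⟩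
    cauchy a (λ j i → conv (f′ j) (λ β → conv g k (i ∷ β)) α) ∎
    where
    f′ g′ k′ : ℕ → Series
    f′ i β = f (i ∷ β)
    g′ i β = g (i ∷ β)
    k′ i β = k (i ∷ β)

  conv-identityˡ : ∀ f → conv (homogeneous 0) f ≋ f
  conv-identityˡ f []      = *-identityˡ _
  conv-identityˡ f (a ∷ α) = trans
    (cauchy-comm a λ i j → conv (λ β → homogeneous 0 (i ∷ β)) (λ γ → f (j ∷ γ)) α)
    (trans (cauchy-final a (λ j i → conv (λ β → homogeneous 0 (i ∷ β)) (λ γ → f (j ∷ γ)) α)
              (λ j i → conv-zeroˡ (λ γ → f (j ∷ γ)) (λ _ → refl) α))
           (conv-identityˡ (λ γ → f (a ∷ γ)) α))

  conv-distribʳ : ∀ f g k → conv (λ β → g β + k β) f ≋ λ α → conv g f α + conv k f α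
  conv-distribʳ f g k α = trans (conv-cong {g = f} (λ β → +-congˡ (sym (*-identityˡ _))) (λ _ → refl) α)
    (trans (conv-linearˡ 1# g k f α) (+-congˡ (*-identityˡ _)))

  seriesRing : CommutativeRing c ℓ
  seriesRing = record
    { Carrier = Series ; _≈_ = _≋_
    ; _+_ = S._+_ ; _*_ = S._*_ ; -_ = S.-_ ; 0# = S.0# ; 1# = S.1#
    ; isCommutativeRing = record
      { isRing = record
        { +-isAbelianGroup = record
          { isGroup = record
            { isMonoid = record
              { isSemigroup = record
                { isMagma = record
                  { isEquivalence = record
                    { refl = λ _ → refl ; sym = λ p α → sym (p α) ; trans = λ p q α → trans (p α) (q α) }
                  ; ∙-cong = λ p q α → +-cong (p α) (q α) }
                ; assoc = λ f g k α → +-assoc _ _ _ }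
              ; identity = (λ f α → +-identityˡ _) , (λ f α → +-identityʳ _) }
            ; inverse = (λ f α → -‿inverseˡ _) , (λ f α → -‿inverseʳ _)
            ; ⁻¹-cong = λ p α → -‿cong (p α) }
          ; comm = λ f g α → +-comm _ _ }
        ; *-cong = conv-cong
        ; *-assoc = conv-assoc
        ; *-identity = conv-identityˡ , λ f α → trans (conv-comm f (homogeneous 0) α) (conv-identityˡ f α)
        ; distrib = (λ f g k α → trans (conv-comm f (λ β → g β + k β) α)
                       (trans (conv-distribʳ f g k α) (+-cong (conv-comm g f α) (conv-comm k f α))))
                  , conv-distribʳ }
      ; *-comm = conv-comm } }

  module SeriesTheory = RingTheory seriesRing

  EqualAt : List ℕ → Series → Series → Set ℓ
  EqualAt α f g = ∀ β → length β ≡ length α → f β ≈ g β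

  conv-congAt : ∀ α {f f′ g g′} → EqualAt α f f′ → EqualAt α g g′ → conv f g α ≈ conv f′ g′ α
  conv-congAt []      p q = *-cong (p [] ≡.refl) (q [] ≡.refl)
  conv-congAt (a ∷ α) p q = cauchy-cong a λ i j →
    conv-congAt α (λ β eq → p (i ∷ β) (≡.cong suc eq)) (λ β eq → q (j ∷ β) (≡.cong suc eq))

  conv-congIn : ∀ n {f f′ g g′} → EqualIn n f f′ → EqualIn n g g′ → EqualIn n (conv f g) (conv f′ g′)
  conv-congIn n p q α eq =
    conv-congAt α (λ β e → p β (≡.trans e eq)) (λ β e → q β (≡.trans e eq))

  open RawSemiringDefs (RawRing.rawSemiring Series-rawRing) using () renaming (sum to ∑S)

  ∑S-eval : ∀ {n} (f : Fin n → Series) α → ∑S f α ≡ ∑ (λ i → f i α)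
  ∑S-eval {zero}  f α = ≡.refl
  ∑S-eval {suc n} f α = ≡.cong (λ s → f fzero α + s) (∑S-eval (f ∘ fsuc) α)

  det-congIn : ∀ n {m} (M N : Fin m → Fin m → Series) → (∀ i j → EqualIn n (M i j) (N i j)) →
    EqualIn n (DetS.det M) (DetS.det N)
  det-congIn n {zero}  M N eq α l = refl
  det-congIn n {suc m} M N eq α l = trans (reflexive (∑S-eval (SeriesTheory.laplace M) α))
    (trans (∑-cong (λ j → SeriesTheory.laplace M j α) (λ j → SeriesTheory.laplace N j α) λ j →
      conv-congIn n {f = SeriesTheory.sign j} (λ _ _ → refl)
        (conv-congIn n (eq fzero j) (det-congIn n _ _ λ i k → eq (fsuc i) (punchIn j k))) α l)
    (sym (reflexive (∑S-eval (SeriesTheory.laplace N) α))))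

  signS : ∀ n f α → conv ((S.- S.1#) S.^ n) f α ≈ (- 1#) ^ n * f α
  signS zero    f α = trans (conv-identityˡ f α) (sym (*-identityˡ _))
  signS (suc n) f α = begin
    conv (conv (S.- S.1#) ((S.- S.1#) S.^ n)) f α
      ≈⟨ conv-assoc (S.- S.1#) ((S.- S.1#) S.^ n) f α ⟩
    conv (S.- S.1#) (conv ((S.- S.1#) S.^ n) f) α
      ≈⟨ conv-cong {f′ = (- 1#) · S.1#} (λ β → trans (-‿cong (sym (*-identityˡ _))) (-‿distribˡ-* 1# _)) (signS n f) α ⟩
    conv ((- 1#) · S.1#) (((- 1#) ^ n) · f) α
      ≈⟨ trans (conv-·ˡ (- 1#) S.1# _ α) (*-congˡ (conv-identityˡ _ α)) ⟩
    - 1# * ((- 1#) ^ n * f α)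
      ≈⟨ *-assoc _ _ _ ⟨
    (- 1#) ^ suc n * f α ∎

  det-eval : ∀ {n} (M : Fin (suc n) → Fin (suc n) → Series) α →
    DetS.det M α ≈ ∑ λ j → (- 1#) ^ toℕ j * conv (M fzero j) (DetS.det (SeriesTheory.minor M j)) α
  det-eval M α = trans (reflexive (∑S-eval (SeriesTheory.laplace M) α))
    (∑-cong (λ j → SeriesTheory.laplace M j α) _
            λ j → signS (toℕ j) (M fzero j S.* DetS.det (SeriesTheory.minor M j)) α)

  -- Renames x_i to x_{i+1}.
  shift : Series → Series
  shift f []          = f []
  shift f (zero ∷ α)  = f α
  shift f (suc _ ∷ α) = 0#

  shift-+ : ∀ f g → shift (f S.+ g) ≋ (shift f S.+ shift g)
  shift-+ f g []          = refl
  shift-+ f g (zero ∷ α)  = refl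
  shift-+ f g (suc _ ∷ α) = sym (+-identityˡ _)

  shift-neg : ∀ f → shift (S.- f) ≋ (S.- shift f)
  shift-neg f []          = refl
  shift-neg f (zero ∷ α)  = refl
  shift-neg f (suc _ ∷ α) = sym -0#≈0#

  shift-· : ∀ x f → shift (x · f) ≋ (x · shift f)
  shift-· x f []          = refl
  shift-· x f (zero ∷ α)  = refl
  shift-· x f (suc _ ∷ α) = sym (zeroʳ x)

  shift-0 : shift S.0# ≋ S.0#
  shift-0 []          = refl
  shift-0 (zero ∷ α)  = refl
  shift-0 (suc _ ∷ α) = refl

  shift-1 : shift S.1# ≋ S.1#
  shift-1 []          = refl
  shift-1 (zero ∷ α)  = refl
  shift-1 (suc _ ∷ α) = refl

  shift-* : ∀ f g → shift (f S.* g) ≋ (shift f S.* shift g)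
  shift-* f g []          = refl
  shift-* f g (zero ∷ α)  = sym (+-identityʳ _)
  shift-* f g (suc a ∷ α) = sym (trans
    (+-cong (conv-zeroʳ f (λ _ → refl) α)
            (cauchy-zero a λ i j → conv-zeroˡ (λ γ → shift g (j ∷ γ)) (λ _ → refl) α))
    (+-identityˡ _))

  shift-power : ∀ f n → shift (f S.^ n) ≋ (shift f S.^ n)
  shift-power = DetHom.hom-power Series-rawRing seriesRing shift shift-+ shift-* shift-neg shift-0 shift-1

  shift-det : ∀ {n} (M : Fin n → Fin n → Series) → shift (DetS.det M) ≋ DetS.det (λ i j → shift (M i j))
  shift-det = DetHom.hom-det Series-rawRing seriesRing shift shift-+ shift-* shift-neg shift-0 shift-1

  var-suc : ∀ i → var (suc i) ≋ shift (var i)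
  var-suc i []          = refl
  var-suc i (zero ∷ α)  = refl
  var-suc i (suc _ ∷ α) = refl

  -- The series in n variables whose coefficient at (a_0, …, a_{n-1}) is
  -- det (f_j(a_i)), and which vanishes in other numbers of variables.
  alternant : ∀ {n} → (Fin n → ℕ → Carrier) → Series
  alternant {zero}  f []      = 1#
  alternant {zero}  f (_ ∷ _) = 0#
  alternant {suc n} f []      = 0#
  alternant {suc n} f (a ∷ α) = ∑ λ j → (- 1#) ^ toℕ j * (f j a * alternant (f ∘ punchIn j) α)

  conv-shift : ∀ (f : ℕ → Carrier) g k a α → (∀ i β → g (i ∷ β) ≈ f i * S.1# β) →
    conv g (shift k) (a ∷ α) ≈ f a * k α
  conv-shift f g k a α eq = trans
    (cauchy-final a (λ i j → conv (λ β → g (i ∷ β)) (λ γ → shift k (j ∷ γ)) α)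
       (λ i j → conv-zeroʳ (λ β → g (i ∷ β)) (λ _ → refl) α))
    (trans (conv-cong {f′ = f a · S.1#} (eq a) (λ _ → refl) α)
    (trans (conv-·ˡ (f a) S.1# k α) (*-congˡ (conv-identityˡ k α))))

  -- The minors along the first row involve only later variables, so they are shifted series.
  -- Multiplying such a series by one in the first variable alone just multiplies coefficients,
  -- which turns the Laplace expansion into that of `alternant`.
  det-alternant : ∀ {n} (M : Fin n → ℕ → Series) (f : Fin n → ℕ → Carrier) →
    (∀ j a α → M j 0 (a ∷ α) ≈ f j a * S.1# α) → (∀ j i → M j (suc i) ≋ shift (M j i)) →
    EqualIn n (DetS.det {n} λ i j → M j (toℕ i)) (alternant f)
  det-alternant {zero}  M f first next [] eq = refl
  det-alternant {suc n} M f first next (a ∷ α) eq = trans (det-eval (λ i j → M j (toℕ i)) (a ∷ α))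
    (∑-cong _ (λ j → (- 1#) ^ toℕ j * (f j a * alternant (f ∘ punchIn j) α)) λ j → *-congˡ (begin
      conv (M j 0) (DetS.det (λ i k → M (punchIn j k) (suc (toℕ i)))) (a ∷ α)
        ≈⟨ conv-cong {f = M j 0} (λ _ → refl) (λ β → trans
             (SeriesTheory.det-cong (λ i k → M (punchIn j k) (suc (toℕ i))) _ (λ i k → next (punchIn j k) (toℕ i)) β)
             (sym (shift-det (λ i k → M (punchIn j k) (toℕ i)) β))) (a ∷ α) ⟩
      conv (M j 0) (shift (DetS.det (λ i k → M (punchIn j k) (toℕ i)))) (a ∷ α)
        ≈⟨ conv-shift (f j) (M j 0) _ a α (first j) ⟩
      f j a * DetS.det (λ i k → M (punchIn j k) (toℕ i)) α
        ≈⟨ *-congˡ (det-alternant (M ∘ punchIn j) (f ∘ punchIn j) (first ∘ punchIn j) (next ∘ punchIn j)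
                      α (ℕₚ.suc-injective eq)) ⟩
      f j a * alternant (f ∘ punchIn j) α ∎))

module ProductForm {c ℓ} (A : CommutativeRing c ℓ) where
  open CommutativeRing A
  open RawSemiringDefs (RawRing.rawSemiring rawRing) using (product)
  open RingTheory A using (differences; vandermondeProduct)

  product-cong : ∀ {n} (f g : Fin n → Carrier) → (∀ i → f i ≈ g i) → product f ≈ product g
  product-cong {zero}  f g eq = refl
  product-cong {suc n} f g eq = *-cong (eq fzero) (product-cong (f ∘ fsuc) (g ∘ fsuc) (eq ∘ fsuc))

  difference : ∀ {n} → (Fin n → Carrier) → Fin n → Fin n → Carrier
  difference f i j = if does (i <? j) then f i + - f j else 1#

  product-differences : ∀ {n} x (f : Fin n → Carrier) →
    product (λ j → x + - f j) ≈ differences x (Vec.tabulate f)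
  product-differences {zero}  x f = refl
  product-differences {suc n} x f = *-congˡ (product-differences x (f ∘ fsuc))

  -- The definition of `vandermonde` runs over all pairs, with factor 1 unless i < j; dropping these
  -- factors gives the recursive product in which `bialternant` is stated.
  vandermonde-product : ∀ {n} (f : Fin n → Carrier) →
    product (λ i → product (difference f i)) ≈ vandermondeProduct (Vec.tabulate f)
  vandermonde-product {zero}  f = refl
  vandermonde-product {suc n} f = *-cong
    (CommutativeRing.trans A (*-identityˡ _) (product-differences (f fzero) (f ∘ fsuc)))
    (CommutativeRing.trans A
      (product-cong (λ i → product (difference f (fsuc i))) (λ i → product (difference (f ∘ fsuc) i))
        (λ i → *-identityˡ _))
      (vandermonde-product (f ∘ fsuc)))

-- Linear functionals on coefficient sequences and their tensor products

module Functionals {c ℓ} (R : CommutativeRing c ℓ) where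
  open SymmetricFunctions R
  open CommutativeRing R hiding (zero)
  open SemiringSum semiring using () renaming (sum to ∑)
  open RawSemiringDefs (RawRing.rawSemiring rawRing) using (_^_)
  open RingProperties ring using (-1*x≈-x)
  open SetoidReasoning setoid
  open RingTheory R using (∑-cong; det; laplace; minor)
  open SeriesRing R using (alternant)

  -- Stands for B ↦ Σ q_e B(e) with finitely many q_e; keeping only the linearity avoids all
  -- bookkeeping of supports.
  record Functional : Set (c ⊔ ℓ) where
    field
      apply        : (ℕ → Carrier) → Carrier
      apply-cong   : ∀ {B B′} → (∀ e → B e ≈ B′ e) → apply B ≈ apply B′
      apply-linear : ∀ x B B′ → apply (λ e → B e + x * B′ e) ≈ apply B + x * apply B′

    apply-zero : ∀ {B} → (∀ e → B e ≈ 0#) → apply B ≈ 0#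
    apply-zero {B} B≈0 = begin
      apply B                        ≈⟨ apply-cong (λ e → trans (B≈0 e) (sym (cancel (B e)))) ⟩
      apply (λ e → B e + - 1# * B e) ≈⟨ apply-linear (- 1#) B B ⟩
      apply B + - 1# * apply B       ≈⟨ cancel (apply B) ⟩
      0#                             ∎
      where
      cancel : ∀ x → x + - 1# * x ≈ 0#
      cancel x = trans (+-congˡ (-1*x≈-x x)) (-‿inverseʳ x)

    apply-∑ : ∀ {n} (x : Fin n → Carrier) (B : Fin n → ℕ → Carrier) →
      apply (λ e → ∑ λ i → x i * B i e) ≈ ∑ λ i → x i * apply (B i)
    apply-∑ {zero}  x B = apply-zero λ _ → refl
    apply-∑ {suc n} x B = begin
      apply (λ e → x fzero * B fzero e + ∑ λ i → x (fsuc i) * B (fsuc i) e)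
        ≈⟨ apply-cong (λ e → +-comm _ _) ⟩
      apply (λ e → (∑ λ i → x (fsuc i) * B (fsuc i) e) + x fzero * B fzero e)
        ≈⟨ apply-linear (x fzero) _ (B fzero) ⟩
      apply (λ e → ∑ λ i → x (fsuc i) * B (fsuc i) e) + x fzero * apply (B fzero)
        ≈⟨ +-congʳ (apply-∑ (x ∘ fsuc) (B ∘ fsuc)) ⟩
      (∑ λ i → x (fsuc i) * apply (B (fsuc i))) + x fzero * apply (B fzero)
        ≈⟨ +-comm _ _ ⟩
      (∑ λ i → x i * apply (B i)) ∎

  open Functional public

  evaluateAt : ℕ → Functional
  evaluateAt e = record { apply = λ B → B e ; apply-cong = λ eq → eq e ; apply-linear = λ x B B′ → refl }

  -- Σ_a q_0(a_0) ⋯ q_{n-1}(a_{n-1}) X(a), if Q i is B ↦ Σ_e q_i(e) B(e).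
  tensor : ∀ {n} → (Fin n → Functional) → Series → Carrier
  tensor {zero}  Q X = X []
  tensor {suc n} Q X = apply (Q fzero) λ e → tensor (Q ∘ fsuc) λ α → X (e ∷ α)

  tensor-cong : ∀ {n} (Q : Fin n → Functional) {X Y} → EqualIn n X Y → tensor Q X ≈ tensor Q Y
  tensor-cong {zero}  Q eq = eq [] ≡.refl
  tensor-cong {suc n} Q eq = apply-cong (Q fzero) λ e →
    tensor-cong (Q ∘ fsuc) λ α l → eq (e ∷ α) (≡.cong suc l)

  tensor-linear : ∀ {n} (Q : Fin n → Functional) x X Y →
    tensor Q (λ α → X α + x * Y α) ≈ tensor Q X + x * tensor Q Y
  tensor-linear {zero}  Q x X Y = refl
  tensor-linear {suc n} Q x X Y = trans
    (apply-cong (Q fzero) λ e → tensor-linear (Q ∘ fsuc) x (λ α → X (e ∷ α)) (λ α → Y (e ∷ α)))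
    (apply-linear (Q fzero) x _ _)

  tensor-zero : ∀ {n} (Q : Fin n → Functional) X → EqualIn n X (λ _ → 0#) → tensor Q X ≈ 0#
  tensor-zero {zero}  Q X eq = eq [] ≡.refl
  tensor-zero {suc n} Q X eq = apply-zero (Q fzero) λ e →
    tensor-zero (Q ∘ fsuc) (λ α → X (e ∷ α)) λ α l → eq (e ∷ α) (≡.cong suc l)

  tensor-∑ : ∀ {n m} (Q : Fin n → Functional) (x : Fin m → Carrier) (X : Fin m → Series) →
    tensor Q (λ α → ∑ λ i → x i * X i α) ≈ ∑ λ i → x i * tensor Q (X i)
  tensor-∑ {zero}  Q x X = refl
  tensor-∑ {suc n} Q x X = trans
    (apply-cong (Q fzero) λ e → tensor-∑ (Q ∘ fsuc) x (λ i α → X i (e ∷ α)))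
    (apply-∑ (Q fzero) x _)

  tensor-evaluateAt : ∀ {n} (a : Fin n → ℕ) X → tensor (evaluateAt ∘ a) X ≡ X (List.tabulate a)
  tensor-evaluateAt {zero}  a X = ≡.refl
  tensor-evaluateAt {suc n} a X = tensor-evaluateAt (a ∘ fsuc) (λ α → X (a fzero ∷ α))

  -- Row i of the determinant depends on the i-th exponent alone and enters linearly, so each
  -- functional can be applied inside its own row.
  tensor-alternant : ∀ {n} (Q : Fin n → Functional) (f : Fin n → ℕ → Carrier) →
    tensor Q (alternant f) ≈ det (λ i j → apply (Q i) (f j))
  tensor-alternant {zero}  Q f = refl
  tensor-alternant {suc n} Q f = begin
    apply (Q fzero) (λ e → tensor Q′ λ α → ∑ λ j → sgn j * (f j e * alternant (f ∘ punchIn j) α))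
      ≈⟨ apply-cong (Q fzero) (λ e → begin
           tensor Q′ (λ α → ∑ λ j → sgn j * (f j e * alternant (f ∘ punchIn j) α))
             ≈⟨ tensor-cong Q′ (λ α _ → ∑-cong (λ j → sgn j * (f j e * alternant (f ∘ punchIn j) α)) _
                                              λ j → sym (*-assoc _ _ _)) ⟩
           tensor Q′ (λ α → ∑ λ j → (sgn j * f j e) * alternant (f ∘ punchIn j) α)
             ≈⟨ tensor-∑ Q′ (λ j → sgn j * f j e) (λ j → alternant (f ∘ punchIn j)) ⟩
           (∑ λ j → (sgn j * f j e) * tensor Q′ (alternant (f ∘ punchIn j)))
             ≈⟨ ∑-cong (λ j → (sgn j * f j e) * tensor Q′ (alternant (f ∘ punchIn j))) (λ j → (sgn j * D j) * f j e) (λ j → trans (*-congˡ (tensor-alternant Q′ (f ∘ punchIn j)))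
                              (trans (*-assoc _ _ _) (trans (*-congˡ (*-comm _ _)) (sym (*-assoc _ _ _))))) ⟩
           (∑ λ j → (sgn j * D j) * f j e) ∎) ⟩
    apply (Q fzero) (λ e → ∑ λ j → (sgn j * D j) * f j e)
      ≈⟨ apply-∑ (Q fzero) (λ j → sgn j * D j) f ⟩
    (∑ λ j → (sgn j * D j) * apply (Q fzero) (f j))
      ≈⟨ ∑-cong (λ j → (sgn j * D j) * apply (Q fzero) (f j)) (laplace (λ i j → apply (Q i) (f j)))
           (λ j → trans (*-assoc _ _ _) (*-congˡ (*-comm _ _))) ⟩
    det (λ i j → apply (Q i) (f j)) ∎
    where
    Q′ : Fin n → Functional
    Q′ = Q ∘ fsuc
    sgn D : Fin (suc n) → Carrier
    sgn j = (- 1#) ^ toℕ j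
    D j = det (minor (λ i j → apply (Q i) (f j)) j)

-- Alternating series

module AlternatingSeries {c ℓ} (R : CommutativeRing c ℓ) where
  open SymmetricFunctions R
  open CommutativeRing R hiding (zero)
  open SemiringSum semiring using (∑-comm; ∑-distrib-+) renaming (sum to ∑)
  open RawSemiringDefs (RawRing.rawSemiring rawRing) using (_^_)
  open RingProperties ring using (-0#≈0#; -1*x≈-x)
  open SetoidReasoning setoid
  open RingTheory R using (∑-cong; ∑-zero; ∑-neg; det; det-cong; det-swapRows; det-equalRows₀₁; swap₀₁; laplace;
                           term-zero; minor-zero)
  open RingIdentities R using (neg-term)
  open CauchySums R
  open SeriesRing R

  alternant-tabulate : ∀ {n} (f : Fin n → ℕ → Carrier) (a : Fin n → ℕ) →
    alternant f (List.tabulate a) ≈ det (λ i j → f j (a i))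
  alternant-tabulate {zero}  f a = refl
  alternant-tabulate {suc n} f a = ∑-cong _ (laplace λ i j → f j (a i)) λ j →
    *-congˡ (*-congˡ (alternant-tabulate (f ∘ punchIn j) (a ∘ fsuc)))

  alternant-length : ∀ {n} (f : Fin n → ℕ → Carrier) α → length α ≢ n → alternant f α ≈ 0#
  alternant-length {zero}  f []      ≢ = contradiction ≡.refl ≢
  alternant-length {zero}  f (_ ∷ _) ≢ = refl
  alternant-length {suc n} f []      ≢ = refl
  alternant-length {suc n} f (a ∷ α) ≢ = ∑-zero (λ j → (- 1#) ^ toℕ j * (f j a * alternant (f ∘ punchIn j) α)) λ j →
    minor-zero (alternant-length (f ∘ punchIn j) α (≢ ∘ ≡.cong suc))

  -- `repeated` is a field of its own because `transpose` would only show that twice the coefficient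
  -- is zero.
  record Alternating (X : Series) : Set ℓ where
    field
      transpose : ∀ pre a b post → X (pre ++ a ∷ b ∷ post) ≈ - X (pre ++ b ∷ a ∷ post)
      repeated  : ∀ pre a post → X (pre ++ a ∷ a ∷ post) ≈ 0#

  open Alternating public

  slice-alternating : ∀ {X} → Alternating X → ∀ a → Alternating (λ α → X (a ∷ α))
  slice-alternating alt a = record
    { transpose = λ pre → transpose alt (a ∷ pre) ; repeated = λ pre → repeated alt (a ∷ pre) }

  private
    pair : ∀ {n} → ℕ → ℕ → (Fin n → ℕ) → Fin (suc (suc n)) → ℕ
    pair a b g fzero           = a
    pair a b g (fsuc fzero)    = b
    pair a b g (fsuc (fsuc i)) = g i

    alternant-pair : ∀ a b post (f : Fin (suc (suc (length post))) → ℕ → Carrier) →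
      alternant f (a ∷ b ∷ post) ≈ det (λ i j → f j (pair a b (List.lookup post) i))
    alternant-pair a b post f = trans
      (reflexive (≡.cong (λ γ → alternant f (a ∷ b ∷ γ)) (≡.sym (tabulate-lookup post))))
      (alternant-tabulate f (pair a b (List.lookup post)))

  -- Laplace expansion removes the common prefix; what remains concerns the first two rows of a
  -- determinant, or is zero because the number of exponents is wrong.
  alternant-alternating : ∀ {n} (f : Fin n → ℕ → Carrier) → Alternating (alternant f)
  alternant-alternating f = record { transpose = swaps f ; repeated = repeats f }
    where
    swaps : ∀ {n} (f : Fin n → ℕ → Carrier) pre a b post →
      alternant f (pre ++ a ∷ b ∷ post) ≈ - alternant f (pre ++ b ∷ a ∷ post)
    swaps {n} f [] a b post with suc (suc (length post)) ℕₚ.≟ n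
    ... | no  ≢ = trans (alternant-length f (a ∷ b ∷ post) ≢)
                    (sym (trans (-‿cong (alternant-length f (b ∷ a ∷ post) ≢)) -0#≈0#))
    ... | yes ≡.refl = begin
      alternant f (a ∷ b ∷ post)
        ≈⟨ alternant-pair a b post f ⟩
      det (λ i j → f j (pair a b g i))
        ≈⟨ det-cong (λ i j → f j (pair a b g i)) (λ i j → f j (pair b a g (swap₀₁ i)))
             (λ i j → reflexive (≡.cong (f j) (swapped i))) ⟩
      det (λ i j → f j (pair b a g (swap₀₁ i)))
        ≈⟨ det-swapRows (λ i j → f j (pair b a g i)) ⟩
      - det (λ i j → f j (pair b a g i))
        ≈⟨ -‿cong (alternant-pair b a post f) ⟨
      - alternant f (b ∷ a ∷ post) ∎
      where
      g : Fin (length post) → ℕ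
      g = List.lookup post
      swapped : ∀ i → pair a b g i ≡ pair b a g (swap₀₁ i)
      swapped fzero           = ≡.refl
      swapped (fsuc fzero)    = ≡.refl
      swapped (fsuc (fsuc i)) = ≡.refl
    swaps {zero}  f (x ∷ pre) a b post = sym -0#≈0#
    swaps {suc n} f (x ∷ pre) a b post = trans
      (∑-cong (λ j → (- 1#) ^ toℕ j * (f j x * alternant (f ∘ punchIn j) (pre ++ a ∷ b ∷ post)))
              (λ j → - ((- 1#) ^ toℕ j * (f j x * alternant (f ∘ punchIn j) (pre ++ b ∷ a ∷ post)))) λ j →
        trans (*-congˡ (*-congˡ (swaps (f ∘ punchIn j) pre a b post))) (neg-term _ _ _))
      (∑-neg (λ j → (- 1#) ^ toℕ j * (f j x * alternant (f ∘ punchIn j) (pre ++ b ∷ a ∷ post))))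
    repeats : ∀ {n} (f : Fin n → ℕ → Carrier) pre a post → alternant f (pre ++ a ∷ a ∷ post) ≈ 0#
    repeats {n} f [] a post with suc (suc (length post)) ℕₚ.≟ n
    ... | no  ≢      = alternant-length f (a ∷ a ∷ post) ≢
    ... | yes ≡.refl = trans (alternant-pair a a post f)
      (det-equalRows₀₁ (λ i j → f j (pair a a (List.lookup post) i)) λ j → refl)
    repeats {zero}  f (x ∷ pre) a post = refl
    repeats {suc n} f (x ∷ pre) a post =
      ∑-zero (λ j → (- 1#) ^ toℕ j * (f j x * alternant (f ∘ punchIn j) (pre ++ a ∷ a ∷ post))) λ j →
        minor-zero (repeats (f ∘ punchIn j) pre a post)

  -- Row and column of the same index cancel. The shorter argument that the sum equals its own
  -- negative would leave a factor 2.
  ∑-antisymmetric : ∀ {n} (T : Fin n → Fin n → Carrier) → (∀ i j → T i j ≈ - T j i) → (∀ i → T i i ≈ 0#) →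
    ∑ (λ i → ∑ (T i)) ≈ 0#
  ∑-antisymmetric {zero}  T anti diag = refl
  ∑-antisymmetric {suc n} T anti diag = begin
    (T fzero fzero + ∑ row) + ∑ (λ i → T (fsuc i) fzero + ∑ (λ j → T (fsuc i) (fsuc j)))
      ≈⟨ +-cong (trans (+-congʳ (diag fzero)) (+-identityˡ _))
                (∑-distrib-+ (λ i → T (fsuc i) fzero) (λ i → ∑ (λ j → T (fsuc i) (fsuc j)))) ⟩
    ∑ row + (∑ (λ i → T (fsuc i) fzero) + ∑ (λ i → ∑ (λ j → T (fsuc i) (fsuc j))))
      ≈⟨ +-congˡ (+-cong (trans (∑-cong (λ i → T (fsuc i) fzero) (λ i → - row i) (λ i → anti (fsuc i) fzero)) (∑-neg row))
            (∑-antisymmetric (λ i j → T (fsuc i) (fsuc j)) (λ i j → anti (fsuc i) (fsuc j)) (λ i → diag (fsuc i)))) ⟩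
    ∑ row + (- ∑ row + 0#)
      ≈⟨ trans (+-congˡ (+-identityʳ _)) (-‿inverseʳ _) ⟩
    0# ∎
    where
    row : Fin n → Carrier
    row j = T fzero (fsuc j)

  conv-negˡ : ∀ f g α → conv (S.- f) g α ≈ - conv f g α
  conv-negˡ f g α = begin
    conv (S.- f) g α        ≈⟨ conv-cong (λ β → sym (-1*x≈-x (f β))) (λ _ → refl) α ⟩
    conv ((- 1#) · f) g α   ≈⟨ conv-·ˡ (- 1#) f g α ⟩
    - 1# * conv f g α       ≈⟨ -1*x≈-x _ ⟩
    - conv f g α            ∎

  -- Exchanging two exponents of the product exchanges them in both factors. For equal exponents the
  -- splittings (i, j) and (j, i) cancel, and i = j is a repetition in the alternating factor.
  conv-alternating : ∀ {f g} → Alternating f → Symmetric g → Alternating (conv f g)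
  conv-alternating {f} {g} alt sym′ = record { transpose = swaps f g alt sym′ ; repeated = repeats f g alt sym′ }
    where
    exchange : ∀ f g → Alternating f → Symmetric g → ∀ i i′ j j′ α →
      conv (λ β → f (i ∷ j ∷ β)) (λ γ → g (i′ ∷ j′ ∷ γ)) α
        ≈ - conv (λ β → f (j ∷ i ∷ β)) (λ γ → g (j′ ∷ i′ ∷ γ)) α
    exchange f g alt s i i′ j j′ α = trans
      (conv-cong (λ β → transpose alt [] i j β) (λ γ → s (↭.swap i′ j′ ↭.refl)) α)
      (conv-negˡ (λ β → f (j ∷ i ∷ β)) (λ γ → g (j′ ∷ i′ ∷ γ)) α)
    swaps : ∀ f g → Alternating f → Symmetric g → ∀ pre a b post →
      conv f g (pre ++ a ∷ b ∷ post) ≈ - conv f g (pre ++ b ∷ a ∷ post)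
    swaps f g alt s [] a b post = begin
      cauchy a (λ i i′ → cauchy b λ j j′ → T i i′ j j′)
        ≈⟨ ∑-comm {suc a} {suc b} (λ i j → T (toℕ i) (a ∸ toℕ i) (toℕ j) (b ∸ toℕ j)) ⟩
      cauchy b (λ j j′ → cauchy a λ i i′ → T i i′ j j′)
        ≈⟨ cauchy-cong b (λ j j′ → trans (cauchy-cong a λ i i′ → exchange f g alt s i i′ j j′ post)
             (∑-neg {suc a} λ i → T j j′ (toℕ i) (a ∸ toℕ i))) ⟩
      cauchy b (λ j j′ → - cauchy a λ i i′ → T j j′ i i′)
        ≈⟨ ∑-neg {suc b} (λ j → cauchy a λ i i′ → T (toℕ j) (b ∸ toℕ j) i i′) ⟩
      - cauchy b (λ j j′ → cauchy a λ i i′ → T j j′ i i′) ∎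
      where
      T : ℕ → ℕ → ℕ → ℕ → Carrier
      T i i′ j j′ = conv (λ β → f (i ∷ j ∷ β)) (λ γ → g (i′ ∷ j′ ∷ γ)) post
    swaps f g alt s (x ∷ pre) a b post = trans
      (cauchy-cong x λ i j → swaps (λ β → f (i ∷ β)) (λ γ → g (j ∷ γ)) (slice-alternating alt i) (slice-symmetric s j) pre a b post)
      (∑-neg {suc x} λ i → conv (λ β → f (toℕ i ∷ β)) (λ γ → g ((x ∸ toℕ i) ∷ γ)) (pre ++ b ∷ a ∷ post))
    repeats : ∀ f g → Alternating f → Symmetric g → ∀ pre a post → conv f g (pre ++ a ∷ a ∷ post) ≈ 0#
    repeats f g alt s [] a post = ∑-antisymmetric {suc a}
      (λ i j → conv (λ β → f (toℕ i ∷ toℕ j ∷ β)) (λ γ → g ((a ∸ toℕ i) ∷ (a ∸ toℕ j) ∷ γ)) post)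
      (λ i j → exchange f g alt s (toℕ i) (a ∸ toℕ i) (toℕ j) (a ∸ toℕ j) post)
      (λ i → conv-zeroˡ _ (λ β → repeated alt [] (toℕ i) β) post)
    repeats f g alt s (x ∷ pre) a post = cauchy-zero x λ i j →
      repeats (λ β → f (i ∷ β)) (λ γ → g (j ∷ γ)) (slice-alternating alt i) (slice-symmetric s j) pre a post

  sum-tabulate-punchIn : ∀ {n} (d : Fin (suc n) → ℕ) j →
    sum (List.tabulate d) ≡ d j ℕ.+ sum (List.tabulate (d ∘ punchIn j))
  sum-tabulate-punchIn         d fzero    = ≡.refl
  sum-tabulate-punchIn {suc n} d (fsuc j) = ≡.trans
    (≡.cong (d fzero ℕ.+_) (sum-tabulate-punchIn (d ∘ fsuc) j))
    (x∙yz≈y∙xz (d fzero) (d (fsuc j)) _)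

  -- In each Laplace term either the first exponent exceeds d_j, or the remaining exponents exceed
  -- the sum of the remaining bounds.
  alternant-bounded : ∀ {n} (f : Fin n → ℕ → Carrier) (d : Fin n → ℕ) → (∀ j e → d j < e → f j e ≈ 0#) →
    DegreeAtMost (sum (List.tabulate d)) (alternant f)
  alternant-bounded {zero}  f d f≈0 []      ()
  alternant-bounded {zero}  f d f≈0 (_ ∷ _) _ = refl
  alternant-bounded {suc n} f d f≈0 []      _ = refl
  alternant-bounded {suc n} f d f≈0 (a ∷ α) lt =
    ∑-zero (λ j → (- 1#) ^ toℕ j * (f j a * alternant (f ∘ punchIn j) α)) vanish
    where
    vanish : ∀ j → (- 1#) ^ toℕ j * (f j a * alternant (f ∘ punchIn j) α) ≈ 0#
    vanish j with d j ℕₚ.<? a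
    ... | yes d<a = term-zero (f≈0 j a d<a)
    ... | no  d≮a = minor-zero (alternant-bounded (f ∘ punchIn j) (d ∘ punchIn j) (λ k → f≈0 (punchIn j k)) α
      (ℕₚ.+-cancelˡ-< a _ _ (ℕₚ.≤-<-trans
        (ℕₚ.+-monoˡ-≤ _ (ℕₚ.≮⇒≥ d≮a)) (≡.subst (ℕ._< a ℕ.+ sum α) (sum-tabulate-punchIn d j) lt))))

-- Series in the variables, and Schur functions in n variables

shift-left : ∀ p i {j n} → j < n → p ℕ.+ i ℕ.+ n ≡ p ℕ.+ (n ∸ suc j) ℕ.+ (i ℕ.+ suc j)
shift-left p i {j} {n} j<n = begin
  p ℕ.+ i ℕ.+ n                          ≡⟨ ≡.cong (p ℕ.+ i ℕ.+_) (ℕₚ.m∸n+n≡m j<n) ⟨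
  p ℕ.+ i ℕ.+ (n ∸ suc j ℕ.+ suc j)      ≡⟨ interchange p i (n ∸ suc j) (suc j) ⟩
  p ℕ.+ (n ∸ suc j) ℕ.+ (i ℕ.+ suc j)    ∎
  where open ≡.≡-Reasoning

shift-right : ∀ j {i n} → i < n → j ℕ.+ n ≡ n ∸ suc i ℕ.+ (i ℕ.+ suc j)
shift-right j {i} {n} i<n = begin
  j ℕ.+ n                          ≡⟨ ≡.cong (j ℕ.+_) (ℕₚ.m∸n+n≡m i<n) ⟨
  j ℕ.+ (n ∸ suc i ℕ.+ suc i)      ≡⟨ ℕₚ.+-comm j _ ⟩
  n ∸ suc i ℕ.+ suc i ℕ.+ j        ≡⟨ ℕₚ.+-assoc (n ∸ suc i) (suc i) j ⟩
  n ∸ suc i ℕ.+ (suc i ℕ.+ j)      ≡⟨ ≡.cong (n ∸ suc i ℕ.+_) (ℕₚ.+-suc i j) ⟨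
  n ∸ suc i ℕ.+ (i ℕ.+ suc j)      ∎
  where open ≡.≡-Reasoning

module Variables {c ℓ} (R : CommutativeRing c ℓ) where
  open SymmetricFunctions R
  open CommutativeRing R hiding (zero)
  open SetoidReasoning setoid
  open RingTheory R using (shifted)
  open CauchySums R
  open SeriesRing R
  private
    module SeriesR = CommutativeRing seriesRing

  shifted-+ : ∀ {a} {A : CommutativeRing a ℓ} f b s k →
    RingTheory.shifted A f (b ℕ.+ k) (s ℕ.+ k) ≡ RingTheory.shifted A f b s
  shifted-+ {A = A} f b s zero    = ≡.cong₂ (RingTheory.shifted A f) (ℕₚ.+-identityʳ b) (ℕₚ.+-identityʳ s)
  shifted-+ {A = A} f b s (suc k) = ≡.trans
    (≡.cong₂ (RingTheory.shifted A f) (ℕₚ.+-suc b k) (ℕₚ.+-suc s k)) (shifted-+ {A = A} f b s k)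

  shifted-< : ∀ {a} {A : CommutativeRing a ℓ} f {b s} → b < s →
    RingTheory.shifted A f b s ≡ CommutativeRing.0# A
  shifted-<         f {zero}  {suc s} _         = ≡.refl
  shifted-< {A = A} f {suc b} {suc s} (s≤s b<s) = shifted-< {A = A} f b<s

  -- Both sides read f at p + i - j: adding n to both arguments on the left and i + j + 1 on the
  -- right gives the same pair. This passes between Jacobi-Trudi indices and differences of entries
  -- of ν + δ and δ.
  shifted-reindex : ∀ {a} {A : CommutativeRing a ℓ} f p {i j n} → i < n → j < n →
    RingTheory.shifted A f (p ℕ.+ i) j ≡ RingTheory.shifted A f (p ℕ.+ (n ∸ suc j)) (n ∸ suc i)
  shifted-reindex {A = A} f p {i} {j} {n} i<n j<n = ≡.trans (≡.sym (shifted-+ {A = A} f (p ℕ.+ i) j n))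
    (≡.trans (≡.cong₂ (RingTheory.shifted A f) (shift-left p i j<n) (shift-right j i<n))
      (shifted-+ {A = A} f (p ℕ.+ (n ∸ suc j)) (n ∸ suc i) (i ℕ.+ suc j)))

  vars : ∀ n → Vec Series n
  vars n = Vec.tabulate (var ∘ toℕ)

  var₀-zero : ∀ f α → conv (var 0) f (0 ∷ α) ≈ 0#
  var₀-zero f α = trans (+-identityʳ _) (conv-zeroˡ (λ γ → f (0 ∷ γ)) (λ _ → refl) α)

  var₀-suc : ∀ f a α → conv (var 0) f (suc a ∷ α) ≈ f (a ∷ α)
  var₀-suc f a α = trans
    (+-cong (conv-zeroˡ (λ γ → f (suc a ∷ γ)) (λ _ → refl) α) (rest a))
    (+-identityˡ _)
    where
    rest : ∀ a → cauchy a (λ i j → conv (λ β → var 0 (suc i ∷ β)) (λ γ → f (j ∷ γ)) α) ≈ f (a ∷ α)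
    rest zero    = trans (+-identityʳ _) (conv-identityˡ (λ γ → f (0 ∷ γ)) α)
    rest (suc a) = trans (+-cong (conv-identityˡ (λ γ → f (suc a ∷ γ)) α)
      (cauchy-zero a λ i j → conv-zeroˡ (λ γ → f (j ∷ γ)) (λ _ → refl) α)) (+-identityʳ _)

  vandermonde-vars : ∀ n → vandermonde n ≋ SeriesTheory.vandermondeProduct (vars n)
  vandermonde-vars n = ProductForm.vandermonde-product seriesRing {n} (var ∘ toℕ)

  complete-shift : ∀ {n} (f g : Fin n → Series) → (∀ i → g i ≋ shift (f i)) → ∀ m →
    SeriesTheory.complete (Vec.tabulate g) m ≋ shift (SeriesTheory.complete (Vec.tabulate f) m)
  complete-shift f g eq zero α = sym (shift-1 α)
  complete-shift {zero}  f g eq (suc m) α = sym (shift-0 α)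
  complete-shift {suc n} f g eq (suc m) α = trans
    (+-cong (trans (conv-cong (eq fzero) (complete-shift f g eq m) α) (sym (shift-* (f fzero) _ α)))
            (complete-shift (f ∘ fsuc) (g ∘ fsuc) (eq ∘ fsuc) (suc m) α))
    (sym (shift-+ _ _ α))

  -- If the first exponent is zero, only the summand free of the first variable contributes;
  -- otherwise only the summand divisible by it does, with the exponent and the degree lowered by
  -- one.
  homogeneous-vars : ∀ n m → EqualIn n (homogeneous m) (SeriesTheory.complete (vars n) m)
  homogeneous-vars n       zero    α       eq = refl
  homogeneous-vars zero    (suc m) []      eq = refl
  homogeneous-vars (suc n) (suc m) (zero ∷ α) eq = begin
    homogeneous (suc m) α
      ≈⟨ homogeneous-vars n (suc m) α (ℕₚ.suc-injective eq) ⟩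
    SeriesTheory.complete (vars n) (suc m) α
      ≈⟨ complete-shift (var ∘ toℕ) (var ∘ suc ∘ toℕ) (λ i → var-suc (toℕ {n} i)) (suc m) (0 ∷ α) ⟨
    SeriesTheory.complete (Vec.tabulate (var ∘ suc ∘ toℕ {n})) (suc m) (0 ∷ α)
      ≈⟨ trans (+-congʳ (var₀-zero (SeriesTheory.complete (vars (suc n)) m) α)) (+-identityˡ _) ⟨
    SeriesTheory.complete (vars (suc n)) (suc m) (0 ∷ α) ∎
  homogeneous-vars (suc n) (suc m) (suc a ∷ α) eq = begin
    homogeneous m (a ∷ α)
      ≈⟨ homogeneous-vars (suc n) m (a ∷ α) eq ⟩
    SeriesTheory.complete (vars (suc n)) m (a ∷ α)
      ≈⟨ var₀-suc (SeriesTheory.complete (vars (suc n)) m) a α ⟨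
    conv (var 0) (SeriesTheory.complete (vars (suc n)) m) (suc a ∷ α)
      ≈⟨ trans (+-congˡ (complete-shift (var ∘ toℕ) (var ∘ suc ∘ toℕ) (λ i → var-suc (toℕ {n} i)) (suc m) (suc a ∷ α)))
           (+-identityʳ _) ⟨
    SeriesTheory.complete (vars (suc n)) (suc m) (suc a ∷ α) ∎

  indicator : ℕ → ℕ → Carrier
  indicator d a = if does (a ℕₚ.≟ d) then 1# else 0#

  var₀-power : ∀ p a α → (var 0 S.^ p) (a ∷ α) ≈ indicator p a * S.1# α
  var₀-power zero    zero    α = sym (*-identityˡ _)
  var₀-power zero    (suc a) α = sym (zeroˡ _)
  var₀-power (suc p) zero    α = trans (var₀-zero (var 0 S.^ p) α) (sym (zeroˡ _))
  var₀-power (suc p) (suc a) α = trans (var₀-suc (var 0 S.^ p) a α) (var₀-power p a α)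

  power-suc : ∀ i p → (var (suc i) S.^ p) ≋ shift (var i S.^ p)
  power-suc i p = SeriesR.trans (cong p) (SeriesR.sym {shift (var i S.^ p)} (shift-power (var i) p))
    where
    cong : ∀ p → (var (suc i) S.^ p) ≋ (shift (var i) S.^ p)
    cong zero    = SeriesR.refl {S.1#}
    cong (suc p) = conv-cong (var-suc i) (cong p)

  monomialAlternant : ∀ {n} → (Fin n → ℕ) → Series
  monomialAlternant b = alternant (indicator ∘ b)

  jacobiTrudiSeries : ∀ n → (Fin n → ℕ) → Series
  jacobiTrudiSeries n b = DetS.det {n} λ i j → SeriesTheory.shifted homogeneous (b j) (n ∸ suc (toℕ i))

  -- The series `homogeneous m` is the polynomial `complete (vars n) m` only in n variables, which
  -- is why the identity is confined to them.
  bialternantIn : ∀ n (b : Fin n → ℕ) →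
    EqualIn n (conv (vandermonde n) (jacobiTrudiSeries n b)) (monomialAlternant b)
  bialternantIn n b α eq = begin
    conv (vandermonde n) (jacobiTrudiSeries n b) α
      ≈⟨ conv-congIn n {f = vandermonde n} (λ β _ → vandermonde-vars n β)
           (det-congIn n (λ i j → SeriesTheory.shifted homogeneous (b j) (n ∸ suc (toℕ i)))
              (SeriesTheory.jacobiTrudi (vars n) b) λ i j → shifted-In (b j) (n ∸ suc (toℕ i))) α eq ⟩
    conv (SeriesTheory.vandermondeProduct (vars n)) (DetS.det (SeriesTheory.jacobiTrudi (vars n) b)) α
      ≈⟨ SeriesTheory.bialternant (vars n) b α ⟩
    DetS.det (λ i j → lookup (vars n) i S.^ b j) α
      ≈⟨ SeriesTheory.det-cong (λ i j → lookup (vars n) i S.^ b j) (λ i j → var (toℕ i) S.^ b j)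
           (λ i j → SeriesR.reflexive (≡.cong (S._^ b j) (lookup∘tabulate (var ∘ toℕ) i))) α ⟩
    DetS.det {n} (λ i j → var (toℕ i) S.^ b j) α
      ≈⟨ det-alternant (λ j i → var i S.^ b j) (indicator ∘ b) (λ j → var₀-power (b j)) (λ j i → power-suc i (b j)) α eq ⟩
    monomialAlternant b α ∎
    where
    shifted-In : ∀ b s → EqualIn n (SeriesTheory.shifted homogeneous b s)
                                   (SeriesTheory.shifted (SeriesTheory.complete (vars n)) b s)
    shifted-In b       zero    = homogeneous-vars n b
    shifted-In zero    (suc s) = λ _ _ → refl
    shifted-In (suc b) (suc s) = shifted-In b s

  hℤ-⊖ : ∀ b s → coeff (hℤ (b ⊖ s)) ≋ SeriesTheory.shifted homogeneous b s
  hℤ-⊖ b       zero    α = refl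
  hℤ-⊖ zero    (suc s) α = refl
  hℤ-⊖ (suc b) (suc s) α = trans (reflexive (≡.cong (λ z → coeff (hℤ z) α) (ℤₚ.[1+m]⊖[1+n]≡m⊖n b s))) (hℤ-⊖ b s α)

  schurEntry : Partition → ℕ → ℕ → Series
  schurEntry ν i j = SeriesTheory.shifted homogeneous (part ν i ℕ.+ j) i

  p-i+j : ∀ p i j → + p ℤ.- + i ℤ.+ + j ≡ (p ℕ.+ j) ⊖ i
  p-i+j p i j = ≡.trans (ℤₚ.+-assoc (+ p) (ℤ.- + i) (+ j))
    (≡.trans (≡.cong (λ z → + p ℤ.+ z) (ℤₚ.+-comm (ℤ.- + i) (+ j)))
    (≡.trans (≡.sym (ℤₚ.+-assoc (+ p) (+ j) (ℤ.- + i))) (ℤₚ.m-n≡m⊖n (p ℕ.+ j) i)))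

  coeff-det : ∀ {n} (M : Fin n → Fin n → Λ) → coeff (DetΛ.det M) ≋ DetS.det (λ i j → coeff (M i j))
  coeff-det = DetHom.hom-det Λ-rawRing seriesRing coeff (λ _ _ _ → refl) (λ _ _ _ → refl)
    (λ _ _ → refl) (λ _ → refl) (λ _ → refl)

  -- Zero parts may be appended to ν because each new last row consists of h_(j-n) with j ≤ n, that
  -- is 0, ..., 0, 1.
  schur-det : ∀ ν d → coeff (schur ν) ≋ DetS.det {d ℕ.+ ℓ⟨ ν ⟩} λ i j → schurEntry ν (toℕ i) (toℕ j)
  schur-det ν zero α = trans (coeff-det {ℓ⟨ ν ⟩} (λ i j → hℤ (+ part ν (toℕ i) ℤ.- + toℕ i ℤ.+ + toℕ j)) α)
    (SeriesTheory.det-cong {ℓ⟨ ν ⟩} _ (λ i j → schurEntry ν (toℕ i) (toℕ j)) (λ i j → SeriesR.trans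
      {coeff (hℤ (+ part ν (toℕ i) ℤ.- + toℕ i ℤ.+ + toℕ j))} {_} {schurEntry ν (toℕ i) (toℕ j)}
      (λ β → reflexive (≡.cong (λ z → coeff (hℤ z) β) (p-i+j (part ν (toℕ i)) (toℕ i) (toℕ j))))
      (hℤ-⊖ (part ν (toℕ i) ℕ.+ toℕ j) (toℕ i))) α)
  schur-det ν (suc d) α = trans (schur-det ν d α) (sym (trans
    (SeriesTheory.det-lastRow {n} (λ i j → schurEntry ν (toℕ i) (toℕ j))
      (λ j → SeriesR.reflexive (zero-entry j)) (SeriesR.reflexive corner) α)
    (SeriesTheory.det-cong {n} (λ i j → schurEntry ν (toℕ (inject₁ i)) (toℕ (inject₁ j)))
      (λ i j → schurEntry ν (toℕ i) (toℕ j))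
      (λ i j → SeriesR.reflexive (≡.cong₂ (schurEntry ν) (toℕ-inject₁ i) (toℕ-inject₁ j))) α)))
    where
    n : ℕ
    n = d ℕ.+ ℓ⟨ ν ⟩
    last≡ : ∀ j → schurEntry ν (toℕ (fromℕ n)) j ≡ SeriesTheory.shifted homogeneous j n
    last≡ j = ≡.trans (≡.cong (λ i → schurEntry ν i j) (toℕ-fromℕ n))
      (≡.cong (λ p → SeriesTheory.shifted homogeneous (p ℕ.+ j) n) (part-beyond ν (ℕₚ.m≤n+m ℓ⟨ ν ⟩ d)))
    zero-entry : ∀ (j : Fin n) → schurEntry ν (toℕ (fromℕ n)) (toℕ (inject₁ j)) ≡ S.0#
    zero-entry j = ≡.trans (last≡ (toℕ (inject₁ j)))
      (shifted-< {A = seriesRing} homogeneous (≡.subst (_< n) (≡.sym (toℕ-inject₁ j)) (toℕ<n j)))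
    corner : schurEntry ν (toℕ (fromℕ n)) (toℕ (fromℕ n)) ≡ S.1#
    corner = ≡.trans (last≡ (toℕ (fromℕ n))) (≡.trans (≡.cong (λ j → SeriesTheory.shifted homogeneous j n) (toℕ-fromℕ n))
      (shifted-+ {A = seriesRing} homogeneous 0 0 n))

  -- λ + δ in n variables, with parts indexed from 0.
  exponents : Partition → ∀ n → Fin n → ℕ
  exponents ν n j = part ν (toℕ j) ℕ.+ (n ∸ suc (toℕ j))

  schur-jacobiTrudi : ∀ ν n → ℓ⟨ ν ⟩ ≤ n → coeff (schur ν) ≋ jacobiTrudiSeries n (exponents ν n)
  schur-jacobiTrudi ν n ℓ≤n = ≡.subst (λ m → coeff (schur ν) ≋ jacobiTrudiSeries m (exponents ν m))
    (ℕₚ.m∸n+n≡m ℓ≤n) (λ α → trans (schur-det ν (n ∸ ℓ⟨ ν ⟩) α) (transposed (n ∸ ℓ⟨ ν ⟩ ℕ.+ ℓ⟨ ν ⟩) α))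
    where
    transposed : ∀ n → DetS.det {n} (λ i j → schurEntry ν (toℕ i) (toℕ j)) ≋ jacobiTrudiSeries n (exponents ν n)
    transposed n α = trans (sym (SeriesTheory.det-transpose {n} (λ i j → schurEntry ν (toℕ i) (toℕ j)) α))
      (SeriesTheory.det-cong {n} (λ i j → schurEntry ν (toℕ j) (toℕ i))
        (λ i j → SeriesTheory.shifted homogeneous (exponents ν n j) (n ∸ suc (toℕ i)))
        (λ i j → SeriesR.reflexive (shifted-reindex {A = seriesRing} homogeneous (part ν (toℕ j)) (toℕ<n i) (toℕ<n j))) α)

  vandermonde-schur : ∀ ν n → ℓ⟨ ν ⟩ ≤ n →
    EqualIn n (conv (vandermonde n) (coeff (schur ν))) (monomialAlternant (exponents ν n))
  vandermonde-schur ν n ℓ≤n α eq = trans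
    (conv-cong {f = vandermonde n} (λ _ → refl) (schur-jacobiTrudi ν n ℓ≤n) α)
    (bialternantIn n (exponents ν n) α eq)

-- Products of complete functions, and linear forms on determinants

module Duality {c ℓ} (R : CommutativeRing c ℓ) where
  open SymmetricFunctions R
  open CommutativeRing R hiding (zero)
  open SemiringSum semiring using (∑-comm; *-distribˡ-sum) renaming (sum to ∑)
  open RawSemiringDefs (RawRing.rawSemiring rawRing) using (_^_)
  open SetoidReasoning setoid
  open RingTheory R using (shifted; ∑-cong)
  open CauchySums R
  open SeriesRing R
  open Functionals R
  open Variables R

  hProduct : List ℕ → Λ
  hProduct = foldr (λ m F → h m *Λ F) (h 0)

  -- The two convolutions act on separate lists of exponents, so their order is immaterial.
  conv-fubini : ∀ f g (K : List ℕ → Series) β γ →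
    conv f (λ β → conv g (λ γ → K γ β) γ) β ≈ conv g (λ γ → conv f (K γ) β) γ
  conv-fubini f g K []      γ = sym (conv-·ʳ (f []) g (λ γ → K γ []) γ)
  conv-fubini f g K (b ∷ β) γ = trans
    (cauchy-cong b λ i j → conv-fubini (λ β → f (i ∷ β)) g (λ γ β → K γ (j ∷ β)) β γ)
    (trans (cauchy-cong b λ i j → conv-comm g (λ γ → conv (λ β → f (i ∷ β)) (λ β → K γ (j ∷ β)) β) γ)
    (trans (sym (conv-∑ˡ {suc b} (λ i γ → conv (λ β → f (toℕ i ∷ β)) (λ β → K γ ((b ∸ toℕ i) ∷ β)) β) g γ))
      (conv-comm (λ γ → conv f (K γ) (b ∷ β)) g γ)))

  -- Both sides are the sum of T (m - i) (b - i) over all i up to b and m.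
  cauchy-shifted : ∀ b m (T : ℕ → ℕ → Carrier) →
    cauchy b (λ i j → shifted (λ k → T k j) m i) ≈ cauchy m (λ u v → shifted (T v) b u)
  cauchy-shifted zero    zero    T = refl
  cauchy-shifted zero    (suc m) T = +-congˡ (sym (cauchy-zero m λ _ _ → refl))
  cauchy-shifted (suc b) zero    T = +-congˡ (cauchy-zero b λ _ _ → refl)
  cauchy-shifted (suc b) (suc m) T = +-congˡ (cauchy-shifted b m T)

  shifted-cong : ∀ {f g : ℕ → Carrier} → (∀ m → f m ≈ g m) → ∀ b s → shifted f b s ≈ shifted g b s
  shifted-cong eq b       zero    = eq b
  shifted-cong eq zero    (suc s) = refl
  shifted-cong eq (suc b) (suc s) = shifted-cong eq b s

  conv-homogeneous-∷ : ∀ m i K α →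
    conv (λ β → homogeneous m (i ∷ β)) K α ≈ shifted (λ k → conv (homogeneous k) K α) m i
  conv-homogeneous-∷ m       zero    K α = refl
  conv-homogeneous-∷ zero    (suc i) K α = conv-zeroˡ K (λ _ → refl) α
  conv-homogeneous-∷ (suc m) (suc i) K α = conv-homogeneous-∷ m i K α

  -- To reach exponent b of the first variable, the factors of the product give up degrees with
  -- total b; γ lists the degrees they keep for the other variables.
  hProduct-∷ : ∀ c b β → coeff (hProduct c) (b ∷ β) ≈ conv (homogeneous b) (λ γ → coeff (hProduct γ) β) c
  hProduct-∷ []      zero    β = sym (*-identityˡ _)
  hProduct-∷ []      (suc b) β = sym (zeroˡ _)
  hProduct-∷ (m ∷ c) b β = begin
    cauchy b (λ i j → conv (λ δ → homogeneous m (i ∷ δ)) (λ δ → coeff (hProduct c) (j ∷ δ)) β)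
      ≈⟨ cauchy-cong b (λ i j → trans
           (conv-cong {f = λ δ → homogeneous m (i ∷ δ)} (λ _ → refl) (λ δ → hProduct-∷ c j δ) β)
           (conv-homogeneous-∷ m i (λ δ → conv (homogeneous j) (λ γ → coeff (hProduct γ) δ) c) β)) ⟩
    cauchy b (λ i j → shifted (λ k → T k j) m i)
      ≈⟨ cauchy-shifted b m T ⟩
    cauchy m (λ u v → shifted (T v) b u)
      ≈⟨ cauchy-cong m (λ u v → trans
           (shifted-cong (λ k → conv-fubini (homogeneous v) (homogeneous k) (λ γ → coeff (hProduct γ)) β c) b u)
           (sym (conv-homogeneous-∷ b u (λ γ → conv (homogeneous v) (coeff (hProduct γ)) β) c))) ⟩
    cauchy m (λ u v → conv (λ γ → homogeneous b (u ∷ γ)) (λ γ → coeff (hProduct (v ∷ γ)) β) c) ∎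
    where
    T : ℕ → ℕ → Carrier
    T k j = conv (homogeneous k) (λ δ → conv (homogeneous j) (λ γ → coeff (hProduct γ) δ) c) β

  -- Both sides count the matrices of natural numbers with row sums b and column sums c; `hProduct`
  -- recurses over the rows and `hProduct-∷` over the columns.
  hProduct-symmetric : ∀ b c → coeff (hProduct b) c ≈ coeff (hProduct c) b
  hProduct-symmetric [] []            = refl
  hProduct-symmetric [] (zero ∷ c)    = trans (hProduct-symmetric [] c) (sym (*-identityˡ _))
  hProduct-symmetric [] (suc m ∷ c)   = sym (zeroˡ _)
  hProduct-symmetric (b ∷ β) c = trans
    (conv-cong {f = homogeneous b} (λ _ → refl) (λ γ → hProduct-symmetric β γ) c)
    (sym (hProduct-∷ c b β))

  -- `det-pairing` is applied both to the Hall product with a fixed function and to the extraction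
  -- of a coefficient, and its induction composes forms with multiplications.
  record LinearForm : Set (c ⊔ ℓ) where
    field
      form      : Λ → Carrier
      form-cong : ∀ {f g} → f ≈Λ g → form f ≈ form g
      form-+    : ∀ f g → form (f +Λ g) ≈ form f + form g
      form-•    : ∀ x f → form (x • f) ≈ x * form f

    form-0 : form 0Λ ≈ 0#
    form-0 = trans (form-cong {0Λ} {0# • 0Λ} λ _ → sym (zeroˡ _)) (trans (form-• 0# 0Λ) (zeroˡ _))

    form-∑ : ∀ {n} (F : Fin n → Λ) → form (SumΛ.sum F) ≈ ∑ (form ∘ F)
    form-∑ {zero}  F = form-0
    form-∑ {suc n} F = trans (form-+ _ _) (+-congˡ (form-∑ (F ∘ fsuc)))

  open LinearForm public

  coefficientForm : List ℕ → LinearForm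
  coefficientForm α = record
    { form = λ f → coeff f α ; form-cong = λ eq → eq α ; form-+ = λ _ _ → refl ; form-• = λ _ _ → refl }

  timesʳ : LinearForm → Λ → LinearForm
  timesʳ φ F = record
    { form = λ f → form φ (f *Λ F)
    ; form-cong = λ {f} {g} eq → form-cong φ {f *Λ F} {g *Λ F} (conv-cong eq λ _ → refl)
    ; form-+ = λ f g → trans (form-cong φ {(f +Λ g) *Λ F} {(f *Λ F) +Λ (g *Λ F)}
        (conv-distribʳ (coeff F) (coeff f) (coeff g))) (form-+ φ (f *Λ F) (g *Λ F))
    ; form-• = λ x f → trans (form-cong φ {(x • f) *Λ F} {x • (f *Λ F)} (conv-·ˡ x (coeff f) (coeff F)))
        (form-• φ x (f *Λ F)) }

  timesˡ : LinearForm → Λ → LinearForm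
  timesˡ φ F = record
    { form = λ f → form φ (F *Λ f)
    ; form-cong = λ {f} {g} eq → form-cong φ {F *Λ f} {F *Λ g} (conv-cong {f = coeff F} (λ _ → refl) eq)
    ; form-+ = λ f g → trans (form-cong φ {F *Λ (f +Λ g)} {(F *Λ f) +Λ (F *Λ g)}
        (CommutativeRing.distribˡ seriesRing (coeff F) (coeff f) (coeff g))) (form-+ φ (F *Λ f) (F *Λ g))
    ; form-• = λ x f → trans (form-cong φ {F *Λ (x • f)} {x • (F *Λ f)} (conv-·ʳ x (coeff F) (coeff f)))
        (form-• φ x (F *Λ f)) }

  -- M = Σ q_e p_b h_{e-b}, where Q is the functional with coefficients q_e.
  Represents : Λ → Functional → (ℕ → Carrier) → Set (c ⊔ ℓ)
  Represents M Q p = ∀ φ → form φ M ≈ apply Q λ e → cauchy e λ b m → p b * form φ (h m)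

  form-sign : ∀ φ n F → form φ (((-Λ h 0) SumΛ.^ n) *Λ F) ≈ (- 1#) ^ n * form φ F
  form-sign φ n F = trans (form-cong φ {((-Λ h 0) SumΛ.^ n) *Λ F} {((- 1#) ^ n) • F} λ α → trans
    (conv-cong {g = coeff F} (DetHom.hom-power Λ-rawRing seriesRing coeff (λ _ _ _ → refl) (λ _ _ _ → refl)
      (λ _ _ → refl) (λ _ → refl) (λ _ → refl) (-Λ h 0) n) (λ _ → refl) α)
    (signS n (coeff F) α)) (form-• φ _ F)

  tensor-sum : ∀ {n m} (Q : Fin n → Functional) (X : Fin m → Series) →
    tensor Q (λ α → ∑ λ i → X i α) ≈ ∑ λ i → tensor Q (X i)
  tensor-sum Q X = trans
    (tensor-cong Q λ α _ → ∑-cong (λ i → X i α) (λ i → 1# * X i α) λ i → sym (*-identityˡ _))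
    (trans (tensor-∑ Q (λ _ → 1#) X)
      (∑-cong (λ i → 1# * tensor Q (X i)) (λ i → tensor Q (X i)) λ i → *-identityˡ _))

  conv-combination : ∀ {m} (x : Fin m → Carrier) (X : Fin m → Series) k α →
    conv (λ β → ∑ λ i → x i * X i β) k α ≈ ∑ λ i → x i * conv (X i) k α
  conv-combination x X k α = trans (conv-∑ˡ (λ i → x i · X i) k α)
    (∑-cong (λ i → conv (x i · X i) k α) (λ i → x i * conv (X i) k α) λ i → conv-·ˡ (x i) (X i) k α)

  -- Along the first row `Represents` replaces each entry by complete functions h_m. Multiplication
  -- by h_m is absorbed into the form, which turns `k` into its slice at m, and induction applies to
  -- the minor; the sums over b and m then make up the convolution with `k`.
  det-pairing : ∀ {n} (M : Fin n → Fin n → Λ) (Q : Fin n → Functional) (p : Fin n → ℕ → Carrier) →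
    (∀ i j → Represents (M i j) (Q i) (p j)) → ∀ φ k →
    (∀ b → length b ≡ n → form φ (hProduct b) ≈ k b) →
    form φ (DetΛ.det M) ≈ tensor Q (conv (alternant p) k)
  det-pairing {zero}  M Q p rep φ k dual = trans (dual [] ≡.refl) (sym (*-identityˡ _))
  det-pairing {suc n} M Q p rep φ k dual = begin
    form φ (DetΛ.det M)
      ≈⟨ form-∑ φ (λ j → ((-Λ h 0) SumΛ.^ toℕ j) *Λ (M fzero j *Λ D j)) ⟩
    ∑ (λ j → form φ (((-Λ h 0) SumΛ.^ toℕ j) *Λ (M fzero j *Λ D j)))
      ≈⟨ ∑-cong (λ j → form φ (((-Λ h 0) SumΛ.^ toℕ j) *Λ (M fzero j *Λ D j))) (λ j → sgn j * apply Q₀ (B j))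
           (λ j → trans (form-sign φ (toℕ j) (M fzero j *Λ D j)) (*-congˡ (expand j))) ⟩
    (∑ λ j → sgn j * apply Q₀ (B j))
      ≈⟨ apply-∑ Q₀ sgn B ⟨
    apply Q₀ (λ e → ∑ λ j → sgn j * B j e)
      ≈⟨ apply-cong Q₀ collect ⟩
    apply Q₀ (λ e → tensor Q′ (λ α → conv (alternant p) k (e ∷ α))) ∎
    where
    Q₀ : Functional
    Q₀ = Q fzero
    Q′ : Fin n → Functional
    Q′ = Q ∘ fsuc
    D : Fin (suc n) → Λ
    D j = DetΛ.det λ i l → M (fsuc i) (punchIn j l)
    sgn : Fin (suc n) → Carrier
    sgn j = (- 1#) ^ toℕ j
    t : Fin (suc n) → ℕ → Carrier
    t j m = tensor Q′ (conv (alternant (p ∘ punchIn j)) λ β → k (m ∷ β))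
    B : Fin (suc n) → ℕ → Carrier
    B j e = cauchy e λ b m → p j b * t j m
    expand : ∀ j → form φ (M fzero j *Λ D j) ≈ apply Q₀ (B j)
    expand j = trans (rep fzero j (timesʳ φ (D j))) (apply-cong Q₀ λ e → cauchy-cong e
      {λ b m → p j b * form φ (h m *Λ D j)} {λ b m → p j b * t j m} λ b m → *-congˡ
      (det-pairing (λ i l → M (fsuc i) (punchIn j l)) Q′ (p ∘ punchIn j) (λ i l → rep (fsuc i) (punchIn j l))
        (timesˡ φ (h m)) (λ β → k (m ∷ β)) λ b eq → dual (m ∷ b) (≡.cong suc eq)))
    collect : ∀ e → (∑ λ j → sgn j * B j e) ≈ tensor Q′ (λ α → conv (alternant p) k (e ∷ α))
    collect e = begin
      (∑ λ j → sgn j * B j e)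
        ≈⟨ ∑-cong (λ j → sgn j * B j e) (λ j → cauchy e λ b m → (sgn j * p j b) * t j m) (λ j → trans
             (*-distribˡ-sum {suc e} (sgn j) (λ i → p j (toℕ i) * t j (e ∸ toℕ i)))
             (cauchy-cong e {λ b m → sgn j * (p j b * t j m)} {λ b m → (sgn j * p j b) * t j m} λ b m →
               sym (*-assoc _ _ _))) ⟩
      (∑ λ j → cauchy e λ b m → (sgn j * p j b) * t j m)
        ≈⟨ ∑-comm {_} {suc e} (λ j i → (sgn j * p j (toℕ i)) * t j (e ∸ toℕ i)) ⟩
      cauchy e (λ b m → ∑ λ j → (sgn j * p j b) * t j m)
        ≈⟨ cauchy-cong e (λ b m → tensor-∑ Q′ (λ j → sgn j * p j b)
             (λ j → conv (alternant (p ∘ punchIn j)) λ β → k (m ∷ β))) ⟨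
      cauchy e (λ b m → tensor Q′ λ α → ∑ λ j → (sgn j * p j b) * conv (alternant (p ∘ punchIn j)) (λ β → k (m ∷ β)) α)
        ≈⟨ cauchy-cong e (λ b m → tensor-cong Q′ λ α _ → sym (trans
             (conv-cong {g = λ β → k (m ∷ β)} (λ β → ∑-cong (λ j → sgn j * (p j b * alternant (p ∘ punchIn j) β))
                 (λ j → (sgn j * p j b) * alternant (p ∘ punchIn j) β) λ j → sym (*-assoc _ _ _)) (λ _ → refl) α)
             (conv-combination (λ j → sgn j * p j b) (λ j → alternant (p ∘ punchIn j)) (λ β → k (m ∷ β)) α))) ⟩
      cauchy e (λ b m → tensor Q′ λ α → conv (λ β → alternant p (b ∷ β)) (λ β → k (m ∷ β)) α)
        ≈⟨ tensor-sum {m = suc e} Q′ (λ i → conv (λ β → alternant p (toℕ i ∷ β)) (λ β → k ((e ∸ toℕ i) ∷ β))) ⟨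
      tensor Q′ (λ α → conv (alternant p) k (e ∷ α)) ∎

-- Lists of partitions of bounded length and size

∅ : Partition
∅ = mkPartition [] ([] , [])

sum-tabulate-+ : ∀ {n} (f g : Fin n → ℕ) →
  sum (List.tabulate λ i → f i ℕ.+ g i) ≡ sum (List.tabulate f) ℕ.+ sum (List.tabulate g)
sum-tabulate-+ {zero}  f g = ≡.refl
sum-tabulate-+ {suc n} f g = ≡.trans (≡.cong (f fzero ℕ.+ g fzero ℕ.+_) (sum-tabulate-+ (f ∘ fsuc) (g ∘ fsuc)))
  (interchange (f fzero) (g fzero) _ _)

sum-parts : ∀ ν n → ℓ⟨ ν ⟩ ≤ n → sum (List.tabulate {n = n} λ i → part ν (toℕ i)) ≡ ∣ ν ∣
sum-parts (mkPartition xs (l , a)) n le = total xs l a n le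
  where
  total : ∀ xs l a n → length xs ≤ n →
    sum (List.tabulate {n = n} λ i → part (mkPartition xs (l , a)) (toℕ i)) ≡ sum xs
  total []       l a zero    le       = ≡.refl
  total []       l a (suc n) le       = total [] l a n z≤n
  total (x ∷ xs) l a (suc n) (s≤s le) = ≡.cong (x ℕ.+_) (total xs (Linked.tail l) (All.tail a) n le)

sum-exponentList : ∀ ν n → ℓ⟨ ν ⟩ ≤ n → sum (exponentList ν n) ≡ ∣ ν ∣ ℕ.+ sum (exponentList ∅ n)
sum-exponentList ν n le = ≡.trans (sum-tabulate-+ {n} (λ i → part ν (toℕ i)) (λ i → n ∸ suc (toℕ i)))
  (≡.cong (ℕ._+ sum (exponentList ∅ n)) (sum-parts ν n le))

within : ℕ → ℕ → List Partition
within n D = filter (λ ν → ℓ⟨ ν ⟩ ℕₚ.≤? n) (partitionsUpTo D)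

within-unique : ∀ n D → Unique (within n D)
within-unique n D = Unique.filter⁺ (λ ν → ℓ⟨ ν ⟩ ℕₚ.≤? n) (partitionsUpTo-unique D)

∈-within : ∀ n D ν → ℓ⟨ ν ⟩ ≤ n → ∣ ν ∣ ≤ D → ν ∈ within n D
∈-within n D ν ℓ≤n size = ∈-filter⁺ (λ ν → ℓ⟨ ν ⟩ ℕₚ.≤? n) (∈-partitionsUpTo D ν size) ℓ≤n

within-length : ∀ n D {ν} → ν ∈ within n D → ℓ⟨ ν ⟩ ≤ n
within-length n D ν∈ = proj₂ (∈-filter⁻ (λ ν → ℓ⟨ ν ⟩ ℕₚ.≤? n) {xs = partitionsUpTo D} ν∈)

within-size : ∀ n D {ν} → ν ∈ within n D → ∣ ν ∣ ≤ D
within-size n D ν∈ = partitionsUpTo-size D (proj₁ (∈-filter⁻ (λ ν → ℓ⟨ ν ⟩ ℕₚ.≤? n) {xs = partitionsUpTo D} ν∈))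

-- The length of a partition is at most its size, so the condition on the length is void here.
within-all : ∀ n D → D ≤ n → within n D ≡ partitionsUpTo D
within-all n D D≤n = filter-all (λ ν → ℓ⟨ ν ⟩ ℕₚ.≤? n)
  (All.tabulate λ {ν} ν∈ → ℕₚ.≤-trans (length≤size ν) (ℕₚ.≤-trans (partitionsUpTo-size D ν∈) D≤n))

trailing-zeros : ∀ α → ∃ λ β → ∃ λ z → α ↭ β ++ replicate z 0 × length β ≤ sum α
trailing-zeros []          = [] , 0 , ↭.refl , z≤n
trailing-zeros (zero ∷ α)  = let β , z , p , le = trailing-zeros α in
  β , suc z , ↭-trans (↭.prep 0 p) (↭-sym (shift-↭ 0 β (replicate z 0))) , le
trailing-zeros (suc a ∷ α) = let β , z , p , le = trailing-zeros α in
  suc a ∷ β , z , ↭.prep (suc a) p , s≤s (ℕₚ.≤-trans le (ℕₚ.m≤n+m (sum α) a))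

-- Expansion of alternating series in monomial alternants

module Straightening {c ℓ} (R : CommutativeRing c ℓ) where
  open SymmetricFunctions R
  open CommutativeRing R hiding (zero)
  open RawSemiringDefs (RawRing.rawSemiring rawRing) using (product)
  open RingProperties ring using (-0#≈0#; -‿+-comm; -‿distribʳ-*)
  open SetoidReasoning setoid
  open RingTheory R using (det; det-crossing)
  open AlternatingSeries R
  open Variables R

  sumOver : List Partition → (Partition → Carrier) → Carrier
  sumOver L F = foldr (λ ν s → F ν + s) 0# L

  sumOver-cong : ∀ L {F G} → (∀ {ν} → ν ∈ L → F ν ≈ G ν) → sumOver L F ≈ sumOver L G
  sumOver-cong []      eq = refl
  sumOver-cong (ν ∷ L) eq = +-cong (eq (here ≡.refl)) (sumOver-cong L (eq ∘ there))

  sumOver-zero : ∀ L {F} → (∀ {ν} → ν ∈ L → F ν ≈ 0#) → sumOver L F ≈ 0#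
  sumOver-zero []      eq = refl
  sumOver-zero (ν ∷ L) eq = trans (+-cong (eq (here ≡.refl)) (sumOver-zero L (eq ∘ there))) (+-identityˡ _)

  sumOver-+ : ∀ L F G → sumOver L (λ ν → F ν + G ν) ≈ sumOver L F + sumOver L G
  sumOver-+ []      F G = sym (+-identityˡ _)
  sumOver-+ (ν ∷ L) F G = begin
    (F ν + G ν) + sumOver L (λ ν → F ν + G ν)  ≈⟨ +-congˡ (sumOver-+ L F G) ⟩
    (F ν + G ν) + (sumOver L F + sumOver L G)  ≈⟨ medial (F ν) (G ν) _ _ ⟩
    (F ν + sumOver L F) + (G ν + sumOver L G)  ∎
    where open CommutativeSemigroupProperties (CommutativeRing.+-commutativeSemigroup R) renaming (interchange to medial)

  sumOver-swap : ∀ L L′ (F : Partition → Partition → Carrier) →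
    sumOver L (λ ν → sumOver L′ (F ν)) ≈ sumOver L′ (λ κ → sumOver L λ ν → F ν κ)
  sumOver-swap []      L′ F = sym (sumOver-zero L′ λ _ → refl)
  sumOver-swap (ν ∷ L) L′ F = trans (+-congˡ (sumOver-swap L L′ F)) (sym (sumOver-+ L′ (F ν) _))

  δ-equal : ∀ ν κ → parts ν ≡ parts κ → δ ν κ ≈ 1#
  δ-equal ν κ eq = reflexive (≡.cong (λ b → if b then 1# else 0#) (dec-true (≡-dec ℕₚ._≟_ (parts ν) (parts κ)) eq))

  δ-distinct : ∀ ν κ → parts ν ≢ parts κ → δ ν κ ≈ 0#
  δ-distinct ν κ neq = reflexive (≡.cong (λ b → if b then 1# else 0#) (dec-false (≡-dec ℕₚ._≟_ (parts ν) (parts κ)) neq))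

  δ-symmetric : ∀ κ ν → δ κ ν ≈ δ ν κ
  δ-symmetric κ ν with ≡-dec ℕₚ._≟_ (parts κ) (parts ν)
  ... | yes eq = sym (δ-equal ν κ (≡.sym eq))
  ... | no neq = sym (δ-distinct ν κ (neq ∘ ≡.sym))

  sumOver-δ-∉ : ∀ L {ν} (Y : Partition → Carrier) → ν ∉ L → sumOver L (λ κ → Y κ * δ κ ν) ≈ 0#
  sumOver-δ-∉ L {ν} Y ν∉ = sumOver-zero L λ {κ} κ∈ → trans
    (*-congˡ (δ-distinct κ ν λ eq → ν∉ (≡.subst (_∈ L) (parts-injective eq) κ∈))) (zeroʳ _)

  sumOver-δ : ∀ {L} → Unique L → ∀ {ν} (Y : Partition → Carrier) → ν ∈ L → sumOver L (λ κ → Y κ * δ κ ν) ≈ Y ν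
  sumOver-δ {ν ∷ L} (ν∉ ∷ L!) Y (here ≡.refl) = trans
    (+-cong (trans (*-congˡ (δ-equal ν ν ≡.refl)) (*-identityʳ _))
            (sumOver-δ-∉ L Y λ ν∈ → All.lookup ν∉ ν∈ ≡.refl))
    (+-identityʳ _)
  sumOver-δ {κ ∷ L} (κ∉ ∷ L!) {ν} Y (there ν∈) = trans
    (+-cong (trans (*-congˡ (δ-distinct κ ν λ eq → All.lookup κ∉ ν∈ (parts-injective eq))) (zeroʳ _))
            (sumOver-δ L! Y ν∈))
    (+-identityˡ _)

  sumOver-within-δ : ∀ n D ν (Y : Partition → Carrier) → ℓ⟨ ν ⟩ ≤ n → (D < ∣ ν ∣ → Y ν ≈ 0#) →
    sumOver (within n D) (λ κ → Y κ * δ κ ν) ≈ Y ν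
  sumOver-within-δ n D ν Y ℓ≤n big with ∣ ν ∣ ℕₚ.≤? D
  ... | yes small = sumOver-δ (within-unique n D) Y (∈-within n D ν ℓ≤n small)
  ... | no  large = trans (sumOver-δ-∉ (within n D) Y (large ∘ within-size n D {ν})) (sym (big (ℕₚ.≰⇒> large)))

  -- Each sum is rewritten with `δ` as a double sum over both lists, where the order of summation
  -- can be exchanged; the lists themselves are never compared.
  sumOver-within-change : ∀ n D D′ Z → (∀ ν → ℓ⟨ ν ⟩ ≤ n → D < ∣ ν ∣ → Z ν ≈ 0#) →
    (∀ ν → ℓ⟨ ν ⟩ ≤ n → D′ < ∣ ν ∣ → Z ν ≈ 0#) → sumOver (within n D) Z ≈ sumOver (within n D′) Z
  sumOver-within-change n D D′ Z big big′ = begin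
    sumOver (within n D) Z
      ≈⟨ sumOver-cong (within n D) (λ {ν} ν∈ →
           sumOver-within-δ n D′ ν Z (within-length n D ν∈) (big′ ν (within-length n D ν∈))) ⟨
    sumOver (within n D) (λ ν → sumOver (within n D′) λ κ → Z κ * δ κ ν)
      ≈⟨ sumOver-swap (within n D) (within n D′) (λ ν κ → Z κ * δ κ ν) ⟩
    sumOver (within n D′) (λ κ → sumOver (within n D) λ ν → Z κ * δ κ ν)
      ≈⟨ sumOver-cong (within n D′) (λ {κ} κ∈ → trans
           (sumOver-cong (within n D) λ {ν} _ → symmetric-δ κ ν)
           (sumOver-within-δ n D κ Z (within-length n D′ κ∈) (big κ (within-length n D′ κ∈)))) ⟩
    sumOver (within n D′) Z ∎
    where
    symmetric-δ : ∀ κ ν → Z κ * δ κ ν ≈ Z ν * δ ν κ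
    symmetric-δ κ ν with ≡-dec ℕₚ._≟_ (parts κ) (parts ν)
    ... | yes eq with ≡.refl ← parts-injective {κ} {ν} eq = *-congˡ (sym (δ-equal ν ν ≡.refl))
    ... | no neq = trans (zeroʳ _) (sym (trans (*-congˡ (δ-distinct ν κ (neq ∘ ≡.sym))) (zeroʳ _)))

  product-one : ∀ {n} (f : Fin n → Carrier) → (∀ i → f i ≈ 1#) → product f ≈ 1#
  product-one {zero}  f eq = refl
  product-one {suc n} f eq = trans (*-cong (eq fzero) (product-one (f ∘ fsuc) (eq ∘ fsuc))) (*-identityˡ _)

  product-zero : ∀ {n} (f : Fin n → Carrier) i → f i ≈ 0# → product f ≈ 0#
  product-zero f fzero    eq = trans (*-congʳ eq) (zeroˡ _)
  product-zero f (fsuc i) eq = trans (*-congˡ (product-zero (f ∘ fsuc) i eq)) (zeroʳ _)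

  det-crossing-δ : ∀ {n} (M : Fin n → Fin n → Carrier) lam mu → ℓ⟨ lam ⟩ ≤ n → ℓ⟨ mu ⟩ ≤ n →
    (∀ i j → toℕ i < toℕ j → part mu (toℕ j) ≤ part lam (toℕ i) → M i j ≈ 0#) →
    (∀ i j → toℕ j < toℕ i → part lam (toℕ i) < part mu (toℕ j) → M i j ≈ 0#) →
    (∀ i → part lam (toℕ i) ≢ part mu (toℕ i) → M i i ≈ 0#) →
    (∀ i → part lam (toℕ i) ≡ part mu (toℕ i) → M i i ≈ 1#) →
    det M ≈ δ lam mu
  det-crossing-δ {n} M lam mu ℓlam ℓmu upper lower off on = trans
    (det-crossing M (part lam ∘ toℕ) (part mu ∘ toℕ) (part-antitone lam) (part-antitone mu) upper lower off)
    diagonal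
    where
    diagonal : product (λ i → M i i) ≈ δ lam mu
    diagonal with ≡-dec ℕₚ._≟_ (parts lam) (parts mu)
    ... | yes eq with ≡.refl ← parts-injective {lam} {mu} eq = product-one _ λ i → on i ≡.refl
    ... | no neq with all? (λ (i : Fin n) → part lam (toℕ i) ℕₚ.≟ part mu (toℕ i))
    ...   | yes same = contradiction (part-injective-< lam mu n ℓlam ℓmu λ i i<n →
              ≡.subst (λ k → part lam k ≡ part mu k) (toℕ-fromℕ< i<n) (same (fromℕ< i<n))) neq
    ...   | no ¬same = let i , i≢ = ¬∀⟶∃¬ n _ (λ i → part lam (toℕ i) ℕₚ.≟ part mu (toℕ i)) ¬same in
              product-zero (λ i → M i i) i (off i i≢)

  indicator-equal : ∀ d → indicator d d ≈ 1#
  indicator-equal d = reflexive (≡.cong (λ b → if b then 1# else 0#) (dec-true (d ℕₚ.≟ d) ≡.refl))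

  indicator-distinct : ∀ {d a} → a ≢ d → indicator d a ≈ 0#
  indicator-distinct {d} {a} neq = reflexive (≡.cong (λ b → if b then 1# else 0#) (dec-false (a ℕₚ.≟ d) neq))

  exponents-< : ∀ {p q i j n} → i < j → j < n → p ≤ q → p ℕ.+ (n ∸ suc j) < q ℕ.+ (n ∸ suc i)
  exponents-< i<j j<n p≤q = ℕₚ.+-mono-≤-< p≤q (ℕₚ.∸-monoʳ-< (s≤s i<j) j<n)

  -- Adding δ makes weak inequalities between parts strict, so for i ≠ j the exponents differ
  -- wherever `det-crossing-δ` asks for a zero, and no permutations have to be considered.
  monomialAlternant-exponents : ∀ n ν κ → ℓ⟨ ν ⟩ ≤ n → ℓ⟨ κ ⟩ ≤ n →
    monomialAlternant (exponents ν n) (exponentList κ n) ≈ δ κ ν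
  monomialAlternant-exponents n ν κ ℓν ℓκ = trans
    (alternant-tabulate (indicator ∘ exponents ν n) (exponents κ n))
    (det-crossing-δ (λ i j → indicator (exponents ν n j) (exponents κ n i)) κ ν ℓκ ℓν
      (λ i j i<j ν≤κ → indicator-distinct (ℕₚ.>⇒≢ (exponents-< i<j (toℕ<n j) ν≤κ)))
      (λ i j j<i κ<ν → indicator-distinct (ℕₚ.<⇒≢ (exponents-< j<i (toℕ<n i) (ℕₚ.<⇒≤ κ<ν))))
      (λ i κ≢ν → indicator-distinct λ eq → κ≢ν (ℕₚ.+-cancelʳ-≡ _ _ _ eq))
      (λ i κ≡ν → ≡.subst (λ k → indicator (exponents ν n i) (k ℕ.+ (n ∸ suc (toℕ i))) ≈ 1#) (≡.sym κ≡ν)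
                   (indicator-equal (exponents ν n i))))

  alternating-↭ : ∀ {X α β} → Alternating X → α ↭ β → X α ≈ 0# → X β ≈ 0#
  alternating-↭ alt ↭.refl z = z
  alternating-↭ alt (↭.prep x p) z = alternating-↭ (slice-alternating alt x) p z
  alternating-↭ {X} alt (↭.swap {ys = β} x y p) z = trans (transpose alt [] y x β)
    (trans (-‿cong (alternating-↭ (slice-alternating (slice-alternating alt x) y) p z)) -0#≈0#)
  alternating-↭ alt (↭.trans p q) z = alternating-↭ alt q (alternating-↭ alt p z)

  -- Sorting α yields a repetition or some κ + δ. Only κ + δ of the same total degree as α are
  -- inspected, which lets `alternating-from-tensor` work in one degree at a time.
  alternating-zero : ∀ {X} → Alternating X → ∀ n α → length α ≡ n →
    (∀ κ → ℓ⟨ κ ⟩ ≤ n → sum (exponentList κ n) ≡ sum α → X (exponentList κ n) ≈ 0#) → X α ≈ 0#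
  alternating-zero {X} alt n α ≡.refl vanish = let β , p , sorted = decreasing-sort α in
    alternating-↭ alt p (on-sorted β p (strict-or-repeated sorted))
    where
    on-sorted : ∀ β → β ↭ α → Linked ℕ._>_ β ⊎ (∃ λ pre → ∃₂ λ x post → β ≡ pre ++ x ∷ x ∷ post) → X β ≈ 0#
    on-sorted β p (inj₂ (pre , x , post , ≡.refl)) = repeated alt pre x post
    on-sorted β p (inj₁ strict) with strict-exponents strict
    ... | κ , ℓκ , eq = ≡.subst (λ γ → X γ ≈ 0#) eq′
        (vanish κ (≡.subst (ℓ⟨ κ ⟩ ≤_) (↭-length p) ℓκ) (≡.trans (≡.cong sum eq′) (sum-↭ p)))
        where
        eq′ : exponentList κ (length α) ≡ β
        eq′ = ≡.trans (≡.cong (exponentList κ) (≡.sym (↭-length p))) eq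

  alternating-combination : ∀ {X Y} x → Alternating X → Alternating Y → Alternating (λ α → X α + x * Y α)
  alternating-combination {X} {Y} x altX altY = record
    { transpose = λ pre a b post → trans
        (+-cong (transpose altX pre a b post) (*-congˡ (transpose altY pre a b post)))
        (trans (+-congˡ (sym (-‿distribʳ-* x _))) (-‿+-comm _ _))
    ; repeated = λ pre a post → trans
        (+-cong (repeated altX pre a post) (trans (*-congˡ (repeated altY pre a post)) (zeroʳ x)))
        (+-identityˡ _) }

  alternating-sumOver : ∀ L (x : Partition → Carrier) (X : Partition → Series) → (∀ ν → Alternating (X ν)) →
    Alternating (λ α → sumOver L λ ν → x ν * X ν α)
  alternating-sumOver []      x X alt = record
    { transpose = λ _ _ _ _ → sym -0#≈0# ; repeated = λ _ _ _ → refl }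
  alternating-sumOver (ν ∷ L) x X alt = record
    { transpose = λ pre a b post → trans (+-comm _ _)
        (trans (transpose both pre a b post) (-‿cong (+-comm _ _)))
    ; repeated = λ pre a post → trans (+-comm _ _) (repeated both pre a post) }
    where
    both : Alternating (λ α → sumOver L (λ ν → x ν * X ν α) + x ν * X ν α)
    both = alternating-combination (x ν) (alternating-sumOver L x X alt) (alt ν)

  alternating-unique : ∀ {X Y} → Alternating X → Alternating Y → ∀ n →
    (∀ κ → ℓ⟨ κ ⟩ ≤ n → X (exponentList κ n) ≈ Y (exponentList κ n)) → EqualIn n X Y
  alternating-unique {X} {Y} altX altY n eq α len = difference-zero
    (alternating-zero (alternating-combination (- 1#) altX altY) n α len λ κ ℓκ _ →
      trans (+-congʳ (eq κ ℓκ)) (cancel _))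
    where
    open RingProperties ring using (-1*x≈-x; x∙y⁻¹≈ε⇒x≈y)
    cancel : ∀ y → y + - 1# * y ≈ 0#
    cancel y = trans (+-congˡ (-1*x≈-x y)) (-‿inverseʳ y)
    difference-zero : ∀ {x y} → x + - 1# * y ≈ 0# → x ≈ y
    difference-zero {x} {y} z = x∙y⁻¹≈ε⇒x≈y x y (trans (+-congˡ (sym (-1*x≈-x y))) z)

  -- The alternants of ν + δ have coefficient `δ` at κ + δ, so both sides agree at every κ + δ, and
  -- this suffices for alternating series.
  straighten : ∀ {X} → Alternating X → ∀ n D → (∀ κ → ℓ⟨ κ ⟩ ≤ n → D < ∣ κ ∣ → X (exponentList κ n) ≈ 0#) →
    EqualIn n X (λ α → sumOver (within n D) λ ν → X (exponentList ν n) * monomialAlternant (exponents ν n) α)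
  straighten {X} alt n D big = alternating-unique alt
    (alternating-sumOver (within n D) (λ ν → X (exponentList ν n)) (λ ν → monomialAlternant (exponents ν n))
      (λ ν → alternant-alternating (indicator ∘ exponents ν n))) n
    λ κ ℓκ → sym (trans
      (sumOver-cong (within n D) λ {ν} ν∈ → *-congˡ (trans
        (monomialAlternant-exponents n ν κ (within-length n D ν∈) ℓκ) (δ-symmetric κ ν)))
      (sumOver-within-δ n D κ (λ ν → X (exponentList ν n)) ℓκ (big κ ℓκ)))

-- Multiplication by a_δ, and spanning of Λ by Schur functions

module Spanning {c ℓ} (R : CommutativeRing c ℓ) where
  open SymmetricFunctions R
  open CommutativeRing R hiding (zero)
  open SemiringSum semiring using () renaming (sum to ∑)
  open RawSemiringDefs (RawRing.rawSemiring rawRing) using (_^_)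
  open RingProperties ring using (x∙y⁻¹≈ε⇒x≈y)
  open SetoidReasoning setoid
  open RingTheory R using (shifted; ∑-zero; term-zero)
  open CauchySums R
  open SeriesRing R
  open AlternatingSeries R
  open Variables R
  open Functionals R
  open Duality R
  open Straightening R
  private
    module SeriesR = CommutativeRing seriesRing

  staircaseAlternant : ℕ → Series
  staircaseAlternant n = monomialAlternant (exponents ∅ n)

  -- Multiplication by a_δ, written as an alternant because alternation and degree bounds are then
  -- available at once.
  antisymmetrise : ℕ → Series → Series
  antisymmetrise n = conv (staircaseAlternant n)

  -- The case ν = ∅ of a_δ s_ν = a_(ν+δ), because s_∅ = 1.
  vandermonde-staircase : ∀ n → EqualIn n (vandermonde n) (staircaseAlternant n)
  vandermonde-staircase n α len = trans (sym (SeriesR.*-identityʳ (vandermonde n) α))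
    (vandermonde-schur ∅ n z≤n α len)

  antisymmetrise-schur : ∀ n ν → ℓ⟨ ν ⟩ ≤ n →
    EqualIn n (antisymmetrise n (coeff (schur ν))) (monomialAlternant (exponents ν n))
  antisymmetrise-schur n ν ℓν α len = trans
    (conv-congIn n {g = coeff (schur ν)} (λ β l → sym (vandermonde-staircase n β l)) (λ _ _ → refl) α len)
    (vandermonde-schur ν n ℓν α len)

  antisymmetrise-alternating : ∀ n {f} → Symmetric f → Alternating (antisymmetrise n f)
  antisymmetrise-alternating n = conv-alternating (alternant-alternating (indicator ∘ exponents ∅ n))

  antisymmetrise-vanish : ∀ n {D f} → DegreeAtMost D f → ∀ κ → ℓ⟨ κ ⟩ ≤ n → D < ∣ κ ∣ →
    antisymmetrise n f (exponentList κ n) ≈ 0#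
  antisymmetrise-vanish n {D} {f} bound κ ℓκ D<κ = conv-bounded {sum (exponentList ∅ n)} {D} {staircaseAlternant n} {f}
    (alternant-bounded (indicator ∘ exponents ∅ n) (exponents ∅ n) λ j e d<e → indicator-distinct (ℕₚ.>⇒≢ d<e))
    bound (exponentList κ n)
    (≡.subst₂ _<_ (ℕₚ.+-comm D _) (≡.sym (sum-exponentList κ n ℓκ)) (ℕₚ.+-monoˡ-< _ D<κ))

  conv-sumOver : ∀ A L (x : Partition → Carrier) (X : Partition → Series) α →
    conv A (λ β → sumOver L λ ν → x ν * X ν β) α ≈ sumOver L λ ν → x ν * conv A (X ν) α
  conv-sumOver A []      x X α = conv-zeroʳ A (λ _ → refl) α
  conv-sumOver A (ν ∷ L) x X α = trans
    (SeriesR.distribˡ A (x ν · X ν) (λ β → sumOver L λ ν → x ν * X ν β) α)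
    (+-cong (conv-·ʳ (x ν) A (X ν) α) (conv-sumOver A L x X α))

  cauchy-single : ∀ n e (F : ℕ → ℕ → Carrier) → (∀ b m → n < b → F b m ≈ 0#) → (∀ b m → e < m → F b m ≈ 0#) →
    cauchy (n ℕ.+ e) F ≈ F n e
  cauchy-single zero    zero    F high low = +-identityʳ _
  cauchy-single zero    (suc e) F high low = trans
    (+-congˡ (cauchy-zero e λ b m → high (suc b) m (s≤s z≤n))) (+-identityʳ _)
  cauchy-single (suc n) e       F high low = trans
    (+-cong (low 0 (suc (n ℕ.+ e)) (s≤s (ℕₚ.m≤n+m e n)))
            (cauchy-single n e (λ b m → F (suc b) m) (λ b m n<b → high (suc b) m (s≤s n<b)) (λ b m → low (suc b) m)))
    (+-identityˡ _)

  staircase-high : ∀ n a α → n < a → staircaseAlternant (suc n) (a ∷ α) ≈ 0#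
  staircase-high n a α n<a = ∑-zero
    (λ j → (- 1#) ^ toℕ j * (indicator (exponents ∅ (suc n) j) a * alternant (indicator ∘ exponents ∅ (suc n) ∘ punchIn j) α))
    λ j → term-zero (indicator-distinct (ℕₚ.>⇒≢ (ℕₚ.≤-<-trans (ℕₚ.m∸n≤m n (toℕ j)) n<a)))

  staircase-leading : ∀ n α → staircaseAlternant (suc n) (n ∷ α) ≈ staircaseAlternant n α
  staircase-leading n α = trans
    (+-cong (trans (*-identityˡ _) (trans (*-congʳ (indicator-equal n)) (*-identityˡ _)))
            (∑-zero (λ j → (- 1#) ^ toℕ (fsuc j) * (indicator (exponents ∅ (suc n) (fsuc j)) n
                            * alternant (indicator ∘ exponents ∅ (suc n) ∘ punchIn (fsuc j)) α))
               λ j → term-zero (indicator-distinct (ℕₚ.>⇒≢ (ℕₚ.∸-monoʳ-< {n} {suc (toℕ j)} {0} (s≤s z≤n) (toℕ<n j))))))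
    (+-identityʳ _)

  -- In n + 1 variables the top power of the first variable in a_δ is the n-th, with coefficient a_δ
  -- of the remaining ones. Descending in e from the degree bound, the coefficient of a_δ F at first
  -- exponent n + e is that leading coefficient times the slice of `F` at e, because the higher
  -- slices are already zero; induction on n cancels it.
  antisymmetrise-injective : ∀ n d F → (∀ α → length α ≡ n → d < sum α → F α ≈ 0#) →
    EqualIn n (antisymmetrise n F) S.0# → EqualIn n F S.0#
  antisymmetrise-injective zero    d F bound eq [] len = trans (sym (*-identityˡ _)) (eq [] ≡.refl)
  antisymmetrise-injective (suc n) d F bound eq (a ∷ α) len =
    slices (suc d) a (ℕₚ.m≤n+m (suc d) a) α (ℕₚ.suc-injective len)
    where
    slices : ∀ m e → d < e ℕ.+ m → EqualIn n (λ α → F (e ∷ α)) S.0#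
    slices zero    e d<e β l = bound (e ∷ β) (≡.cong suc l)
      (ℕₚ.<-≤-trans (≡.subst (d <_) (ℕₚ.+-identityʳ e) d<e) (ℕₚ.m≤m+n e (sum β)))
    slices (suc m) e d<e = antisymmetrise-injective n d (λ α → F (e ∷ α))
      (λ α l d<α → bound (e ∷ α) (≡.cong suc l) (ℕₚ.<-≤-trans d<α (ℕₚ.m≤n+m (sum α) e)))
      λ α l → begin
        antisymmetrise n (λ β → F (e ∷ β)) α
          ≈⟨ conv-cong {g = λ β → F (e ∷ β)} (staircase-leading n) (λ _ → refl) α ⟨
        conv (λ β → staircaseAlternant (suc n) (n ∷ β)) (λ β → F (e ∷ β)) α
          ≈⟨ cauchy-single n e (λ b m → conv (λ β → staircaseAlternant (suc n) (b ∷ β)) (λ β → F (m ∷ β)) α)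
               (λ b m n<b → conv-zeroˡ (λ β → F (m ∷ β)) (λ β → staircase-high n b β n<b) α)
               (λ b k e<k → trans
                 (conv-congIn n {f = λ β → staircaseAlternant (suc n) (b ∷ β)} (λ _ _ → refl) (above k e<k) α l)
                 (conv-zeroʳ (λ β → staircaseAlternant (suc n) (b ∷ β)) (λ _ → refl) α)) ⟨
        antisymmetrise (suc n) F (n ℕ.+ e ∷ α)
          ≈⟨ eq (n ℕ.+ e ∷ α) (≡.cong suc l) ⟩
        0# ∎
      where
      above : ∀ k → e < k → EqualIn n (λ β → F (k ∷ β)) S.0#
      above k e<k = slices m k (ℕₚ.<-≤-trans d<e (≡.subst (ℕ._≤ k ℕ.+ m) (≡.sym (ℕₚ.+-suc e m)) (ℕₚ.+-monoˡ-≤ m e<k)))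

  -- The same fold as in `truncation`, so that `form-combination` applies to truncations by
  -- computation.
  combination : (Partition → Carrier) → List Partition → Λ
  combination x = foldr (λ ν F → (x ν • schur ν) +Λ F) 0Λ

  combination-coeff : ∀ x L α → coeff (combination x L) α ≡ sumOver L (λ ν → x ν * coeff (schur ν) α)
  combination-coeff x []      α = ≡.refl
  combination-coeff x (ν ∷ L) α = ≡.cong (λ s → x ν * coeff (schur ν) α + s) (combination-coeff x L α)

  schurDegree : List Partition → ℕ
  schurDegree = foldr (λ ν d → degree (schur ν) ℕ.⊔ d) 0

  combination-degree : ∀ x L → degree (combination x L) ≡ schurDegree L
  combination-degree x []      = ≡.refl
  combination-degree x (ν ∷ L) = ≡.cong (degree (schur ν) ℕ.⊔_) (combination-degree x L)

  form-combination : ∀ φ x L → form φ (combination x L) ≈ sumOver L λ ν → x ν * form φ (schur ν)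
  form-combination φ x []      = form-0 φ
  form-combination φ x (ν ∷ L) = trans (form-+ φ (x ν • schur ν) (combination x L))
    (+-cong (form-• φ (x ν) (schur ν)) (form-combination φ x L))

  stable-zeros : ∀ {f} → Stable f → ∀ z α → f (α ++ replicate z 0) ≈ f α
  stable-zeros {f} st zero    α = reflexive (≡.cong f (++-identityʳ α))
  stable-zeros {f} st (suc z) α = trans
    (reflexive (≡.cong f (≡.sym (++-assoc α (0 ∷ []) (replicate z 0)))))
    (trans (stable-zeros st z (α ++ 0 ∷ [])) (st α))

  -- A monomial of degree at most N involves at most N variables; by symmetry and stability its
  -- coefficient also occurs in exactly N variables.
  zero-from : ∀ (X : Λ) N → degree X ≤ N → EqualIn N (coeff X) S.0# → coeff X ≋ S.0#
  zero-from X N deg eq α with degree X ℕₚ.<? sum α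
  ... | yes high = bounded X α high
  ... | no  low  = begin
    coeff X α
      ≈⟨ symmetric X p ⟩
    coeff X (β ++ replicate z 0)
      ≈⟨ stable-zeros (stable X) z β ⟩
    coeff X β
      ≈⟨ stable-zeros (stable X) (N ∸ length β) β ⟨
    coeff X (β ++ replicate (N ∸ length β) 0)
      ≈⟨ eq _ (≡.trans (length-++ β) (≡.trans (≡.cong (length β ℕ.+_) (length-replicate (N ∸ length β)))
           (ℕₚ.m+[n∸m]≡n (ℕₚ.≤-trans short (ℕₚ.≤-trans (ℕₚ.≮⇒≥ low) deg))))) ⟩
    0# ∎
    where
    decomposition = trailing-zeros α
    β = proj₁ decomposition
    z = proj₁ (proj₂ decomposition)
    p = proj₁ (proj₂ (proj₂ decomposition))
    short = proj₂ (proj₂ (proj₂ decomposition))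

  schurCoefficient : ℕ → Λ → Partition → Carrier
  schurCoefficient N f ν = antisymmetrise N (coeff f) (exponentList ν N)

  -- The coefficients `schurCoefficient N f` depend on N, so the size required of N is expressed
  -- through degrees of Schur functions alone.
  spanningBound : Λ → ℕ
  spanningBound f = degree f ℕ.⊔ schurDegree (partitionsUpTo (degree f))

  -- In N variables both sides agree after multiplication by a_δ, by `straighten`. Then a_δ is
  -- cancelled, and N is large enough for equality in N variables to give equality in Λ.
  spanning : ∀ f N → spanningBound f ≤ N →
    f ≈Λ combination (schurCoefficient N f) (partitionsUpTo (degree f))
  spanning f N N≥ α = x∙y⁻¹≈ε⇒x≈y _ _
    (zero-from (f +Λ (-Λ T)) N (≡.subst (λ d → degree f ℕ.⊔ d ≤ N) (≡.sym (combination-degree x L)) N≥)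
      (antisymmetrise-injective N N (coeff (f +Λ (-Λ T)))
        (λ β _ N<β → bounded (f +Λ (-Λ T)) β (ℕₚ.≤-<-trans
          (≡.subst (λ d → degree f ℕ.⊔ d ≤ N) (≡.sym (combination-degree x L)) N≥) N<β))
        difference) α)
    where
    D : ℕ
    D = degree f
    D≤N : D ≤ N
    D≤N = ℕₚ.≤-trans (ℕₚ.m≤m⊔n D _) N≥
    L : List Partition
    L = partitionsUpTo D
    x : Partition → Carrier
    x = schurCoefficient N f
    T : Λ
    T = combination x L
    same : EqualIn N (antisymmetrise N (coeff T)) (antisymmetrise N (coeff f))
    same β len = begin
      antisymmetrise N (coeff T) β
        ≈⟨ conv-cong {f = staircaseAlternant N} (λ _ → refl) (λ γ → reflexive (combination-coeff x L γ)) β ⟩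
      antisymmetrise N (λ γ → sumOver L λ ν → x ν * coeff (schur ν) γ) β
        ≈⟨ conv-sumOver (staircaseAlternant N) L x (coeff ∘ schur) β ⟩
      sumOver L (λ ν → x ν * antisymmetrise N (coeff (schur ν)) β)
        ≈⟨ sumOver-cong L (λ {ν} ν∈ → *-congˡ (antisymmetrise-schur N ν
             (ℕₚ.≤-trans (length≤size ν) (ℕₚ.≤-trans (partitionsUpTo-size D ν∈) D≤N)) β len)) ⟩
      sumOver L (λ ν → x ν * monomialAlternant (exponents ν N) β)
        ≈⟨ reflexive (≡.cong (λ L → sumOver L (λ ν → x ν * monomialAlternant (exponents ν N) β)) (within-all N D D≤N)) ⟨
      sumOver (within N D) (λ ν → x ν * monomialAlternant (exponents ν N) β)
        ≈⟨ straighten (antisymmetrise-alternating N (symmetric f)) N D (antisymmetrise-vanish N (bounded f)) β len ⟨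
      antisymmetrise N (coeff f) β ∎
    difference : EqualIn N (antisymmetrise N (coeff (f +Λ (-Λ T)))) S.0#
    difference β len = begin
      antisymmetrise N (coeff (f +Λ (-Λ T))) β
        ≈⟨ SeriesR.distribˡ (staircaseAlternant N) (coeff f) (S.- coeff T) β ⟩
      antisymmetrise N (coeff f) β + antisymmetrise N (S.- coeff T) β
        ≈⟨ +-congˡ (trans (conv-comm (staircaseAlternant N) (S.- coeff T) β) (trans
             (conv-negˡ (coeff T) (staircaseAlternant N) β)
             (-‿cong (trans (conv-comm (coeff T) (staircaseAlternant N) β) (same β len))))) ⟩
      antisymmetrise N (coeff f) β + - antisymmetrise N (coeff f) β
        ≈⟨ -‿inverseʳ _ ⟩
      0# ∎

  cauchy-indicator : ∀ e d (T : ℕ → Carrier) → cauchy e (λ b m → indicator d b * T m) ≈ shifted T e d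
  cauchy-indicator e       zero    T = trans (+-cong (*-identityˡ _) (later e)) (+-identityʳ _)
    where
    later : ∀ e → ∑ {e} (λ i → indicator 0 (suc (toℕ i)) * T (e ∸ suc (toℕ i))) ≈ 0#
    later e = ∑-zero {e} (λ i → indicator 0 (suc (toℕ i)) * T (e ∸ suc (toℕ i))) λ i → zeroˡ _
  cauchy-indicator zero    (suc d) T = trans (+-identityʳ _) (zeroˡ _)
  cauchy-indicator (suc e) (suc d) T = trans (+-cong (zeroˡ _) (cauchy-indicator e d T)) (+-identityˡ _)

  form-hℤ : ∀ φ b s → form φ (hℤ (b ⊖ s)) ≈ shifted (form φ ∘ h) b s
  form-hℤ φ b       zero    = refl
  form-hℤ φ zero    (suc s) = form-0 φ
  form-hℤ φ (suc b) (suc s) = trans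
    (reflexive (≡.cong (form φ ∘ hℤ) (ℤₚ.[1+m]⊖[1+n]≡m⊖n b s))) (form-hℤ φ b s)

  -- The Jacobi-Trudi entry is h of index (ν + δ)_i - δ_j. Its row functional is evaluation at (ν +
  -- δ)_i and its column polynomial is t^(δ_j), so the columns assemble to a_δ.
  schur-pairing : ∀ φ n ν → ℓ⟨ ν ⟩ ≤ n → ∀ k → (∀ b → length b ≡ n → form φ (hProduct b) ≈ k b) →
    form φ (schur ν) ≈ antisymmetrise n k (exponentList ν n)
  schur-pairing φ n ν ℓν k dual = begin
    form φ (schur ν)
      ≈⟨ form-cong φ {schur ν} {DetΛ.det M} schur≈ ⟩
    form φ (DetΛ.det M)
      ≈⟨ det-pairing M (evaluateAt ∘ exponents ν n) (indicator ∘ exponents ∅ n) represents φ k dual ⟩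
    tensor (evaluateAt ∘ exponents ν n) (antisymmetrise n k)
      ≈⟨ reflexive (tensor-evaluateAt (exponents ν n) (antisymmetrise n k)) ⟩
    antisymmetrise n k (exponentList ν n) ∎
    where
    M : Fin n → Fin n → Λ
    M i j = hℤ ((part ν (toℕ i) ℕ.+ toℕ j) ⊖ toℕ i)
    schur≈ : schur ν ≈Λ DetΛ.det M
    schur≈ α = trans (≡.subst (λ m → coeff (schur ν) ≋ DetS.det {m} λ i j → schurEntry ν (toℕ i) (toℕ j))
        (ℕₚ.m∸n+n≡m ℓν) (schur-det ν (n ∸ ℓ⟨ ν ⟩)) α)
      (sym (trans (coeff-det M α) (SeriesTheory.det-cong (λ i j → coeff (M i j))
        (λ i j → schurEntry ν (toℕ i) (toℕ j)) (λ i j → hℤ-⊖ (part ν (toℕ i) ℕ.+ toℕ j) (toℕ i)) α)))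
    represents : ∀ i j → Represents (M i j) (evaluateAt (exponents ν n i)) (indicator (exponents ∅ n j))
    represents i j φ = trans (form-hℤ φ (part ν (toℕ i) ℕ.+ toℕ j) (toℕ i))
      (trans (reflexive (shifted-reindex {A = R} (form φ ∘ h) (part ν (toℕ i)) (toℕ<n j) (toℕ<n i)))
        (sym (cauchy-indicator (exponents ν n i) (exponents ∅ n j) (form φ ∘ h))))

-- The Hall product in terms of coefficients

module HallTheory {c ℓ} (R : CommutativeRing c ℓ) (H : SymmetricFunctions.HallProduct R) where
  open SymmetricFunctions R
  open HallProduct H
  open CommutativeRing R hiding (zero)
  open RingProperties ring using (x∙y⁻¹≈ε⇒x≈y; -1*x≈-x)
  open SetoidReasoning setoid
  open Duality R
  open Straightening R
  open Spanning R

  pairingWith : Λ → LinearForm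
  pairingWith k = record
    { form = λ f → ⟨ f , k ⟩ ; form-cong = λ eq → ⟨⟩-cong {g = k} {k} eq (λ _ → refl)
    ; form-+ = λ f g → +-linearˡ f g k ; form-• = λ x f → •-linearˡ x f k }

  pairingOf : Λ → LinearForm
  pairingOf f = record
    { form = λ k → ⟨ f , k ⟩ ; form-cong = λ eq → ⟨⟩-cong {f} {f} (λ _ → refl) eq
    ; form-+ = λ g k → +-linearʳ f g k ; form-• = λ x k → •-linearʳ x f k }

  sumOver-partitionsUpTo-δ : ∀ N D ν Y → D ≤ N → ℓ⟨ ν ⟩ ≤ N → (D < ∣ ν ∣ → Y ν ≈ 0#) →
    sumOver (partitionsUpTo D) (λ κ → Y κ * δ κ ν) ≈ Y ν
  sumOver-partitionsUpTo-δ N D ν Y D≤N ℓν big = ≡.subst (λ L → sumOver L (λ κ → Y κ * δ κ ν) ≈ Y ν)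
    (within-all N D D≤N) (sumOver-within-δ N D ν Y ℓν big)

  schur-orthogonal : ∀ f N → spanningBound f ≤ N → ∀ ν → ℓ⟨ ν ⟩ ≤ N →
    ⟨ schur ν , f ⟩ ≈ schurCoefficient N f ν
  schur-orthogonal f N N≥ ν ℓν = begin
    ⟨ schur ν , f ⟩
      ≈⟨ form-cong (pairingOf (schur ν)) {f} {combination x L} (spanning f N N≥) ⟩
    ⟨ schur ν , combination x L ⟩
      ≈⟨ form-combination (pairingOf (schur ν)) x L ⟩
    sumOver L (λ κ → x κ * ⟨ schur ν , schur κ ⟩)
      ≈⟨ sumOver-cong L (λ {κ} _ → *-congˡ (trans (orthonormal ν κ) (δ-symmetric ν κ))) ⟩
    sumOver L (λ κ → x κ * δ κ ν)
      ≈⟨ sumOver-partitionsUpTo-δ N (degree f) ν x (ℕₚ.≤-trans (ℕₚ.m≤m⊔n (degree f) _) N≥) ℓν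
           (antisymmetrise-vanish N (bounded f) ν ℓν) ⟩
    x ν ∎
    where
    x : Partition → Carrier
    x = schurCoefficient N f
    L : List Partition
    L = partitionsUpTo (degree f)

  -- Pairing with s_ν extracts the coefficient of s_ν in f - g, and by `spanning` these coefficients
  -- determine the difference.
  nondegenerate : ∀ f g → (∀ k → ⟨ f , k ⟩ ≈ ⟨ g , k ⟩) → f ≈Λ g
  nondegenerate f g eq α = x∙y⁻¹≈ε⇒x≈y _ _ (begin
    coeff X α
      ≈⟨ spanning X N ℕₚ.≤-refl α ⟩
    coeff (combination x L) α
      ≈⟨ reflexive (combination-coeff x L α) ⟩
    sumOver L (λ ν → x ν * coeff (schur ν) α)
      ≈⟨ sumOver-zero L (λ {ν} ν∈ → trans (*-congʳ (x≈0 ν (ℕₚ.≤-trans (length≤size ν)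
           (ℕₚ.≤-trans (partitionsUpTo-size (degree X) ν∈) (ℕₚ.m≤m⊔n (degree X) _))))) (zeroˡ _)) ⟩
    0# ∎)
    where
    X : Λ
    X = f +Λ (-Λ g)
    N : ℕ
    N = spanningBound X
    x : Partition → Carrier
    x = schurCoefficient N X
    L : List Partition
    L = partitionsUpTo (degree X)
    X⊥ : ∀ k → ⟨ X , k ⟩ ≈ 0#
    X⊥ k = begin
      ⟨ X , k ⟩                       ≈⟨ +-linearˡ f (-Λ g) k ⟩
      ⟨ f , k ⟩ + ⟨ -Λ g , k ⟩        ≈⟨ +-cong (eq k) (form-cong (pairingWith k) {(-Λ g)} {(- 1#) • g} λ β → sym (-1*x≈-x _)) ⟩
      ⟨ g , k ⟩ + ⟨ (- 1#) • g , k ⟩  ≈⟨ +-congˡ (trans (•-linearˡ (- 1#) g k) (-1*x≈-x _)) ⟩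
      ⟨ g , k ⟩ + - ⟨ g , k ⟩         ≈⟨ -‿inverseʳ _ ⟩
      0#                              ∎
    x≈0 : ∀ ν → ℓ⟨ ν ⟩ ≤ N → x ν ≈ 0#
    x≈0 ν ℓν = begin
      x ν
        ≈⟨ sumOver-partitionsUpTo-δ N (degree X) ν x (ℕₚ.m≤m⊔n (degree X) _) ℓν
             (antisymmetrise-vanish N (bounded X) ν ℓν) ⟨
      sumOver L (λ κ → x κ * δ κ ν)
        ≈⟨ sumOver-cong L (λ {κ} _ → *-congˡ (orthonormal κ ν)) ⟨
      sumOver L (λ κ → x κ * ⟨ schur κ , schur ν ⟩)
        ≈⟨ form-combination (pairingWith (schur ν)) x L ⟨
      ⟨ combination x L , schur ν ⟩
        ≈⟨ form-cong (pairingWith (schur ν)) {X} {combination x L} (spanning X N ℕₚ.≤-refl) ⟨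
      ⟨ X , schur ν ⟩
        ≈⟨ X⊥ (schur ν) ⟩
      0# ∎

  -- With x_ν and y_ν the Schur coefficients of h_b and k, the pairing is Σ x_ν y_ν. The symmetry of
  -- [x^c] h_b in b and c identifies x_ν with [x^b] s_ν, and Σ y_ν s_ν is k.
  hProduct-dual : ∀ b k → ⟨ hProduct b , k ⟩ ≈ coeff k b
  hProduct-dual b k = begin
    ⟨ hProduct b , k ⟩
      ≈⟨ form-cong (pairingWith k) {hProduct b} {combination x (partitionsUpTo D)} (spanning (hProduct b) N N≥b) ⟩
    ⟨ combination x (partitionsUpTo D) , k ⟩
      ≈⟨ form-combination (pairingWith k) x (partitionsUpTo D) ⟩
    sumOver (partitionsUpTo D) (λ ν → x ν * ⟨ schur ν , k ⟩)
      ≈⟨ reflexive (≡.cong (λ L → sumOver L (λ ν → x ν * ⟨ schur ν , k ⟩)) (within-all N D D≤N)) ⟨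
    sumOver (within N D) (λ ν → x ν * ⟨ schur ν , k ⟩)
      ≈⟨ sumOver-cong (within N D) (λ {ν} ν∈ → *-congˡ (schur-orthogonal k N N≥k ν (within-length N D ν∈))) ⟩
    sumOver (within N D) (λ ν → x ν * y ν)
      ≈⟨ sumOver-within-change N D E (λ ν → x ν * y ν)
           (λ ν ℓν big → trans (*-congʳ (antisymmetrise-vanish N (bounded (hProduct b)) ν ℓν big)) (zeroˡ _))
           (λ ν ℓν big → trans (*-congˡ (antisymmetrise-vanish N (bounded k) ν ℓν big)) (zeroʳ _)) ⟩
    sumOver (within N E) (λ ν → x ν * y ν)
      ≈⟨ sumOver-cong (within N E) (λ {ν} ν∈ → trans (*-comm _ _) (*-congˡ (sym
           (schur-pairing (coefficientForm b) N ν (within-length N E ν∈) (coeff (hProduct b))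
             λ c _ → hProduct-symmetric c b)))) ⟩
    sumOver (within N E) (λ ν → y ν * coeff (schur ν) b)
      ≈⟨ reflexive (≡.cong (λ L → sumOver L (λ ν → y ν * coeff (schur ν) b)) (within-all N E E≤N)) ⟩
    sumOver (partitionsUpTo E) (λ ν → y ν * coeff (schur ν) b)
      ≈⟨ reflexive (combination-coeff y (partitionsUpTo E) b) ⟨
    coeff (combination y (partitionsUpTo E)) b
      ≈⟨ spanning k N N≥k b ⟨
    coeff k b ∎
    where
    D E N : ℕ
    D = degree (hProduct b)
    E = degree k
    N = spanningBound (hProduct b) ℕ.⊔ spanningBound k
    N≥b : spanningBound (hProduct b) ≤ N
    N≥b = ℕₚ.m≤m⊔n _ _
    N≥k : spanningBound k ≤ N
    N≥k = ℕₚ.m≤n⊔m (spanningBound (hProduct b)) _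
    D≤N : D ≤ N
    D≤N = ℕₚ.≤-trans (ℕₚ.m≤m⊔n D _) N≥b
    E≤N : E ≤ N
    E≤N = ℕₚ.≤-trans (ℕₚ.m≤m⊔n E _) N≥k
    x y : Partition → Carrier
    x = schurCoefficient N (hProduct b)
    y = schurCoefficient N k

  -- `schur-orthogonal` gives this for large n only. Now that all h-products are known to pair with
  -- coefficients, any n from the length of ν on will do, so the right side does not depend on n.
  schur-dual : ∀ n ν k → ℓ⟨ ν ⟩ ≤ n → ⟨ schur ν , k ⟩ ≈ antisymmetrise n (coeff k) (exponentList ν n)
  schur-dual n ν k ℓν = schur-pairing (pairingWith k) n ν ℓν (coeff k) λ b _ → hProduct-dual b k

-- Binomial coefficients with integer top

-- Division of a negative integer branches on the remainder, so exactness has to be supplied in that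
-- form.
neg-/ℕ : ∀ n d .{{_ : NonZero d}} → suc n ℕ.% d ≡ 0 → -[1+ n ] ℤ./ℕ d ≡ ℤ.- + (suc n ℕ./ d)
neg-/ℕ n d eq with suc n ℕ.% d
neg-/ℕ n d ≡.refl | .0 = ≡.refl

multiple-/ℕ : ∀ z d .{{_ : NonZero d}} → (z ℤ.* + d) ℤ./ℕ d ≡ z
multiple-/ℕ (+ n) d = ≡.trans (≡.cong (ℤ._/ℕ d) (≡.sym (ℤₚ.pos-* n d))) (≡.cong +_ (DivMod.m*n/n≡m n d))
multiple-/ℕ -[1+ n ] (suc d) = ≡.trans (neg-/ℕ (d ℕ.+ n ℕ.* suc d) (suc d) (DivMod.m*n%n≡0 (suc n) (suc d)))
  (≡.cong (λ q → ℤ.- + q) (DivMod.m*n/n≡m (suc n) (suc d)))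

falling-suc : ∀ a n → falling (a ℤ.+ ℤ.1ℤ) (suc n) ≡ (a ℤ.+ ℤ.1ℤ) ℤ.* falling a n
falling-suc a zero    = step a
  where
  step : ∀ a → ℤ.1ℤ ℤ.* ((a ℤ.+ ℤ.1ℤ) ℤ.- ℤ.0ℤ) ≡ (a ℤ.+ ℤ.1ℤ) ℤ.* ℤ.1ℤ
  step = solveℤ-∀
falling-suc a (suc n) = ≡.trans (≡.cong (ℤ._* (a ℤ.+ ℤ.1ℤ ℤ.- + suc n)) (falling-suc a n))
  (step a (falling a n) (+ n))
  where
  step : ∀ a f n → (a ℤ.+ ℤ.1ℤ) ℤ.* f ℤ.* (a ℤ.+ ℤ.1ℤ ℤ.- (ℤ.1ℤ ℤ.+ n)) ≡ (a ℤ.+ ℤ.1ℤ) ℤ.* (f ℤ.* (a ℤ.- n))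
  step = solveℤ-∀

falling-pascal : ∀ a n → falling (a ℤ.+ ℤ.1ℤ) (suc n) ≡ falling a (suc n) ℤ.+ + suc n ℤ.* falling a n
falling-pascal a n = ≡.trans (falling-suc a n) (step a (falling a n) (+ n))
  where
  step : ∀ a f n → (a ℤ.+ ℤ.1ℤ) ℤ.* f ≡ f ℤ.* (a ℤ.- n) ℤ.+ (ℤ.1ℤ ℤ.+ n) ℤ.* f
  step = solveℤ-∀

falling-zero : ∀ n → falling ℤ.0ℤ (suc n) ≡ ℤ.0ℤ
falling-zero zero    = ≡.refl
falling-zero (suc n) = ≡.trans (≡.cong (ℤ._* (ℤ.0ℤ ℤ.- + suc n)) (falling-zero n)) (ℤₚ.*-zeroˡ (ℤ.0ℤ ℤ.- + suc n))

-- Characterises binomials before the division by n!, where Pascal's rule is a ring identity;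
-- `binom-unique` divides once and for all.
FactorialMultiple : ℤ → (ℕ → ℤ) → Set
FactorialMultiple a b = ∀ n → falling a n ≡ b n ℤ.* + (n !)

binom-unique : ∀ {a b} → FactorialMultiple a b → ∀ n → binom a (+ n) ≡ b n
binom-unique {a} {b} eq n = ≡.trans (≡.cong (λ f → (f ℤ./ℕ (n !)) {{n ℕₚ.!≢0}}) (eq n))
  (multiple-/ℕ (b n) (n !) {{n ℕₚ.!≢0}})

pos-! : ∀ n → + (suc n !) ≡ + suc n ℤ.* + (n !)
pos-! n = ℤₚ.pos-* (suc n) (n !)

-- The coefficients of (1 + t)^i and of (1 + t)^(-j) by Pascal's rule, which for the second is
-- solved for the term with the smaller top.
positiveBinomial negativeBinomial : ℕ → ℕ → ℤ
positiveBinomial zero    zero    = ℤ.1ℤ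
positiveBinomial zero    (suc n) = ℤ.0ℤ
positiveBinomial (suc i) zero    = ℤ.1ℤ
positiveBinomial (suc i) (suc n) = positiveBinomial i (suc n) ℤ.+ positiveBinomial i n
negativeBinomial zero    zero    = ℤ.1ℤ
negativeBinomial zero    (suc n) = ℤ.0ℤ
negativeBinomial (suc j) zero    = ℤ.1ℤ
negativeBinomial (suc j) (suc n) = negativeBinomial j (suc n) ℤ.- negativeBinomial (suc j) n

positive-multiple : ∀ i → FactorialMultiple (+ i) (positiveBinomial i)
positive-multiple zero    zero    = ≡.refl
positive-multiple zero    (suc n) = ≡.trans (falling-zero n) (≡.sym (ℤₚ.*-zeroˡ (+ (suc n !))))
positive-multiple (suc i) zero    = ≡.refl
positive-multiple (suc i) (suc n) = begin
  falling (+ suc i) (suc n)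
    ≡⟨ ≡.cong (λ a → falling a (suc n)) (ℤₚ.+-comm ℤ.1ℤ (+ i)) ⟩
  falling (+ i ℤ.+ ℤ.1ℤ) (suc n)
    ≡⟨ falling-pascal (+ i) n ⟩
  falling (+ i) (suc n) ℤ.+ + suc n ℤ.* falling (+ i) n
    ≡⟨ ≡.cong₂ (λ f g → f ℤ.+ + suc n ℤ.* g) (≡.trans (positive-multiple i (suc n))
         (≡.cong (positiveBinomial i (suc n) ℤ.*_) (pos-! n))) (positive-multiple i n) ⟩
  positiveBinomial i (suc n) ℤ.* (+ suc n ℤ.* + (n !)) ℤ.+ + suc n ℤ.* (positiveBinomial i n ℤ.* + (n !))
    ≡⟨ step (positiveBinomial i (suc n)) (positiveBinomial i n) (+ suc n) (+ (n !)) ⟩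
  positiveBinomial (suc i) (suc n) ℤ.* (+ suc n ℤ.* + (n !))
    ≡⟨ ≡.cong (positiveBinomial (suc i) (suc n) ℤ.*_) (pos-! n) ⟨
  positiveBinomial (suc i) (suc n) ℤ.* + (suc n !) ∎
  where
  open ≡.≡-Reasoning
  step : ∀ x y m f → x ℤ.* (m ℤ.* f) ℤ.+ m ℤ.* (y ℤ.* f) ≡ (x ℤ.+ y) ℤ.* (m ℤ.* f)
  step = solveℤ-∀

negative-multiple : ∀ j → FactorialMultiple (ℤ.- + j) (negativeBinomial j)
negative-multiple zero    zero    = ≡.refl
negative-multiple zero    (suc n) = ≡.trans (falling-zero n) (≡.sym (ℤₚ.*-zeroˡ (+ (suc n !))))
negative-multiple (suc j) zero    = ≡.refl
negative-multiple (suc j) (suc n) = begin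
  falling -[1+ j ] (suc n)
    ≡⟨ isolate (falling -[1+ j ] (suc n)) (+ suc n ℤ.* falling -[1+ j ] n) ⟩
  falling -[1+ j ] (suc n) ℤ.+ + suc n ℤ.* falling -[1+ j ] n ℤ.- + suc n ℤ.* falling -[1+ j ] n
    ≡⟨ ≡.cong (ℤ._- + suc n ℤ.* falling -[1+ j ] n) (falling-pascal -[1+ j ] n) ⟨
  falling (-[1+ j ] ℤ.+ ℤ.1ℤ) (suc n) ℤ.- + suc n ℤ.* falling -[1+ j ] n
    ≡⟨ ≡.cong (λ a → falling a (suc n) ℤ.- + suc n ℤ.* falling -[1+ j ] n) (successor j) ⟩
  falling (ℤ.- + j) (suc n) ℤ.- + suc n ℤ.* falling -[1+ j ] n
    ≡⟨ ≡.cong₂ (λ f g → f ℤ.- + suc n ℤ.* g) (≡.trans (negative-multiple j (suc n))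
         (≡.cong (negativeBinomial j (suc n) ℤ.*_) (pos-! n))) (negative-multiple (suc j) n) ⟩
  negativeBinomial j (suc n) ℤ.* (+ suc n ℤ.* + (n !)) ℤ.- + suc n ℤ.* (negativeBinomial (suc j) n ℤ.* + (n !))
    ≡⟨ step (negativeBinomial j (suc n)) (negativeBinomial (suc j) n) (+ suc n) (+ (n !)) ⟩
  negativeBinomial (suc j) (suc n) ℤ.* (+ suc n ℤ.* + (n !))
    ≡⟨ ≡.cong (negativeBinomial (suc j) (suc n) ℤ.*_) (pos-! n) ⟨
  negativeBinomial (suc j) (suc n) ℤ.* + (suc n !) ∎
  where
  open ≡.≡-Reasoning
  isolate : ∀ x y → x ≡ x ℤ.+ y ℤ.- y
  isolate = solveℤ-∀
  step : ∀ x y m f → x ℤ.* (m ℤ.* f) ℤ.- m ℤ.* (y ℤ.* f) ≡ (x ℤ.- y) ℤ.* (m ℤ.* f)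
  step = solveℤ-∀
  successor : ∀ j → -[1+ j ] ℤ.+ ℤ.1ℤ ≡ ℤ.- + j
  successor zero    = ≡.refl
  successor (suc j) = ≡.refl

binom-positive : ∀ i n → binom (+ i) (+ n) ≡ positiveBinomial i n
binom-positive i = binom-unique (positive-multiple i)

binom-negative : ∀ j n → binom (ℤ.- + j) (+ n) ≡ negativeBinomial j n
binom-negative j = binom-unique (negative-multiple j)

module IntegerImage {c ℓ} (R : CommutativeRing c ℓ) where
  open SymmetricFunctions R
  open CommutativeRing R hiding (zero)
  open RawSemiringDefs (RawRing.rawSemiring rawRing) using () renaming (_×_ to _×ℕ_)
  open RingProperties ring using (-0#≈0#; -‿+-comm)
  open SetoidReasoning setoid
  open MonoidMult +-monoid using (×-homo-+)

  fromℤ-⊖ : ∀ m n → fromℤ (m ⊖ n) ≈ m ×ℕ 1# + - (n ×ℕ 1#)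
  fromℤ-⊖ m       zero    = sym (trans (+-congˡ -0#≈0#) (+-identityʳ _))
  fromℤ-⊖ zero    (suc n) = sym (+-identityˡ _)
  fromℤ-⊖ (suc m) (suc n) = begin
    fromℤ (suc m ⊖ suc n)
      ≈⟨ reflexive (≡.cong fromℤ (ℤₚ.[1+m]⊖[1+n]≡m⊖n m n)) ⟩
    fromℤ (m ⊖ n)
      ≈⟨ fromℤ-⊖ m n ⟩
    m ×ℕ 1# + - (n ×ℕ 1#)
      ≈⟨ +-congˡ (trans (+-congʳ (-‿inverseʳ 1#)) (+-identityˡ _)) ⟨
    m ×ℕ 1# + ((1# + - 1#) + - (n ×ℕ 1#))
      ≈⟨ +-congˡ (trans (+-assoc _ _ _) (+-congˡ (-‿+-comm 1# (n ×ℕ 1#)))) ⟩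
    m ×ℕ 1# + (1# + - (1# + n ×ℕ 1#))
      ≈⟨ trans (sym (+-assoc _ _ _)) (+-congʳ (+-comm _ _)) ⟩
    (1# + m ×ℕ 1#) + - (1# + n ×ℕ 1#) ∎

  fromℤ-+ : ∀ x y → fromℤ (x ℤ.+ y) ≈ fromℤ x + fromℤ y
  fromℤ-+ (+ m)    (+ n)    = ×-homo-+ 1# m n
  fromℤ-+ (+ m)    -[1+ n ] = fromℤ-⊖ m (suc n)
  fromℤ-+ -[1+ m ] (+ n)    = trans (fromℤ-⊖ n (suc m)) (+-comm _ _)
  fromℤ-+ -[1+ m ] -[1+ n ] = trans
    (-‿cong (trans (reflexive (≡.cong (_×ℕ 1#) (≡.cong suc (≡.sym (ℕₚ.+-suc m n))))) (×-homo-+ 1# (suc m) (suc n))))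
    (sym (-‿+-comm _ _))

-- Grothendieck numerators and the dual columns

module Raising {c ℓ} (R : CommutativeRing c ℓ) (β : CommutativeRing.Carrier R) where
  open SymmetricFunctions R
  open CommutativeRing R hiding (zero)
  open RawSemiringDefs (RawRing.rawSemiring rawRing) using (_^_)
  open SetoidReasoning setoid
  open RingTheory R using (det; det-cong; det-transpose; det-lastRow; shifted)
  open SeriesRing R
  open AlternatingSeries R
  open Variables R
  open Functionals R
  open Straightening R
  open Spanning R
  open IntegerImage R
  private
    module SeriesR = CommutativeRing seriesRing

  -- The value on t^e (1 + β t)^j of the functional t^k ↦ B k.
  raise : ℕ → (ℕ → Carrier) → ℕ → Carrier
  raise zero    B e = B e
  raise (suc j) B e = raise j B e + β * raise j B (suc e)

  raise-cong : ∀ j {B B′} → (∀ e → B e ≈ B′ e) → ∀ e → raise j B e ≈ raise j B′ e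
  raise-cong zero    eq e = eq e
  raise-cong (suc j) eq e = +-cong (raise-cong j eq e) (*-congˡ (raise-cong j eq (suc e)))

  raise-linear : ∀ j x B B′ e → raise j (λ e → B e + x * B′ e) e ≈ raise j B e + x * raise j B′ e
  raise-linear zero    x B B′ e = refl
  raise-linear (suc j) x B B′ e = trans
    (+-cong (raise-linear j x B B′ e) (*-congˡ (raise-linear j x B B′ (suc e))))
    (combine _ _ _ _ _ _)
    where
    open NaturalCoefficients commutativeSemiring using (solve; _:=_; _:+_; _:*_)
    combine : ∀ b b′ x c c′ y → (b + x * b′) + y * (c + x * c′) ≈ (b + y * c) + x * (b′ + y * c′)
    combine = solve 6 (λ b b′ x c c′ y → (b :+ x :* b′) :+ y :* (c :+ x :* c′) := (b :+ y :* c) :+ x :* (b′ :+ y :* c′)) refl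

  -- The factors 1 + β t commute: the last one may act on the sequence first, which is the order
  -- needed to cancel factors against inverses.
  raise-suc : ∀ j B e → raise (suc j) B e ≈ raise j (raise 1 B) e
  raise-suc j B e = sym (trans (raise-linear j β B (B ∘ suc) e) (+-congˡ (*-congˡ (shift-suc j e))))
    where
    shift-suc : ∀ j e → raise j (B ∘ suc) e ≈ raise j B (suc e)
    shift-suc zero    e = refl
    shift-suc (suc j) e = +-cong (shift-suc j e) (*-congˡ (shift-suc j (suc e)))

  raising : ℕ → ℕ → Functional
  raising j p = record
    { apply = λ B → raise j B p ; apply-cong = λ eq → raise-cong j eq p ; apply-linear = λ x B B′ → raise-linear j x B B′ p }

  rowFunctional : Partition → ∀ n → Fin n → Functional
  rowFunctional lam n i = raising (toℕ i) (exponents lam n i)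

  -- The coefficient of t^a in t^e (1 + β t)^j, with j counted from 0 and e the entry of λ + δ at j.
  numeratorColumn : Partition → ∀ n → Fin n → ℕ → Carrier
  numeratorColumn lam n j a = raise (toℕ j) (λ e → indicator e a) (exponents lam n j)

  private
    entry : ℕ → ℕ → ℕ → Series
    entry p j i = var i S.^ p S.* (S.1# S.+ β · var i) S.^ j

  entry-suc : ∀ p j → entry p (suc j) 0 ≋ (entry p j 0 S.+ β · entry (suc p) j 0)
  entry-suc p j α = begin
    conv x (conv y z) α
      ≈⟨ conv-assoc x y z α ⟨
    conv (conv x y) z α
      ≈⟨ conv-cong {g = z} (λ γ → trans (SeriesR.distribˡ x S.1# (β · var 0) γ)
           (+-cong (SeriesR.*-identityʳ x γ) (trans (conv-·ʳ β x (var 0) γ) (*-congˡ (conv-comm x (var 0) γ)))))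
           (λ _ → refl) α ⟩
    conv (λ γ → x γ + β * conv (var 0) x γ) z α
      ≈⟨ conv-linearˡ β x (conv (var 0) x) z α ⟩
    conv x z α + β * conv (conv (var 0) x) z α ∎
    where
    x y z : Series
    x = var 0 S.^ p
    y = S.1# S.+ β · var 0
    z = y S.^ j

  entry-coefficient : ∀ j p a α → entry p j 0 (a ∷ α) ≈ raise j (λ e → indicator e a) p * S.1# α
  entry-coefficient zero    p a α = trans (SeriesR.*-identityʳ (var 0 S.^ p) (a ∷ α)) (var₀-power p a α)
  entry-coefficient (suc j) p a α = trans (entry-suc p j (a ∷ α))
    (trans (+-cong (entry-coefficient j p a α) (trans (*-congˡ (entry-coefficient j (suc p) a α)) (sym (*-assoc _ _ _))))
      (sym (distribʳ _ _ _)))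

  entry-shift : ∀ p j i → entry p j (suc i) ≋ shift (entry p j i)
  entry-shift p j i α = trans
    (conv-cong (power-suc i p) (λ γ → trans (power-cong j γ) (sym (shift-power (S.1# S.+ β · var i) j γ))) α)
    (sym (shift-* (var i S.^ p) ((S.1# S.+ β · var i) S.^ j) α))
    where
    base : (S.1# S.+ β · var (suc i)) ≋ shift (S.1# S.+ β · var i)
    base γ = sym (trans (shift-+ S.1# (β · var i) γ) (+-cong (shift-1 γ)
      (trans (shift-· β (var i) γ) (*-congˡ (sym (var-suc i γ))))))
    power-cong : ∀ j → ((S.1# S.+ β · var (suc i)) S.^ j) ≋ (shift (S.1# S.+ β · var i) S.^ j)
    power-cong zero    = λ _ → refl
    power-cong (suc j) = conv-cong base (power-cong j)

  numerator-alternant : ∀ lam n → EqualIn n (grothendieckNumerator β n lam) (alternant (numeratorColumn lam n))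
  numerator-alternant lam n = det-alternant (λ j → entry (exponents lam n j) (toℕ j)) (numeratorColumn lam n)
    (λ j → entry-coefficient (toℕ j) (exponents lam n j)) (λ j → entry-shift (exponents lam n j) (toℕ j))

  length-exponentList : ∀ κ n → length (exponentList κ n) ≡ n
  length-exponentList κ n = length-tabulate (exponents κ n)

  evaluate-sumOver : ∀ n f α → evaluate n f α ≡ sumOver (support n f) λ ν → coeffs f ν * coeff (schur ν) α
  evaluate-sumOver n f α = go (support n f)
    where
    go : ∀ L → foldr (λ ν F → (coeffs f ν · coeff (schur ν)) S.+ F) S.0# L α ≡ sumOver L λ ν → coeffs f ν * coeff (schur ν) α
    go []      = ≡.refl
    go (ν ∷ L) = ≡.cong (λ s → coeffs f ν * coeff (schur ν) α + s) (go L)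

  tensor-sumOver : ∀ {n} (Q : Fin n → Functional) L (x : Partition → Carrier) (X : Partition → Series) →
    tensor Q (λ α → sumOver L λ ν → x ν * X ν α) ≈ sumOver L λ ν → x ν * tensor Q (X ν)
  tensor-sumOver Q []      x X = tensor-zero Q _ λ _ _ → refl
  tensor-sumOver Q (ν ∷ L) x X = begin
    tensor Q (λ α → x ν * X ν α + sumOver L λ ν → x ν * X ν α)
      ≈⟨ tensor-cong Q (λ α _ → +-comm _ _) ⟩
    tensor Q (λ α → (sumOver L λ ν → x ν * X ν α) + x ν * X ν α)
      ≈⟨ tensor-linear Q (x ν) (λ α → sumOver L λ ν → x ν * X ν α) (X ν) ⟩
    tensor Q (λ α → sumOver L λ ν → x ν * X ν α) + x ν * tensor Q (X ν)
      ≈⟨ trans (+-congʳ (tensor-sumOver Q L x X)) (+-comm _ _) ⟩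
    x ν * tensor Q (X ν) + sumOver L (λ ν → x ν * tensor Q (X ν)) ∎

  indicator-symmetric : ∀ d a → indicator d a ≈ indicator a d
  indicator-symmetric d a with d ℕₚ.≟ a
  ... | yes ≡.refl = refl
  ... | no  d≢a    = trans (indicator-distinct (d≢a ∘ ≡.sym)) (sym (indicator-distinct d≢a))

  module _ (G : Partition → Λ̂) (isG : IsStableGrothendieck β G) where

    -- By a_δ s_ν = a_(ν+δ), the coefficient of s_κ in `G lam` is that of a_δ `G lam` at κ + δ, and
    -- this product is the numerator.
    grothendieck-coefficient : ∀ n lam κ → ℓ⟨ lam ⟩ ≤ n → ℓ⟨ κ ⟩ ≤ n →
      coeffs (G lam) κ ≈ alternant (numeratorColumn lam n) (exponentList κ n)
    grothendieck-coefficient n lam κ ℓlam ℓκ = begin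
      coeffs (G lam) κ
        ≈⟨ sumOver-within-δ n (bound (G lam) n) κ (coeffs (G lam)) ℓκ (finite (G lam) n κ ℓκ) ⟨
      sumOver L (λ ν → coeffs (G lam) ν * δ ν κ)
        ≈⟨ sumOver-cong L (λ {ν} ν∈ → *-congˡ (trans (δ-symmetric ν κ) (sym (trans
             (antisymmetrise-schur n ν (within-length n (bound (G lam) n) ν∈) α len)
             (monomialAlternant-exponents n ν κ (within-length n (bound (G lam) n) ν∈) ℓκ))))) ⟩
      sumOver L (λ ν → coeffs (G lam) ν * antisymmetrise n (coeff (schur ν)) α)
        ≈⟨ conv-sumOver (staircaseAlternant n) L (coeffs (G lam)) (coeff ∘ schur) α ⟨
      antisymmetrise n (λ γ → sumOver L λ ν → coeffs (G lam) ν * coeff (schur ν) γ) α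
        ≈⟨ conv-congIn n (λ γ l → sym (vandermonde-staircase n γ l))
             (λ γ _ → sym (reflexive (evaluate-sumOver n (G lam) γ))) α len ⟩
      conv (vandermonde n) (evaluate n (G lam)) α
        ≈⟨ isG lam n ℓlam α len ⟩
      grothendieckNumerator β n lam α
        ≈⟨ numerator-alternant lam n α len ⟩
      alternant (numeratorColumn lam n) α ∎
      where
      α : List ℕ
      α = exponentList κ n
      len : length α ≡ n
      len = length-exponentList κ n
      L : List Partition
      L = within n (bound (G lam) n)

    -- Up to transposition both are the determinant of the coefficients of t^(κ_j+n-j) in
    -- t^(λ_i+n-i) (1 + β t)^(i-1), with i and j counted from 1.
    tensor-monomialAlternant : ∀ n lam κ → ℓ⟨ lam ⟩ ≤ n → ℓ⟨ κ ⟩ ≤ n →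
      tensor (rowFunctional lam n) (monomialAlternant (exponents κ n)) ≈ coeffs (G lam) κ
    tensor-monomialAlternant n lam κ ℓlam ℓκ = begin
      tensor (rowFunctional lam n) (monomialAlternant (exponents κ n))
        ≈⟨ tensor-alternant (rowFunctional lam n) (indicator ∘ exponents κ n) ⟩
      det (λ i j → raise (toℕ i) (indicator (exponents κ n j)) (exponents lam n i))
        ≈⟨ det-cong _ _ (λ i j → raise-cong (toℕ i) (indicator-symmetric (exponents κ n j)) (exponents lam n i)) ⟩
      det (λ i j → numeratorColumn lam n i (exponents κ n j))
        ≈⟨ det-transpose (λ i j → numeratorColumn lam n j (exponents κ n i)) ⟩
      det (λ i j → numeratorColumn lam n j (exponents κ n i))
        ≈⟨ alternant-tabulate (numeratorColumn lam n) (exponents κ n) ⟨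
      alternant (numeratorColumn lam n) (exponentList κ n)
        ≈⟨ grothendieck-coefficient n lam κ ℓlam ℓκ ⟨
      coeffs (G lam) κ ∎

    tensor-alternating : ∀ n lam → ℓ⟨ lam ⟩ ≤ n → ∀ {B} → Alternating B → ∀ D →
      (∀ κ → ℓ⟨ κ ⟩ ≤ n → D < ∣ κ ∣ → B (exponentList κ n) ≈ 0#) →
      tensor (rowFunctional lam n) B ≈ sumOver (within n D) λ ν → coeffs (G lam) ν * B (exponentList ν n)
    tensor-alternating n lam ℓlam {B} alt D big = begin
      tensor Q B
        ≈⟨ tensor-cong Q (straighten alt n D big) ⟩
      tensor Q (λ α → sumOver (within n D) λ ν → B (exponentList ν n) * monomialAlternant (exponents ν n) α)
        ≈⟨ tensor-sumOver Q (within n D) (λ ν → B (exponentList ν n)) (λ ν → monomialAlternant (exponents ν n)) ⟩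
      sumOver (within n D) (λ ν → B (exponentList ν n) * tensor Q (monomialAlternant (exponents ν n)))
        ≈⟨ sumOver-cong (within n D) (λ {ν} ν∈ → trans
             (*-congˡ (tensor-monomialAlternant n lam ν ℓlam (within-length n D ν∈))) (*-comm _ _)) ⟩
      sumOver (within n D) (λ ν → coeffs (G lam) ν * B (exponentList ν n)) ∎
      where
      Q : Fin n → Functional
      Q = rowFunctional lam n

  raise-leading : ∀ j B p → (∀ e → p < e → B e ≈ 0#) → raise j B p ≈ B p
  raise-leading zero    B p above = refl
  raise-leading (suc j) B p above = trans
    (+-cong (raise-leading j B p above) (trans (*-congˡ (trans
      (raise-leading j B (suc p) λ e p<e → above e (ℕₚ.<-trans (ℕₚ.n<1+n p) p<e)) (above (suc p) (ℕₚ.n<1+n p)))) (zeroʳ β)))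
    (+-identityʳ _)

  -- The factors 1 + β t have constant term 1, and their other terms raise the total degree, where
  -- `B` is zero.
  tensor-leading : ∀ {n} (J p : Fin n → ℕ) B →
    (∀ α → length α ≡ n → sum (List.tabulate p) < sum α → B α ≈ 0#) →
    tensor (λ i → raising (J i) (p i)) B ≈ B (List.tabulate p)
  tensor-leading {zero}  J p B above = refl
  tensor-leading {suc n} J p B above = trans
    (raise-leading (J fzero) _ (p fzero) λ e p<e → trans
      (tensor-leading (J ∘ fsuc) (p ∘ fsuc) (λ α → B (e ∷ α)) λ α l p<α →
        above (e ∷ α) (≡.cong suc l) (ℕₚ.+-mono-< p<e p<α))
      (above (e ∷ List.tabulate (p ∘ fsuc)) (≡.cong suc (length-tabulate (p ∘ fsuc))) (ℕₚ.+-monoˡ-< _ p<e)))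
    (tensor-leading (J ∘ fsuc) (p ∘ fsuc) (λ α → B (p fzero ∷ α)) λ α l p<α →
      above (p fzero ∷ α) (≡.cong suc l) (ℕₚ.+-monoʳ-< (p fzero) p<α))

  -- By descending induction on the degree: the functional of κ picks out the
  -- coefficient at κ + δ up to terms of higher degree.
  alternating-from-tensor : ∀ n {X} → Alternating X → ∀ D → (∀ α → length α ≡ n → D < sum α → X α ≈ 0#) →
    (∀ κ → ℓ⟨ κ ⟩ ≤ n → tensor (rowFunctional κ n) X ≈ 0#) → EqualIn n X S.0#
  alternating-from-tensor n {X} alt D bound tensor≈0 α len = descend (suc D) α len (ℕₚ.m≤n+m (suc D) (sum α))
    where
    descend : ∀ m α → length α ≡ n → D < sum α ℕ.+ m → X α ≈ 0#
    descend zero    α len D< = bound α len (≡.subst (D <_) (ℕₚ.+-identityʳ _) D<)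
    descend (suc m) α len D< = alternating-zero alt n α len λ κ ℓκ same → trans
      (sym (tensor-leading toℕ (exponents κ n) X λ γ l κ<γ → descend m γ l
        (ℕₚ.<-≤-trans D< (≡.subst (ℕ._≤ sum γ ℕ.+ m) (≡.sym (ℕₚ.+-suc (sum α) m))
          (ℕₚ.+-monoˡ-≤ m (≡.subst (_< sum γ) same κ<γ))))))
      (tensor≈0 κ ℓκ)

  -- The coefficients of (1 + β t)^{-j}.
  inverseCoefficient : ℕ → ℕ → Carrier
  inverseCoefficient j k = fromℤ (negativeBinomial j k) * β ^ k

  -- The polynomial part of t^{μ_j + n - j} (1 + β / t)^{1 - j}, with j counted from 1.
  dualColumn : Partition → ∀ n → Fin n → ℕ → Carrier
  dualColumn mu n j = shifted (inverseCoefficient (toℕ j)) (exponents mu n j)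

  -- Pascal's rule in the form (1 + β t)^(-j-1) (1 + β t) = (1 + β t)^(-j): the sequence is indexed
  -- by K - e, so raising e reads the preceding coefficient.
  raise-inverse : ∀ j K e → raise 1 (shifted (inverseCoefficient (suc j)) K) e ≈ shifted (inverseCoefficient j) K e
  raise-inverse j K       zero    = step K
    where
    step : ∀ K → shifted (inverseCoefficient (suc j)) K 0 + β * shifted (inverseCoefficient (suc j)) K 1
      ≈ shifted (inverseCoefficient j) K 0
    step zero    = trans (trans (+-congˡ (zeroʳ β)) (+-identityʳ _)) (*-congʳ (reflexive (≡.cong fromℤ (unit j))))
      where
      unit : ∀ j → negativeBinomial (suc j) 0 ≡ negativeBinomial j 0
      unit zero    = ≡.refl
      unit (suc j) = ≡.refl
    step (suc k) = begin
      fromℤ (negativeBinomial j (suc k) ℤ.- negativeBinomial (suc j) k) * (β * β ^ k) + β * (fromℤ (negativeBinomial (suc j) k) * β ^ k)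
        ≈⟨ +-congˡ (trans (sym (*-assoc _ _ _)) (trans (*-congʳ (*-comm _ _)) (*-assoc _ _ _))) ⟩
      fromℤ (negativeBinomial j (suc k) ℤ.- negativeBinomial (suc j) k) * (β * β ^ k) + fromℤ (negativeBinomial (suc j) k) * (β * β ^ k)
        ≈⟨ distribʳ _ _ _ ⟨
      (fromℤ (negativeBinomial j (suc k) ℤ.- negativeBinomial (suc j) k) + fromℤ (negativeBinomial (suc j) k)) * (β * β ^ k)
        ≈⟨ *-congʳ (sym (fromℤ-+ (negativeBinomial j (suc k) ℤ.- negativeBinomial (suc j) k) (negativeBinomial (suc j) k))) ⟩
      fromℤ (negativeBinomial j (suc k) ℤ.- negativeBinomial (suc j) k ℤ.+ negativeBinomial (suc j) k) * (β * β ^ k)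
        ≈⟨ *-congʳ (reflexive (≡.cong fromℤ (cancel (negativeBinomial j (suc k)) (negativeBinomial (suc j) k)))) ⟩
      fromℤ (negativeBinomial j (suc k)) * (β * β ^ k) ∎
      where
      cancel : ∀ x y → x ℤ.- y ℤ.+ y ≡ x
      cancel = solveℤ-∀
  raise-inverse j zero    (suc e) = trans (+-identityˡ _) (zeroʳ β)
  raise-inverse j (suc K) (suc e) = raise-inverse j K e

  raise-inverse-≤ : ∀ i j K e → raise i (shifted (inverseCoefficient (i ℕ.+ j)) K) e ≈ shifted (inverseCoefficient j) K e
  raise-inverse-≤ zero    j K e = refl
  raise-inverse-≤ (suc i) j K e = trans (raise-suc i _ e)
    (trans (raise-cong i (raise-inverse (i ℕ.+ j) K) e) (raise-inverse-≤ i j K e))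

  inverse-indicator : ∀ K e → shifted (inverseCoefficient 0) K e ≈ indicator K e
  inverse-indicator zero    zero    = trans (*-identityʳ _) (+-identityʳ 1#)
  inverse-indicator (suc K) zero    = zeroˡ _
  inverse-indicator zero    (suc e) = refl
  inverse-indicator (suc K) (suc e) = inverse-indicator K e

  raise-inverse-≥ : ∀ i j K e → raise (j ℕ.+ i) (shifted (inverseCoefficient j) K) e ≈ raise i (indicator K) e
  raise-inverse-≥ i zero    K e = raise-cong i (inverse-indicator K) e
  raise-inverse-≥ i (suc j) K e = trans (raise-suc (j ℕ.+ i) _ e)
    (trans (raise-cong (j ℕ.+ i) (raise-inverse j K) e) (raise-inverse-≥ i j K e))

  raise-indicator-below : ∀ i K e → e ℕ.+ i < K → raise i (indicator K) e ≈ 0#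
  raise-indicator-below zero    K e e<K = indicator-distinct (ℕₚ.<⇒≢ (≡.subst (_< K) (ℕₚ.+-identityʳ e) e<K))
  raise-indicator-below (suc i) K e e<K = trans
    (+-cong (raise-indicator-below i K e (ℕₚ.<-trans (ℕₚ.n<1+n _) below))
            (trans (*-congˡ (raise-indicator-below i K (suc e) below)) (zeroʳ β)))
    (+-identityˡ _)
    where
    below : suc (e ℕ.+ i) < K
    below = ≡.subst (_< K) (ℕₚ.+-suc e i) e<K

  -- The entry is the coefficient of t^(K-e) in (1 + β t)^(i-j), with K and e the entries of μ + δ
  -- and λ + δ. It vanishes for i < j if e > K, for i > j if K - e exceeds the degree i - j, and for
  -- i = j unless K = e; this is the pattern of `det-crossing-δ`.
  tensor-dual : ∀ n lam mu → ℓ⟨ lam ⟩ ≤ n → ℓ⟨ mu ⟩ ≤ n →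
    tensor (rowFunctional lam n) (alternant (dualColumn mu n)) ≈ δ lam mu
  tensor-dual n lam mu ℓlam ℓmu = trans (tensor-alternant (rowFunctional lam n) (dualColumn mu n))
    (det-crossing-δ M lam mu ℓlam ℓmu upper lower
      (λ i lam≢mu → trans (diagonal i) (indicator-distinct (lam≢mu ∘ ℕₚ.+-cancelʳ-≡ _ _ _)))
      (λ i lam≡mu → trans (diagonal i) (≡.subst (λ p → indicator (exponents mu n i) (p ℕ.+ (n ∸ suc (toℕ i))) ≈ 1#)
        (≡.sym lam≡mu) (indicator-equal (exponents mu n i)))))
    where
    M : Fin n → Fin n → Carrier
    M i j = raise (toℕ i) (dualColumn mu n j) (exponents lam n i)
    diagonal : ∀ i → M i i ≈ indicator (exponents mu n i) (exponents lam n i)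
    diagonal i = ≡.subst (λ k → raise k (shifted (inverseCoefficient (toℕ i)) K) e ≈ indicator K e)
      (ℕₚ.+-identityʳ (toℕ i)) (raise-inverse-≥ 0 (toℕ i) K e)
      where
      K e : ℕ
      K = exponents mu n i
      e = exponents lam n i
    upper : ∀ i j → toℕ i < toℕ j → part mu (toℕ j) ≤ part lam (toℕ i) → M i j ≈ 0#
    upper i j i<j mu≤lam = trans
      (≡.subst (λ k → raise (toℕ i) (shifted (inverseCoefficient k) K) e ≈ shifted (inverseCoefficient (toℕ j ∸ toℕ i)) K e)
        (ℕₚ.m+[n∸m]≡n (ℕₚ.<⇒≤ i<j)) (raise-inverse-≤ (toℕ i) (toℕ j ∸ toℕ i) K e))
      (reflexive (shifted-< {A = R} (inverseCoefficient (toℕ j ∸ toℕ i)) (exponents-< i<j (toℕ<n j) mu≤lam)))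
      where
      K e : ℕ
      K = exponents mu n j
      e = exponents lam n i
    lower : ∀ i j → toℕ j < toℕ i → part lam (toℕ i) < part mu (toℕ j) → M i j ≈ 0#
    lower i j j<i lam<mu = trans
      (≡.subst (λ k → raise k (shifted (inverseCoefficient (toℕ j)) K) e ≈ raise (toℕ i ∸ toℕ j) (indicator K) e)
        (ℕₚ.m+[n∸m]≡n (ℕₚ.<⇒≤ j<i)) (raise-inverse-≥ (toℕ i ∸ toℕ j) (toℕ j) K e))
      (raise-indicator-below (toℕ i ∸ toℕ j) K e (≡.subst (_< K) (≡.sym sums) (ℕₚ.+-monoˡ-< (n ∸ suc (toℕ j)) lam<mu)))
      where
      K e : ℕ
      K = exponents mu n j
      e = exponents lam n i
      sums : e ℕ.+ (toℕ i ∸ toℕ j) ≡ part lam (toℕ i) ℕ.+ (n ∸ suc (toℕ j))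
      sums = ≡.trans (ℕₚ.+-assoc (part lam (toℕ i)) _ _) (≡.cong (part lam (toℕ i) ℕ.+_) (gap (toℕ i) (toℕ j) n j<i (toℕ<n i)))
        where
        gap : ∀ i j n → j < i → i < n → n ∸ suc i ℕ.+ (i ∸ j) ≡ n ∸ suc j
        gap (suc i) zero    (suc n) _         (s≤s i<n) = ℕₚ.m∸n+n≡m i<n
        gap (suc i) (suc j) (suc n) (s≤s j<i) (s≤s i<n) = gap i j n j<i i<n

  dualColumn-bounded : ∀ mu n → DegreeAtMost (sum (exponentList mu n)) (alternant (dualColumn mu n))
  dualColumn-bounded mu n = alternant-bounded (dualColumn mu n) (exponents mu n)
    λ j e K<e → reflexive (shifted-< {A = R} (inverseCoefficient (toℕ j)) K<e)

  -- One more variable raises all old exponents by one, which differences K - e do not notice. The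
  -- new column is the constant polynomial 1, nonzero only at the new exponent 0.
  dual-stable : ∀ d r mu ν → ℓ⟨ mu ⟩ ≤ r → ℓ⟨ ν ⟩ ≤ r →
    alternant (dualColumn mu (d ℕ.+ r)) (exponentList ν (d ℕ.+ r)) ≈ alternant (dualColumn mu r) (exponentList ν r)
  dual-stable zero    r mu ν ℓmu ℓν = refl
  dual-stable (suc d) r mu ν ℓmu ℓν = trans (begin
    alternant (dualColumn mu (suc n)) (exponentList ν (suc n))
      ≈⟨ alternant-tabulate (dualColumn mu (suc n)) (exponents ν (suc n)) ⟩
    det (λ i j → dualColumn mu (suc n) j (exponents ν (suc n) i))
      ≈⟨ det-transpose (λ i j → dualColumn mu (suc n) j (exponents ν (suc n) i)) ⟨
    det (λ i j → dualColumn mu (suc n) i (exponents ν (suc n) j))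
      ≈⟨ det-lastRow (λ i j → dualColumn mu (suc n) i (exponents ν (suc n) j))
           (λ j → reflexive (≡.trans (≡.cong₂ (λ k K → shifted (inverseCoefficient k) K (exponents ν (suc n) (inject₁ j))) (toℕ-fromℕ n) (last-exponent mu ℓmu))
                    (≡.cong (shifted (inverseCoefficient n) 0) (init-exponent ν j))))
           (trans (reflexive (≡.cong₂ (λ k K → shifted (inverseCoefficient k) K (exponents ν (suc n) (fromℕ n))) (toℕ-fromℕ n) (last-exponent mu ℓmu)))
             (trans (reflexive (≡.cong (shifted (inverseCoefficient n) 0) (last-exponent ν ℓν))) (unit n))) ⟩
    det (λ i j → dualColumn mu (suc n) (inject₁ i) (exponents ν (suc n) (inject₁ j)))
      ≈⟨ det-cong _ _ (λ i j → reflexive (≡.trans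
           (≡.cong₂ (λ K e → shifted (inverseCoefficient (toℕ (inject₁ i))) K e) (init-exponent mu i) (init-exponent ν j))
           (≡.cong (λ k → shifted (inverseCoefficient k) (exponents mu n i) (exponents ν n j)) (toℕ-inject₁ i)))) ⟩
    det (λ i j → dualColumn mu n i (exponents ν n j))
      ≈⟨ det-transpose (λ i j → dualColumn mu n j (exponents ν n i)) ⟩
    det (λ i j → dualColumn mu n j (exponents ν n i))
      ≈⟨ alternant-tabulate (dualColumn mu n) (exponents ν n) ⟨
    alternant (dualColumn mu n) (exponentList ν n) ∎)
    (dual-stable d r mu ν ℓmu ℓν)
    where
    n : ℕ
    n = d ℕ.+ r
    last-exponent : ∀ κ → ℓ⟨ κ ⟩ ≤ r → exponents κ (suc n) (fromℕ n) ≡ 0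
    last-exponent κ ℓκ = ≡.trans (≡.cong (λ k → part κ k ℕ.+ (n ∸ k)) (toℕ-fromℕ n))
      (≡.cong₂ ℕ._+_ (part-beyond κ (ℕₚ.≤-trans ℓκ (ℕₚ.m≤n+m r d))) (ℕₚ.n∸n≡0 n))
    init-exponent : ∀ κ i → exponents κ (suc n) (inject₁ i) ≡ suc (exponents κ n i)
    init-exponent κ i = ≡.trans (≡.cong (λ k → part κ k ℕ.+ (n ∸ k)) (toℕ-inject₁ i))
      (≡.trans (≡.cong (part κ (toℕ i) ℕ.+_) (∸-suc (toℕ<n i))) (ℕₚ.+-suc (part κ (toℕ i)) _))
    unit : ∀ n → inverseCoefficient n 0 ≈ 1#
    unit zero    = trans (*-identityʳ _) (+-identityʳ 1#)
    unit (suc n) = trans (*-identityʳ _) (+-identityʳ 1#)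

-- The entries of the determinant in the theorem

-- Brings the index of h into the form accepted by `form-hℤ`. The truncated subtractions are exact
-- because i, j < r and k ≤ K, so the two differences added in `identity` are zero.
perp-index : ∀ a m {i j r k} l → i < r → j < r → k ≤ m ℕ.+ (r ∸ suc j) →
  + a ℤ.- + m ℤ.- + i ℤ.+ + j ℤ.+ + (k ℕ.+ l) ≡ (a ℕ.+ (r ∸ suc i) ℕ.+ l) ⊖ (m ℕ.+ (r ∸ suc j) ∸ k)
perp-index a m {i} {j} {r} {k} l i<r j<r k≤K = begin
  + a ℤ.- + m ℤ.- + i ℤ.+ + j ℤ.+ (+ k ℤ.+ + l)
    ≡⟨ identity (+ a) (+ m) (+ i) (+ j) (+ k) (+ l) (+ I) (+ J) (+ s) ⟩
  (+ a ℤ.+ + I ℤ.+ + l) ℤ.- + s ℤ.+ (+ (J ℕ.+ suc j) ℤ.- + (I ℕ.+ suc i)) ℤ.+ (+ (s ℕ.+ k) ℤ.- + (m ℕ.+ J))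
    ≡⟨ ≡.cong₂ (λ x y → (+ a ℤ.+ + I ℤ.+ + l) ℤ.- + s ℤ.+ x ℤ.+ y)
         (vanish (≡.trans (ℕₚ.m∸n+n≡m j<r) (≡.sym (ℕₚ.m∸n+n≡m i<r)))) (vanish (ℕₚ.m∸n+n≡m k≤K)) ⟩
  (+ a ℤ.+ + I ℤ.+ + l) ℤ.- + s ℤ.+ ℤ.0ℤ ℤ.+ ℤ.0ℤ
    ≡⟨ ≡.trans (ℤₚ.+-identityʳ _) (ℤₚ.+-identityʳ _) ⟩
  + (a ℕ.+ I ℕ.+ l) ℤ.- + s
    ≡⟨ ℤₚ.m-n≡m⊖n (a ℕ.+ I ℕ.+ l) s ⟩
  (a ℕ.+ I ℕ.+ l) ⊖ s ∎
  where
  open ≡.≡-Reasoning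
  I J s : ℕ
  I = r ∸ suc i
  J = r ∸ suc j
  s = m ℕ.+ J ∸ k
  vanish : ∀ {x y} → x ≡ y → + x ℤ.- + y ≡ ℤ.0ℤ
  vanish {x} ≡.refl = ℤₚ.+-inverseʳ (+ x)
  identity : ∀ a m i j k l I J s → a ℤ.- m ℤ.- i ℤ.+ j ℤ.+ (k ℤ.+ l) ≡
    (a ℤ.+ I ℤ.+ l) ℤ.- s ℤ.+ ((J ℤ.+ (ℤ.1ℤ ℤ.+ j)) ℤ.- (I ℤ.+ (ℤ.1ℤ ℤ.+ i))) ℤ.+ ((s ℤ.+ k) ℤ.- (m ℤ.+ J))
  identity = solveℤ-∀

difference-< : ∀ {n k} → n < k → + n ℤ.- + k ≡ -[1+ k ∸ suc n ]
difference-< {n} {k} n<k = ≡.trans (ℤₚ.m-n≡m⊖n n k) (≡.trans (ℤₚ.⊖-< n<k) (≡.cong (λ d → ℤ.- + d) (∸-suc n<k)))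

difference-+ : ∀ k l → + (k ℕ.+ l) ℤ.- + k ≡ + l
difference-+ k l = ≡.trans (ℤₚ.m-n≡m⊖n (k ℕ.+ l) k)
  (≡.trans (ℤₚ.⊖-≥ (ℕₚ.m≤m+n k l)) (≡.cong +_ (ℕₚ.m+n∸m≡n k l)))

module PerpMatrix {c ℓ} (R : CommutativeRing c ℓ) (β : CommutativeRing.Carrier R) where
  open SymmetricFunctions R
  open CommutativeRing R hiding (zero)
  open SemiringSum semiring using (∑-comm; *-distribˡ-sum) renaming (sum to ∑)
  open RawSemiringDefs (RawRing.rawSemiring rawRing) using (_^_)
  open SetoidReasoning setoid
  open RingTheory R using (shifted; ∑-cong; ∑-zero; ∑-linear)
  open CauchySums R
  open Variables R
  open Functionals R
  open Duality R
  open Spanning R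
  open IntegerImage R
  open Raising R β
  open NaturalCoefficients commutativeSemiring using (solve; _:=_; _:+_; _:*_)

  shifted-*ʳ : ∀ u x b s → shifted (λ k → u k * x) b s ≈ shifted u b s * x
  shifted-*ʳ u x b       zero    = refl
  shifted-*ʳ u x zero    (suc s) = sym (zeroˡ x)
  shifted-*ʳ u x (suc b) (suc s) = shifted-*ʳ u x b s

  shifted-*ˡ : ∀ x u b s → shifted (λ k → x * u k) b s ≈ x * shifted u b s
  shifted-*ˡ x u b       zero    = refl
  shifted-*ˡ x u zero    (suc s) = sym (zeroʳ x)
  shifted-*ˡ x u (suc b) (suc s) = shifted-*ˡ x u b s

  -- The substitution k = K - b turns the coefficients of p_j into the sum over k of the theorem.
  cauchy-dual : ∀ u T K e →
    cauchy e (λ b m → shifted u K b * T m) ≈ ∑ {suc K} λ k → u (toℕ k) * shifted T e (K ∸ toℕ k)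
  cauchy-dual u T K e = begin
    cauchy e (λ b m → shifted u K b * T m)
      ≈⟨ cauchy-cong e (λ b m → sym (shifted-*ʳ u (T m) K b)) ⟩
    cauchy e (λ b m → shifted (λ k → u k * T m) K b)
      ≈⟨ cauchy-shifted e K (λ k m → u k * T m) ⟩
    cauchy K (λ s k → shifted (λ m → u k * T m) e s)
      ≈⟨ cauchy-cong K (λ s k → shifted-*ˡ (u k) T e s) ⟩
    cauchy K (λ s k → u k * shifted T e s)
      ≈⟨ cauchy-comm K (λ s k → u k * shifted T e s) ⟩
    cauchy K (λ k s → u k * shifted T e s) ∎

  -- The binomial expansion of t^e (1 + β t)^i; any number of terms above i will do, since the
  -- binomial coefficients vanish beyond i.
  raise-sum : ∀ i B e M → i < M →
    raise i B e ≈ ∑ {M} λ l → (fromℤ (positiveBinomial i (toℕ l)) * β ^ toℕ l) * B (e ℕ.+ toℕ l)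
  raise-sum zero B e (suc M) _ = sym (trans
    (+-cong (trans (*-congʳ (trans (*-identityʳ _) (+-identityʳ 1#))) (trans (*-identityˡ _)
               (reflexive (≡.cong B (ℕₚ.+-identityʳ e)))))
            (∑-zero {M} (λ l → (0# * (β * β ^ toℕ l)) * B (e ℕ.+ suc (toℕ l))) λ l →
               trans (*-congʳ (zeroˡ _)) (zeroˡ _)))
    (+-identityʳ _))
  raise-sum (suc i) B e (suc M) (s≤s i<M) = begin
    raise i B e + β * raise i B (suc e)
      ≈⟨ +-cong (raise-sum i B e (suc M) (ℕₚ.m≤n⇒m≤1+n i<M)) (*-congˡ (raise-sum i B (suc e) M i<M)) ⟩
    (term i e 0 + ∑ {M} (λ l → term i e (suc (toℕ l)))) + β * ∑ {M} (λ l → term i (suc e) (toℕ l))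
      ≈⟨ trans (+-assoc _ _ _) (+-cong (*-congʳ (*-congʳ (reflexive (≡.cong fromℤ (unit i)))))
           (sym (∑-linear {M} β (λ l → term i e (suc (toℕ l))) (λ l → term i (suc e) (toℕ l))))) ⟩
    term (suc i) e 0 + ∑ {M} (λ l → term i e (suc (toℕ l)) + β * term i (suc e) (toℕ l))
      ≈⟨ +-congˡ (∑-cong {M} (λ l → term i e (suc (toℕ l)) + β * term i (suc e) (toℕ l))
           (λ l → term (suc i) e (suc (toℕ l))) λ l → pascal (toℕ l)) ⟩
    ∑ {suc M} (λ l → term (suc i) e (toℕ l)) ∎
    where
    term : ℕ → ℕ → ℕ → Carrier
    term i e l = (fromℤ (positiveBinomial i l) * β ^ l) * B (e ℕ.+ l)
    unit : ∀ i → positiveBinomial i 0 ≡ positiveBinomial (suc i) 0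
    unit zero    = ≡.refl
    unit (suc i) = ≡.refl
    collect : ∀ x y b p t → (x * (b * p)) * t + b * ((y * p) * t) ≈ ((x + y) * (b * p)) * t
    collect = solve 5 (λ x y b p t → (x :* (b :* p)) :* t :+ b :* ((y :* p) :* t) := ((x :+ y) :* (b :* p)) :* t) refl
    pascal : ∀ l → term i e (suc l) + β * term i (suc e) l ≈ term (suc i) e (suc l)
    pascal l = begin
      term i e (suc l) + β * term i (suc e) l
        ≈⟨ +-congˡ (*-congˡ (*-congˡ (reflexive (≡.cong B (≡.sym (ℕₚ.+-suc e l)))))) ⟩
      term i e (suc l) + β * ((fromℤ (positiveBinomial i l) * β ^ l) * B (e ℕ.+ suc l))
        ≈⟨ collect (fromℤ (positiveBinomial i (suc l))) (fromℤ (positiveBinomial i l)) β (β ^ l) (B (e ℕ.+ suc l)) ⟩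
      ((fromℤ (positiveBinomial i (suc l)) + fromℤ (positiveBinomial i l)) * (β * β ^ l)) * B (e ℕ.+ suc l)
        ≈⟨ *-congʳ (*-congʳ (fromℤ-+ (positiveBinomial i (suc l)) (positiveBinomial i l))) ⟨
      term (suc i) e (suc l) ∎

  ∑-drop : ∀ k N (F : ℕ → Carrier) → k ≤ N → (∀ n → n < k → F n ≈ 0#) →
    ∑ {N} (λ n → F (toℕ n)) ≈ ∑ {N ∸ k} (λ l → F (k ℕ.+ toℕ l))
  ∑-drop zero    N       F k≤N       F≈0 = refl
  ∑-drop (suc k) (suc N) F (s≤s k≤N) F≈0 = trans
    (+-cong (F≈0 0 (s≤s z≤n)) (∑-drop k N (F ∘ suc) k≤N λ n n<k → F≈0 (suc n) (s≤s n<k)))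
    (+-identityˡ _)

  power-+ : ∀ x k l → x ^ (k ℕ.+ l) ≈ x ^ k * x ^ l
  power-+ x zero    l = sym (*-identityˡ _)
  power-+ x (suc k) l = trans (*-congˡ (power-+ x k l)) (sym (*-assoc _ _ _))

  -- Put n = k + l. For n < k the second binomial has a negative lower argument and is zero.
  -- Otherwise β^n splits, the sum over l expands the power of 1 + β t in row i, and the sum over k
  -- gives p_j.
  perpMatrix-represents : ∀ r lam mu i j →
    Represents (perpMatrix β r lam mu i j) (rowFunctional lam r i) (dualColumn mu r j)
  perpMatrix-represents r lam mu i′ j′ φ = begin
    form φ (perpMatrix β r lam mu i′ j′)
      ≈⟨ form-cong φ {perpMatrix β r lam mu i′ j′} {SumΛ.sum {N} (row ∘ toℕ)} (λ _ → refl) ⟩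
    form φ (SumΛ.sum {N} (row ∘ toℕ))
      ≈⟨ form-∑ φ {N} (row ∘ toℕ) ⟩
    ∑ {N} (λ n → form φ (row (toℕ n)))
      ≈⟨ ∑-cong {N} (λ n → form φ (row (toℕ n))) (λ n → ∑ {suc K} λ k → F (toℕ k) (toℕ n)) (λ n → row-form (toℕ n)) ⟩
    ∑ {N} (λ n → ∑ {suc K} λ k → F (toℕ k) (toℕ n))
      ≈⟨ ∑-comm {N} {suc K} (λ n k → F (toℕ k) (toℕ n)) ⟩
    ∑ {suc K} (λ k → ∑ {N} λ n → F (toℕ k) (toℕ n))
      ≈⟨ ∑-cong {suc K} (λ k → ∑ {N} λ n → F (toℕ k) (toℕ n))
           (λ k → inverseCoefficient j (toℕ k) * raise i (λ e → shifted T e (K ∸ toℕ k)) e₀)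
           (λ k → inner (toℕ k) (toℕ≤pred[n] k)) ⟩
    ∑ {suc K} (λ k → inverseCoefficient j (toℕ k) * raise i (λ e → shifted T e (K ∸ toℕ k)) e₀)
      ≈⟨ apply-∑ (raising i e₀) {suc K} (λ k → inverseCoefficient j (toℕ k)) (λ k e → shifted T e (K ∸ toℕ k)) ⟨
    raise i (λ e → ∑ {suc K} λ k → inverseCoefficient j (toℕ k) * shifted T e (K ∸ toℕ k)) e₀
      ≈⟨ raise-cong i (λ e → cauchy-dual (inverseCoefficient j) T K e) e₀ ⟨
    raise i (λ e → cauchy e λ b m → dualColumn mu r j′ b * T m) e₀ ∎
    where
    i j K N e₀ : ℕ
    i = toℕ i′
    j = toℕ j′
    K = exponents mu r j′
    N = suc (i ℕ.+ K)
    e₀ = exponents lam r i′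
    T : ℕ → Carrier
    T = form φ ∘ h
    coefficient : ℕ → ℕ → Carrier
    coefficient n k = fromℤ (binom (ℤ.- (+ j)) (+ k)) * fromℤ (binom (+ i) (+ n ℤ.- + k)) * β ^ n
    index : ℕ → ℤ
    index n = + part lam i ℤ.- + part mu j ℤ.- + i ℤ.+ + j ℤ.+ + n
    F : ℕ → ℕ → Carrier
    F k n = coefficient n k * form φ (hℤ (index n))
    entry : ℕ → ℕ → Λ
    entry n k = coefficient n k • hℤ (index n)
    row : ℕ → Λ
    row n = SumΛ.sum {suc K} λ k → entry n (toℕ k)
    row-form : ∀ n → form φ (row n) ≈ ∑ {suc K} λ k → F (toℕ k) n
    row-form n = trans (form-∑ φ {suc K} (λ k → entry n (toℕ k)))
      (∑-cong {suc K} (λ k → form φ (entry n (toℕ k))) (λ k → F (toℕ k) n)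
        λ k → form-• φ (coefficient n (toℕ k)) (hℤ (index n)))
    regroup : ∀ x y p q t → ((x * y) * (p * q)) * t ≈ (x * p) * ((y * q) * t)
    regroup = solve 5 (λ x y p q t → ((x :* y) :* (p :* q)) :* t := (x :* p) :* ((y :* q) :* t)) refl
    below : ∀ k n → n < k → F k n ≈ 0#
    below k n n<k = trans (*-congʳ (trans (*-congʳ (trans (*-congˡ
      (reflexive (≡.cong (fromℤ ∘ binom (+ i)) (difference-< n<k)))) (zeroʳ _))) (zeroˡ _))) (zeroˡ _)
    shape : ∀ k l → k ≤ K → F k (k ℕ.+ l) ≈
      inverseCoefficient j k * ((fromℤ (positiveBinomial i l) * β ^ l) * shifted T (e₀ ℕ.+ l) (K ∸ k))
    shape k l k≤K = trans
      (*-cong (*-cong (*-cong (reflexive (≡.cong fromℤ (binom-negative j k)))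
                              (reflexive (≡.cong fromℤ (≡.trans (≡.cong (binom (+ i)) (difference-+ k l)) (binom-positive i l)))))
                      (power-+ β k l))
              (trans (reflexive (≡.cong (form φ ∘ hℤ) (perp-index (part lam i) (part mu j) l (toℕ<n i′) (toℕ<n j′) k≤K)))
                       (form-hℤ φ (e₀ ℕ.+ l) (K ∸ k))))
      (regroup _ _ _ _ _)
    inner : ∀ k → k ≤ K → ∑ {N} (λ n → F k (toℕ n)) ≈
      inverseCoefficient j k * raise i (λ e → shifted T e (K ∸ k)) e₀
    inner k k≤K = begin
      ∑ {N} (λ n → F k (toℕ n))
        ≈⟨ ∑-drop k N (F k) (ℕₚ.m≤n⇒m≤1+n (ℕₚ.≤-trans k≤K (ℕₚ.m≤n+m K i))) (below k) ⟩
      ∑ {N ∸ k} (λ l → F k (k ℕ.+ toℕ l))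
        ≈⟨ ∑-cong {N ∸ k} (λ l → F k (k ℕ.+ toℕ l)) (λ l → inverseCoefficient j k * G (toℕ l)) (λ l → shape k (toℕ l) k≤K) ⟩
      ∑ {N ∸ k} (λ l → inverseCoefficient j k * G (toℕ l))
        ≈⟨ *-distribˡ-sum {N ∸ k} (inverseCoefficient j k) (λ l → G (toℕ l)) ⟨
      inverseCoefficient j k * ∑ {N ∸ k} (λ l → G (toℕ l))
        ≈⟨ *-congˡ (raise-sum i (λ e → shifted T e (K ∸ k)) e₀ (N ∸ k) i<N∸k) ⟨
      inverseCoefficient j k * raise i (λ e → shifted T e (K ∸ k)) e₀ ∎
      where
      G : ℕ → Carrier
      G l = (fromℤ (positiveBinomial i l) * β ^ l) * shifted T (e₀ ℕ.+ l) (K ∸ k)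
      -- The bound i + K on n leaves l ≤ i + K - k, which covers all l ≤ i.
      i<N∸k : i < N ∸ k
      i<N∸k = ≡.subst (i <_) (≡.sym (ℕₚ.+-∸-assoc (suc i) k≤K)) (s≤s (ℕₚ.m≤m+n i (K ∸ k)))

-- Pairings of the truncation and of the determinant

module PerpFormula {c ℓ} (R : CommutativeRing c ℓ) (β : CommutativeRing.Carrier R)
  (H : SymmetricFunctions.HallProduct R)
  (G : Partition → SymmetricFunctions.Λ̂ R) (isG : SymmetricFunctions.IsStableGrothendieck R β G)
  (g : Partition → SymmetricFunctions.Λ R) (dual : SymmetricFunctions.IsDualFamily R H G g) where

  open SymmetricFunctions R
  open HallProduct H
  open CommutativeRing R hiding (zero)
  open RingProperties ring using (x∙y⁻¹≈ε⇒x≈y; -1*x≈-x)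
  open SetoidReasoning setoid
  open SeriesRing R
  open AlternatingSeries R
  open Functionals R
  open Variables R
  open Duality R
  open Straightening R
  open Spanning R
  open HallTheory R H
  open Raising R β
  open PerpMatrix R β

  -- The truncation keeps the ν of length at most r, exactly those whose a_(ν+δ) occurs in r
  -- variables. The size bound coming from `G` is traded for the degree of f, outside of which all
  -- terms vanish as well.
  truncation-pairing : ∀ r lam f → ℓ⟨ lam ⟩ ≤ r →
    ⟨ truncation r (G lam) , f ⟩ ≈ tensor (rowFunctional lam r) (antisymmetrise r (coeff f))
  truncation-pairing r lam f ℓlam = begin
    ⟨ truncation r (G lam) , f ⟩
      ≈⟨ form-combination (pairingWith f) (coeffs (G lam)) (within r D) ⟩
    sumOver (within r D) (λ ν → coeffs (G lam) ν * ⟨ schur ν , f ⟩)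
      ≈⟨ sumOver-cong (within r D) (λ {ν} ν∈ → *-congˡ (schur-dual r ν f (within-length r D ν∈))) ⟩
    sumOver (within r D) (λ ν → coeffs (G lam) ν * B (exponentList ν r))
      ≈⟨ sumOver-within-change r D (degree f) (λ ν → coeffs (G lam) ν * B (exponentList ν r))
           (λ ν ℓν big → trans (*-congʳ (finite (G lam) r ν ℓν big)) (zeroˡ _))
           (λ ν ℓν big → trans (*-congˡ (antisymmetrise-vanish r (bounded f) ν ℓν big)) (zeroʳ _)) ⟩
    sumOver (within r (degree f)) (λ ν → coeffs (G lam) ν * B (exponentList ν r))
      ≈⟨ tensor-alternating G isG r lam ℓlam (antisymmetrise-alternating r (symmetric f)) (degree f)
           (antisymmetrise-vanish r (bounded f)) ⟨
    tensor (rowFunctional lam r) B ∎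
    where
    D : ℕ
    D = bound (G lam) r
    B : Series
    B = antisymmetrise r (coeff f)

  -- `⟨_,_⟩^` runs over all partitions up to the degree of g_μ; with N at least that degree, none of
  -- them is too long for N variables.
  dual-tensor : ∀ N lam mu → ℓ⟨ lam ⟩ ≤ N → degree (g mu) ≤ N →
    tensor (rowFunctional lam N) (antisymmetrise N (coeff (g mu))) ≈ δ lam mu
  dual-tensor N lam mu ℓlam D≤N = begin
    tensor (rowFunctional lam N) (antisymmetrise N (coeff (g mu)))
      ≈⟨ tensor-alternating G isG N lam ℓlam (antisymmetrise-alternating N (symmetric (g mu))) D
           (antisymmetrise-vanish N (bounded (g mu))) ⟩
    sumOver (within N D) (λ ν → coeffs (G lam) ν * antisymmetrise N (coeff (g mu)) (exponentList ν N))
      ≈⟨ sumOver-cong (within N D) (λ {ν} ν∈ → *-congˡ (schur-dual N ν (g mu) (within-length N D ν∈))) ⟨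
    sumOver (within N D) (λ ν → coeffs (G lam) ν * ⟨ schur ν , g mu ⟩)
      ≈⟨ reflexive (≡.cong (λ L → sumOver L (λ ν → coeffs (G lam) ν * ⟨ schur ν , g mu ⟩)) (within-all N D D≤N)) ⟩
    ⟨ G lam , g mu ⟩^
      ≈⟨ dual lam mu ⟩
    δ lam mu ∎
    where
    D : ℕ
    D = degree (g mu)

  dual-alternant-large : ∀ N mu → ℓ⟨ mu ⟩ ≤ N → degree (g mu) ≤ N →
    EqualIn N (antisymmetrise N (coeff (g mu))) (alternant (dualColumn mu N))
  dual-alternant-large N mu ℓmu D≤N α len = x∙y⁻¹≈ε⇒x≈y _ _ (trans (+-congˡ (sym (-1*x≈-x _)))
    (alternating-from-tensor N (alternating-combination (- 1#) alternatingB alternatingP) (sB ℕ.⊔ sP)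
      (λ γ _ big → trans
        (+-cong (boundedB γ (ℕₚ.≤-<-trans (ℕₚ.m≤m⊔n sB sP) big))
                (trans (*-congˡ (dualColumn-bounded mu N γ (ℕₚ.≤-<-trans (ℕₚ.m≤n⊔m sB sP) big))) (zeroʳ _)))
        (+-identityˡ 0#))
      (λ κ ℓκ → trans (tensor-linear (rowFunctional κ N) (- 1#) B P)
        (trans (+-cong (dual-tensor N κ mu ℓκ D≤N) (trans (*-congˡ (tensor-dual N κ mu ℓκ ℓmu)) (-1*x≈-x _)))
          (-‿inverseʳ _)))
      α len))
    where
    B P : Series
    B = antisymmetrise N (coeff (g mu))
    P = alternant (dualColumn mu N)
    sB sP : ℕ
    sB = sum (exponentList ∅ N) ℕ.+ degree (g mu)
    sP = sum (exponentList mu N)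
    alternatingB : Alternating B
    alternatingB = antisymmetrise-alternating N (symmetric (g mu))
    alternatingP : Alternating P
    alternatingP = alternant-alternating (dualColumn mu N)
    boundedB : DegreeAtMost sB B
    boundedB = conv-bounded {sum (exponentList ∅ N)} {degree (g mu)} {staircaseAlternant N} {coeff (g mu)}
      (alternant-bounded (indicator ∘ exponents ∅ N) (exponents ∅ N) λ j e d<e → indicator-distinct (ℕₚ.>⇒≢ d<e))
      (bounded (g mu))

  -- Each coefficient at κ + δ is the same in r and in N variables: on the left it is ⟨s_κ, g_μ⟩, on
  -- the right `dual-stable` applies. Alternating series are determined by these coefficients.
  dual-alternant : ∀ r mu → ℓ⟨ mu ⟩ ≤ r →
    EqualIn r (antisymmetrise r (coeff (g mu))) (alternant (dualColumn mu r))
  dual-alternant r mu ℓmu = alternating-unique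
    (antisymmetrise-alternating r (symmetric (g mu))) (alternant-alternating (dualColumn mu r)) r λ κ ℓκ → begin
      antisymmetrise r (coeff (g mu)) (exponentList κ r)
        ≈⟨ schur-dual r κ (g mu) ℓκ ⟨
      ⟨ schur κ , g mu ⟩
        ≈⟨ schur-dual N κ (g mu) (ℕₚ.≤-trans ℓκ r≤N) ⟩
      antisymmetrise N (coeff (g mu)) (exponentList κ N)
        ≈⟨ dual-alternant-large N mu (ℕₚ.≤-trans ℓmu r≤N) (ℕₚ.m≤m+n (degree (g mu)) r)
             (exponentList κ N) (length-exponentList κ N) ⟩
      alternant (dualColumn mu N) (exponentList κ N)
        ≈⟨ dual-stable (degree (g mu)) r mu κ ℓmu ℓκ ⟩
      alternant (dualColumn mu r) (exponentList κ r) ∎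
    where
    -- A sum rather than a maximum, to have the shape over which `dual-stable` recurses.
    N : ℕ
    N = degree (g mu) ℕ.+ r
    r≤N : r ≤ N
    r≤N = ℕₚ.m≤n+m r (degree (g mu))

  perp-pairing : ∀ r lam mu → ℓ⟨ lam ⟩ ≤ r → ℓ⟨ mu ⟩ ≤ r → ∀ k →
    ⟨ perpDeterminant β r lam mu , k ⟩ ≈ ⟨ truncation r (G lam) , g mu *Λ k ⟩
  perp-pairing r lam mu ℓlam ℓmu k = begin
    ⟨ perpDeterminant β r lam mu , k ⟩
      ≈⟨ det-pairing (perpMatrix β r lam mu) (rowFunctional lam r) (dualColumn mu r) (perpMatrix-represents r lam mu)
           (pairingWith k) (coeff k) (λ b _ → hProduct-dual b k) ⟩
    tensor (rowFunctional lam r) (conv (alternant (dualColumn mu r)) (coeff k))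
      ≈⟨ tensor-cong (rowFunctional lam r) (λ α len → trans
           (conv-congIn r {g = coeff k} (λ γ l → sym (dual-alternant r mu ℓmu γ l)) (λ _ _ → refl) α len)
           (conv-assoc (staircaseAlternant r) (coeff (g mu)) (coeff k) α)) ⟩
    tensor (rowFunctional lam r) (antisymmetrise r (coeff (g mu *Λ k)))
      ≈⟨ truncation-pairing r lam (g mu *Λ k) ℓlam ⟨
    ⟨ truncation r (G lam) , g mu *Λ k ⟩ ∎

-- The forward direction is the uniqueness of g_μ^⊥ G^r_λ, from nondegeneracy; the backward
-- direction is its existence.
proposition4p8 : ∀ {c ℓ} (R : CommutativeRing c ℓ) (β : CommutativeRing.Carrier R) →
    let open SymmetricFunctions R in
    (H : HallProduct) → let open HallProduct H in
    (G : Partition → Λ̂) → IsStableGrothendieck β G →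
    (g : Partition → Λ) → IsDualFamily H G g →
    (r : ℕ) → 1 ≤ r →
    (lam mu : Partition) → ℓ⟨ lam ⟩ ≤ r → ℓ⟨ mu ⟩ ≤ r →
    (p : Λ) →
    IsPerp (g mu) (truncation r (G lam)) p ⇔ (p ≈Λ perpDeterminant β r lam mu)
proposition4p8 R β H G isG g dual r _ lam mu ℓlam ℓmu p = mk⇔
  (λ perp → nondegenerate p (perpDeterminant β r lam mu) λ k →
    trans (perp k) (sym (perp-pairing r lam mu ℓlam ℓmu k)))
  (λ p≈det k → trans (HallProduct.⟨⟩-cong H {p} {perpDeterminant β r lam mu} {k} {k} p≈det (λ _ → refl))
    (perp-pairing r lam mu ℓlam ℓmu k))
  where
  open SymmetricFunctions R using (module HallProduct; perpDeterminant)
  open CommutativeRing R using (refl; sym; trans)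
  open HallTheory R H using (nondegenerate)
  open PerpFormula R β H G isG g dual using (perp-pairing)
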